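{- Fix an integer $k\ge 2$ and integers $1\le m_1\le\cdots\le m_k$. There exists $n_0=n_0(m_1,\ldots,m_k)$ such that, for every $n\ge n_0$ and every $n$-vertex tree $T$, \[ R\left(T,K_{m_1,\ldots,m_k}\right)\le (k-1)\bigl(R(T,K_{m_1,m_2})-1\bigr)+m_1 . \]
   Context: All graphs are finite and simple; copies of graphs are ordinary (not necessarily induced) copies. For graphs $J$ and $L$, $R(J,L)$ is the least $N$ such that every red--blue coloring of the edges of $K_N$ contains a red copy of $J$ or a blue copy of $L$. $K_{m_1,\ldots,m_k}$ is the complete $k$-partite graph with part sizes $m_1,\ldots,m_k$. -}

module Defs where

open import Data.Fin.Base using (Fin; zero; suc; inject₁; fromℕ; splitAt; finToFun; funToFin)
open import Data.Fin.Properties as Fin using (all?; any?; finToFun-funToFin)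
open import Data.List.Base using (List; []; _∷_; length; lookup; filter; sum; allFin)
open import Data.List.Membership.Propositional using (_∈_)
open import Data.List.Membership.Propositional.Properties using (∈-filter⁻; ∈-lookup)
open import Data.List.Properties using (length-tabulate)
open import Data.List.Relation.Unary.All as All using (All; []; _∷_)
open import Data.List.Relation.Unary.AllPairs using (AllPairs; []; _∷_)
open import Data.List.Relation.Unary.AllPairs.Properties using (filter⁺)
open import Data.List.Relation.Unary.Any using (here; there)
open import Data.List.Relation.Unary.Unique.Propositional using (Unique)
open import Data.List.Relation.Unary.Unique.Propositional.Properties using (allFin⁺)
open import Data.Nat.Base using (ℕ; zero; suc; _+_; _^_; _≤_; z≤n; s≤s)
open import Data.Nat.Properties using (≤-reflexive; ≤-trans; +-suc; +-mono-<; ≰⇒>; <⇒≱; _≤?_)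
open import Data.Product.Base using (∃; _×_; _,_; proj₁; proj₂)
open import Data.Sum.Base using (_⊎_; inj₁; inj₂; [_,_]′)
open import Function.Base using (_∘_; const)
open import Function.Definitions using (Injective)
open import Level using (0ℓ)
open import Relation.Binary.Construct.Closure.ReflexiveTransitive using (Star)
open import Relation.Binary.Core using (Rel)
open import Relation.Binary.Definitions using (Decidable; DecidableEquality; Symmetric; Irreflexive)
open import Relation.Binary.PropositionalEquality
  using (_≡_; _≢_; refl; sym; trans; cong; subst₂; _≗_; ≢-sym)
open import Relation.Nullary.Decidable using (Dec; yes; no; map′; ¬?; _×-dec_; _⊎-dec_; _→-dec_)
open import Relation.Nullary.Negation using (¬_; contradiction)

-- A simple graph with vertex set Fin n.
record Graph (n : ℕ) : Set₁ where
  field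
    Adj    : Rel (Fin n) 0ℓ
    Adj?   : Decidable Adj
    symm   : Symmetric Adj
    irrefl : Irreflexive _≡_ Adj

open Graph public

-- A copy of J in G is not required to be induced.
infix 4 _⊑_
_⊑_ : ∀ {m n} → Graph m → Graph n → Set
J ⊑ G = ∃ λ f → Injective _≡_ _≡_ f × (∀ u v → Adj J u v → Adj G (f u) (f v))

record Cycle {n} (G : Graph n) : Set where
  field
    {ℓ}         : ℕ
    vertex      : Fin (3 + ℓ) → Fin n
    distinct    : Injective _≡_ _≡_ vertex
    consecutive : ∀ i → Adj G (vertex (inject₁ i)) (vertex (suc i))
    closing     : Adj G (vertex (fromℕ (2 + ℓ))) (vertex zero)

record IsTree {n} (G : Graph n) : Set where
  field
    nonempty  : 1 ≤ n
    connected : ∀ u v → Star (Adj G) u v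
    acyclic   : ¬ Cycle G

-- Vertices are numbered part by part; `part ms v` is the part containing v.
part : (ms : List ℕ) → Fin (sum ms) → Fin (length ms)
part (m ∷ ms) v = [ const zero , suc ∘ part ms ]′ (splitAt m v)

completeMultipartite : (ms : List ℕ) → Graph (sum ms)
completeMultipartite ms = record
  { Adj    = λ u v → part ms u ≢ part ms v
  ; Adj?   = λ u v → ¬? (part ms u Fin.≟ part ms v)
  ; symm   = ≢-sym
  ; irrefl = λ { refl u≢u → u≢u refl }
  }

data Colour : Set where
  red blue : Colour

_≟ᶜ_ : DecidableEquality Colour
red  ≟ᶜ red  = yes refl
red  ≟ᶜ blue = no λ ()
blue ≟ᶜ red  = no λ ()
blue ≟ᶜ blue = yes refl

-- A colouring of the edges of the complete graph on Fin N; the values on the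
-- diagonal carry no meaning and are ignored by `colourClass`.
record EdgeColouring (N : ℕ) : Set where
  field
    colour     : Fin N → Fin N → Colour
    colour-sym : ∀ i j → colour i j ≡ colour j i

open EdgeColouring public

colourClass : ∀ {N} → EdgeColouring N → Colour → Graph N
colourClass c x = record
  { Adj    = λ i j → i ≢ j × colour c i j ≡ x
  ; Adj?   = λ i j → ¬? (i Fin.≟ j) ×-dec (colour c i j ≟ᶜ x)
  ; symm   = λ { {i} {j} (i≢j , cij) → ≢-sym i≢j , trans (colour-sym c j i) cij }
  ; irrefl = λ i≡j (i≢j , _) → i≢j i≡j
  }

HasCopies : ∀ {a b N} → Graph a → Graph b → EdgeColouring N → Set
HasCopies J L c = J ⊑ colourClass c red ⊎ L ⊑ colourClass c blue

Arrows : ∀ {a b} → ℕ → Graph a → Graph b → Set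
Arrows N J L = (c : EdgeColouring N) → HasCopies J L c

IsRamseyNumber : ∀ {a b} → Graph a → Graph b → ℕ → Set
IsRamseyNumber J L N = Arrows N J L × (∀ M → Arrows M J L → N ≤ M)

-- Existence of Ramsey numbers: Arrows is decidable by exhaustive search, and
-- Ramsey's theorem bounds the search for the least N.

private

  allFun? : ∀ {m n} {P : (Fin m → Fin n) → Set} → (∀ {f g} → f ≗ g → P f → P g) →
            (∀ f → Dec (P f)) → Dec (∀ f → P f)
  allFun? resp P? = map′ (λ h f → resp (finToFun-funToFin f) (h (funToFin f)))
                         (λ h k → h (finToFun k))
                         (all? (P? ∘ finToFun))

  anyFun? : ∀ {m n} {P : (Fin m → Fin n) → Set} → (∀ {f g} → f ≗ g → P f → P g) →
            (∀ f → Dec (P f)) → Dec (∃ P)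
  anyFun? resp P? = map′ (λ (k , p) → finToFun k , p)
                         (λ (f , p) → funToFin f , resp (sym ∘ finToFun-funToFin f) p)
                         (any? (P? ∘ finToFun))

  injective? : ∀ {m n} (f : Fin m → Fin n) → Dec (Injective _≡_ _≡_ f)
  injective? f = map′ (λ h {u} {v} → h u v) (λ h u v → h {u} {v})
    (all? λ u → all? λ v → (f u Fin.≟ f v) →-dec (u Fin.≟ v))

  _⊑?_ : ∀ {m n} (J : Graph m) (G : Graph n) → Dec (J ⊑ G)
  J ⊑? G = anyFun? resp λ f → injective? f ×-dec
             (all? λ u → all? λ v → Adj? J u v →-dec Adj? G (f u) (f v))
    where
    resp : ∀ {f g} → f ≗ g →
           Injective _≡_ _≡_ f × (∀ u v → Adj J u v → Adj G (f u) (f v)) →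
           Injective _≡_ _≡_ g × (∀ u v → Adj J u v → Adj G (g u) (g v))
    resp f≗g (inj , hom) =
      (λ {u} {v} gu≡gv → inj (trans (f≗g u) (trans gu≡gv (sym (f≗g v))))) ,
      (λ u v uv → subst₂ (Adj G) (f≗g u) (f≗g v) (hom u v uv))

  hasCopies-resp : ∀ {a b N} (J : Graph a) (L : Graph b) (c d : EdgeColouring N) →
                   (∀ i j → colour c i j ≡ colour d i j) → HasCopies J L c → HasCopies J L d
  hasCopies-resp J L c d c≗d =
    [ (λ (f , inj , hom) → inj₁ (f , inj , λ u v uv → move (hom u v uv)))
    , (λ (f , inj , hom) → inj₂ (f , inj , λ u v uv → move (hom u v uv))) ]′
    where
    move : ∀ {x i j} → i ≢ j × colour c i j ≡ x → i ≢ j × colour d i j ≡ x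
    move {_} {i} {j} (i≢j , cij) = i≢j , trans (sym (c≗d i j)) cij

  toColour : Fin 2 → Colour
  toColour zero    = red
  toColour (suc _) = blue

  fromColour : Colour → Fin 2
  fromColour red  = zero
  fromColour blue = suc zero

  to∘from : ∀ x → toColour (fromColour x) ≡ x
  to∘from red  = refl
  to∘from blue = refl

  Table : ℕ → Set
  Table N = Fin N → Fin (2 ^ N)

  decode : ∀ {N} → Table N → Fin N → Fin N → Colour
  decode h i j = toColour (finToFun (h i) j)

  encode : ∀ {N} → (Fin N → Fin N → Colour) → Table N
  encode c i = funToFin (fromColour ∘ c i)

  decode∘encode : ∀ {N} (c : Fin N → Fin N → Colour) i j → decode (encode c) i j ≡ c i j
  decode∘encode c i j =
    trans (cong toColour (finToFun-funToFin (fromColour ∘ c i) j)) (to∘from (c i j))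

  arrows? : ∀ {a b} N (J : Graph a) (L : Graph b) → Dec (Arrows N J L)
  arrows? N J L = map′ to (λ arr h s → arr (mk h s)) (allFun? resp P?)
    where
    Sym : Table N → Set
    Sym h = ∀ i j → decode h i j ≡ decode h j i

    mk : (h : Table N) → Sym h → EdgeColouring N
    mk h s = record { colour = decode h ; colour-sym = s }

    P : Table N → Set
    P h = (s : Sym h) → HasCopies J L (mk h s)

    P? : ∀ h → Dec (P h)
    P? h with all? (λ i → all? λ j → decode h i j ≟ᶜ decode h j i)
    ... | no ¬s = yes λ s → contradiction s ¬s
    ... | yes s = map′ (λ p s′ → hasCopies-resp J L (mk h s) (mk h s′) (λ _ _ → refl) p)
                       (λ p → p s)
                       ((J ⊑? colourClass (mk h s) red) ⊎-dec (L ⊑? colourClass (mk h s) blue))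

    resp : ∀ {g h} → g ≗ h → P g → P h
    resp {g} {h} g≗h p s = hasCopies-resp J L (mk g s′) (mk h s) eq (p s′)
      where
      eq : ∀ i j → decode g i j ≡ decode h i j
      eq i j = cong (λ k → toColour (finToFun k j)) (g≗h i)
      s′ : Sym g
      s′ i j = trans (eq i j) (trans (s i j) (sym (eq j i)))

    to : (∀ h → P h) → Arrows N J L
    to p c = hasCopies-resp J L (mk (encode (colour c)) s) c eq (p (encode (colour c)) s)
      where
      eq : ∀ i j → decode (encode (colour c)) i j ≡ colour c i j
      eq = decode∘encode (colour c)
      s : Sym (encode (colour c))
      s i j = trans (eq i j) (trans (colour-sym c i j) (sym (eq j i)))

  least : (P : ℕ → Set) → (∀ n → Dec (P n)) → ∀ n → P n →
          ∃ λ m → P m × (∀ k → P k → m ≤ k)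
  least P P? zero    p = zero , p , λ _ _ → z≤n
  least P P? (suc n) p with P? zero
  ... | yes p₀ = zero , p₀ , λ _ _ → z≤n
  ... | no ¬p₀ with least (P ∘ suc) (P? ∘ suc) n p
  ...   | m , pm , min = suc m , pm ,
          λ { zero p₀ → contradiction p₀ ¬p₀ ; (suc k) pk → s≤s (min k pk) }

  Clique : ∀ {N} → Graph N → ℕ → List (Fin N) → Set
  Clique G a xs = ∃ λ ys → length ys ≡ a × AllPairs (Adj G) ys × (∀ {y} → y ∈ ys → y ∈ xs)

  length-classes : ∀ {A : Set} (c : A → Colour) xs →
    length xs ≡ length (filter (λ y → c y ≟ᶜ red) xs) + length (filter (λ y → c y ≟ᶜ blue) xs)
  length-classes c [] = refl
  length-classes c (x ∷ xs) with c x
  ... | red  = cong suc (length-classes c xs)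
  ... | blue = trans (cong suc (length-classes c xs)) (sym (+-suc _ _))

  pigeonhole : ∀ m n {p q} → m + n ≤ p + q → m ≤ p ⊎ n ≤ q
  pigeonhole m n {p} {q} le with m ≤? p | n ≤? q
  ... | yes m≤p | _       = inj₁ m≤p
  ... | no _    | yes n≤q = inj₂ n≤q
  ... | no m≰p  | no n≰q  = contradiction le (<⇒≱ (+-mono-< (≰⇒> m≰p) (≰⇒> n≰q)))

  bound : ℕ → ℕ → ℕ
  bound zero    b       = 0
  bound (suc a) zero    = 0
  bound (suc a) (suc b) = suc (bound a (suc b) + bound (suc a) b)

  nbrs : ∀ {N} → EdgeColouring N → Fin N → Colour → List (Fin N) → List (Fin N)
  nbrs c x z = filter (λ y → colour c x y ≟ᶜ z)

  nbrs⁻ : ∀ {N} (c : EdgeColouring N) x z {xs y} → y ∈ nbrs c x z xs →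
          y ∈ xs × colour c x y ≡ z
  nbrs⁻ c x z = ∈-filter⁻ (λ y → colour c x y ≟ᶜ z)

  widen : ∀ {N} (c : EdgeColouring N) x z {xs} (G : Graph N) {n} →
          Clique G n (nbrs c x z xs) → Clique G n (x ∷ xs)
  widen c x z G (ys , len , cl , ⊆) = ys , len , cl , there ∘ proj₁ ∘ nbrs⁻ c x z ∘ ⊆

  extend : ∀ {N} (c : EdgeColouring N) x z {xs} → All (x ≢_) xs → ∀ {n} →
           Clique (colourClass c z) n (nbrs c x z xs) →
           Clique (colourClass c z) (suc n) (x ∷ xs)
  extend c x z x∉ (ys , len , cl , ⊆) =
    x ∷ ys , cong suc len ,
    All.tabulate (λ y∈ → let y∈xs , eq = nbrs⁻ c x z (⊆ y∈) in All.lookup x∉ y∈xs , eq) ∷ cl ,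
    λ { (here eq) → here eq ; (there y∈) → there (proj₁ (nbrs⁻ c x z (⊆ y∈))) }

  cliques : ∀ {N} (c : EdgeColouring N) a b xs → Unique xs → bound a b ≤ length xs →
            Clique (colourClass c red) a xs ⊎ Clique (colourClass c blue) b xs
  cliques c zero    b    xs _ _ = inj₁ ([] , refl , [] , λ ())
  cliques c (suc a) zero xs _ _ = inj₂ ([] , refl , [] , λ ())
  cliques c (suc a) (suc b) (x ∷ xs) (x∉ ∷ u) (s≤s le)
    with pigeonhole (bound a (suc b)) (bound (suc a) b)
           (≤-trans le (≤-reflexive (length-classes (colour c x) xs)))
  ... | inj₁ big = [ inj₁ ∘ extend c x red x∉ , inj₂ ∘ widen c x red (colourClass c blue) ]′
                     (cliques c a (suc b) (nbrs c x red xs) (filter⁺ _ u) big)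
  ... | inj₂ big = [ inj₁ ∘ widen c x blue (colourClass c red) , inj₂ ∘ extend c x blue x∉ ]′
                     (cliques c (suc a) b (nbrs c x blue xs) (filter⁺ _ u) big)

  clique-adj : ∀ {N} (G : Graph N) ys → AllPairs (Adj G) ys →
               ∀ i j → i ≢ j → Adj G (lookup ys i) (lookup ys j)
  clique-adj G (y ∷ ys) (p ∷ ps) zero    zero    i≢j = contradiction refl i≢j
  clique-adj G (y ∷ ys) (p ∷ ps) zero    (suc j) i≢j = All.lookup p (∈-lookup j)
  clique-adj G (y ∷ ys) (p ∷ ps) (suc i) zero    i≢j = symm G (All.lookup p (∈-lookup i))
  clique-adj G (y ∷ ys) (p ∷ ps) (suc i) (suc j) i≢j =
    clique-adj G ys ps i j (i≢j ∘ cong suc)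

  clique⇒⊑ : ∀ {a N} (J : Graph a) (G : Graph N) {xs} → Clique G a xs → J ⊑ G
  clique⇒⊑ J G (ys , refl , cl , _) = lookup ys , inj , hom
    where
    inj : Injective _≡_ _≡_ (lookup ys)
    inj {i} {j} eq with i Fin.≟ j
    ... | yes i≡j = i≡j
    ... | no  i≢j = contradiction (clique-adj G ys cl i j i≢j) (irrefl G eq)
    hom : ∀ u v → Adj J u v → Adj G (lookup ys u) (lookup ys v)
    hom u v uv = clique-adj G ys cl u v (λ u≡v → irrefl J u≡v uv)

  arrows-bound : ∀ {a b} (J : Graph a) (L : Graph b) → Arrows (bound a b) J L
  arrows-bound {a} {b} J L c =
    [ inj₁ ∘ clique⇒⊑ J (colourClass c red) , inj₂ ∘ clique⇒⊑ L (colourClass c blue) ]′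
      (cliques c a b (allFin _) (allFin⁺ _) (≤-reflexive (sym (length-tabulate _))))

-- Abstract, so that the search is never unfolded; only the specification
-- IsRamseyNumber is visible.
abstract
  ramseyNumber : ∀ {a b} (J : Graph a) (L : Graph b) → ∃ (IsRamseyNumber J L)
  ramseyNumber {a} {b} J L =
    least (λ N → Arrows N J L) (λ N → arrows? N J L) (bound a b) (arrows-bound J L)

R : ∀ {a b} → Graph a → Graph b → ℕ
R J L = proj₁ (ramseyNumber J L)

module Submission where

-- Let q = k - 1 and r = R(T, K_{m₁,m₂}). We show that already a colouring on q (r - 1) + 1 vertices has a
-- red T or a blue K_{m₁,…,m_k}; suppose it has neither.
--
-- Take j blue-complete parts A₁, …, A_j of large constant size. If many vertices have a few blue neighbours
-- in every A_i, pigeonhole gives j + 1 such parts. Otherwise almost every vertex is red to almost all of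
-- some A_i, which sorts the vertices into classes V_i. Cutting T at boundedly many vertices leaves small
-- pieces; the cut vertices fit into a red clique inside A_i and the pieces fit anywhere, by Chvátal's
-- argument. So |V_i| ≤ (1 + ε) n, which forces j = q and |V_i| ≥ (1 - ε) n. Re-root T at a vertex y where
-- all pending subtrees but one are small, while together they are not too small. If a vertex hosting y has
-- more than (1 + ε) n red neighbours, then the large subtree goes into some V_i and the small ones anywhere
-- in the red neighbourhood. Hence red degrees are at most (1 + ε) n, the V_i are nearly red cliques, and
-- almost all edges between them are blue.
--
-- Every remaining vertex with few blue neighbours in V_i is added to V_i; the set E of all others is
-- bounded. Let x_j ∈ V_j have as few red neighbours in E as possible, and let F_i be the set of those z ∈ E
-- that are blue to x_j for all j ≠ i. As z has at most (1 + ε) n red neighbours in all the V_j, averaging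
-- shows that there are at most |E| red edges between E and the x_j; as a z with at most one such edge lies
-- in some F_i, and in at least two if there is none, Σ |F_i| ≥ |E|. So some V_i ∪ F_i has r vertices and
-- contains a blue K_{m₁,m₂}, which extends to a blue K_{m₁,…,m_k} through the many vertices of each V_j, j
-- ≠ i, that have the same neighbours in E as x_j. The extension fails only for vertices whose number of
-- blue neighbours in V_i lies between the two thresholds for "few"; the thresholds are chosen, by
-- pigeonhole along a long decreasing sequence, so that these vertices have few blue neighbours in total,
-- and x_j is taken among the vertices that are blue to all of them.

open import Algebra.Properties.CommutativeSemigroup using (interchange)
open import Data.Bool.Base using (Bool; true; false; T; _∧_; _∨_; not; if_then_else_)
open import Data.Bool.Properties using (T-≡)
open import Data.Empty using (⊥; ⊥-elim)
open import Data.Fin.Base using (Fin; zero; suc; inject₁; fromℕ; punchIn; punchOut; splitAt; _↑ˡ_; _↑ʳ_;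
  finToFun; funToFin) renaming (join to joinFin)
open import Data.Fin.Properties using (_≟_; all?; any?; suc-injective; 0≢1+n; injective⇒≤; finToFun-funToFin;
  punchInᵢ≢i; punchIn-injective; punchIn-punchOut; splitAt-↑ˡ; splitAt-↑ʳ; join-splitAt; ↑ˡ-injective; ↑ʳ-injective)
open import Data.List.Base using (List; []; _∷_; _++_; length; tabulate)
open import Data.List.Properties using (length-tabulate)
open import Data.List.Relation.Unary.All as All using (All; []; _∷_)
import Data.List.Relation.Unary.All.Properties as Allₚ
open import Data.List.Relation.Unary.AllPairs using (AllPairs; []; _∷_)
import Data.List.Relation.Unary.AllPairs.Properties as AllPairsₚ
open import Data.List.Relation.Unary.Linked using (Linked; _∷_)
open import Data.Maybe.Base using (Maybe; just; nothing)
open import Data.Nat.Base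
open import Data.Nat.DivMod using (_/_; m/n*n≤m; m≡m%n+[m/n]*n; m%n<n)
open import Data.Nat.ListAction using () renaming (sum to sumᴸ)
open import Data.Nat.Properties hiding (suc-injective; 0≢1+n; _≟_)
open import Data.Product.Base using (∃; ∃₂; _×_; _,_; proj₁; proj₂)
open import Data.Sum.Base using (_⊎_; inj₁; inj₂; [_,_]′)
open import Data.Unit.Base using (tt)
open import Function.Base using (_∘_; case_of_)
open import Function.Bundles using (module Equivalence)
open import Function.Definitions using (Injective)
open import Relation.Binary.Construct.Closure.ReflexiveTransitive using (Star; ε; _◅_)
open import Relation.Binary.PropositionalEquality hiding ([_])
open import Relation.Nullary.Decidable.Core using (Dec; does; yes; no; map′; _×-dec_; _→-dec_)
open import Relation.Nullary.Negation using (¬_; contradiction)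
open import Defs using (Graph; Adj; Adj?; symm; irrefl; IsTree; _⊑_)

-- The number `q (r - 1) + 1` leaves no slack, so the bounded set E has to be shared out among the
-- classes without losing a single vertex. Estimates with errors of order εn still suffice: they
-- compare integers multiplied by n, and ε is chosen after the bound on |E|, so that the total error
-- stays below n and disappears.
--
-- Two thresholds are forced by a circle. A vertex with up to n/R blue neighbours in V_i may be red
-- to about as many vertices of V_j. The hosts in V_j consist of vertices with equal neighbours in
-- E, so only about n/2^|E| of them are guaranteed, and the bound on |E| grows with R: no single R
-- makes n/R small against the hosts. Hence a finer threshold is chosen after |E|, and the vertices
-- in between are made blue to the hosts by the choice of x_j.
--
-- This choice may raise the minimal number of red neighbours of x_j in E. The rise is under control
-- because the unrestricted minima are not small: if their sum were at most |E| - K, with K the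
-- order of the multipartite graph, then K vertices of E would be blue to a large set in every
-- class.

-- Linear arithmetic over ℕ by certificate: to derive a ≤ b from l ≤ r it suffices that, as polynomials
-- in the atoms ρ, a + r is coefficientwise at most b + l.
module Certificate where

  infixl 7 _⊠_
  infixr 6 _⊞_
  infix  4 _⩽_

  data Expr : Set where
    #_      : ℕ → Expr
    χ       : ℕ → Expr
    _⊞_ _⊠_ : Expr → Expr → Expr

  record Inequality : Set where
    constructor _⩽_
    field lhs rhs : Expr

  Mono Poly : Set
  Mono = List ℕ
  Poly = List (ℕ × Mono)

  -- Indices beyond the end of the list of atoms denote 0.
  get : List ℕ → ℕ → ℕ
  get []       _       = 0
  get (x ∷ _)  zero    = x
  get (_ ∷ xs) (suc i) = get xs i

  module _ (ρ : List ℕ) where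
    ⟦_⟧ : Expr → ℕ
    ⟦ # c ⟧   = c
    ⟦ χ i ⟧   = get ρ i
    ⟦ a ⊞ b ⟧ = ⟦ a ⟧ + ⟦ b ⟧
    ⟦ a ⊠ b ⟧ = ⟦ a ⟧ * ⟦ b ⟧

    ⟦_⟧ᵐ : Mono → ℕ
    ⟦ [] ⟧ᵐ    = 1
    ⟦ i ∷ m ⟧ᵐ = get ρ i * ⟦ m ⟧ᵐ

    ⟦_⟧ᵖ : Poly → ℕ
    ⟦ [] ⟧ᵖ          = 0
    ⟦ (c , m) ∷ p ⟧ᵖ = c * ⟦ m ⟧ᵐ + ⟦ p ⟧ᵖ

    ⟦_⟧≤ : Inequality → Set
    ⟦ a ⩽ b ⟧≤ = ⟦ a ⟧ ≤ ⟦ b ⟧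

  insert : ℕ → Mono → Mono
  insert i [] = i ∷ []
  insert i (j ∷ m) = if i ≤ᵇ j then i ∷ j ∷ m else j ∷ insert i m

  mulMono : Mono → Mono → Mono
  mulMono []      n = n
  mulMono (i ∷ m) n = insert i (mulMono m n)

  mulTerm : ℕ → Mono → Poly → Poly
  mulTerm c m []            = []
  mulTerm c m ((d , n) ∷ p) = (c * d , mulMono m n) ∷ mulTerm c m p

  mulPoly : Poly → Poly → Poly
  mulPoly []            q = []
  mulPoly ((c , m) ∷ p) q = mulTerm c m q ++ mulPoly p q

  norm : Expr → Poly
  norm (# c)    = (c , []) ∷ []
  norm (χ i)    = (1 , i ∷ []) ∷ []
  norm (a ⊞ b)  = norm a ++ norm b
  norm (a ⊠ b)  = mulPoly (norm a) (norm b)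

  eqMono : Mono → Mono → Bool
  eqMono []      []      = true
  eqMono (i ∷ m) (j ∷ n) = (i ≡ᵇ j) ∧ eqMono m n
  eqMono _       _       = false

  remove : ℕ → Mono → Poly → Maybe Poly
  remove zero m q = just q
  remove (suc c) m [] = nothing
  remove (suc c) m ((d , n) ∷ q) with eqMono m n
  ... | true with suc c ≤ᵇ d
  ...   | true  = just ((d ∸ suc c , n) ∷ q)
  ...   | false = remove (suc c ∸ d) m q
  remove (suc c) m ((d , n) ∷ q) | false with remove (suc c) m q
  ...   | just q′ = just ((d , n) ∷ q′)
  ...   | nothing = nothing

  leq : Poly → Poly → Bool
  leq []            q = true
  leq ((c , m) ∷ p) q with remove c m q
  ... | just q′ = leq p q′
  ... | nothing = false

  module _ (ρ : List ℕ) where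
    private
      mid : ∀ a b c → a * (b * c) ≡ b * (a * c)
      mid a b c = trans (sym (*-assoc a b c)) (trans (cong (_* c) (*-comm a b)) (*-assoc b a c))

    insert-sound : ∀ i m → ⟦ ρ ⟧ᵐ (insert i m) ≡ get ρ i * ⟦ ρ ⟧ᵐ m
    insert-sound i [] = refl
    insert-sound i (j ∷ m) with i ≤ᵇ j
    ... | true  = refl
    ... | false = trans (cong (get ρ j *_) (insert-sound i m)) (mid (get ρ j) (get ρ i) _)

    mulMono-sound : ∀ m n → ⟦ ρ ⟧ᵐ (mulMono m n) ≡ ⟦ ρ ⟧ᵐ m * ⟦ ρ ⟧ᵐ n
    mulMono-sound []      n = sym (+-identityʳ _)
    mulMono-sound (i ∷ m) n = trans (insert-sound i (mulMono m n))
      (trans (cong (get ρ i *_) (mulMono-sound m n)) (sym (*-assoc (get ρ i) _ _)))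

    mulTerm-sound : ∀ c m p → ⟦ ρ ⟧ᵖ (mulTerm c m p) ≡ c * ⟦ ρ ⟧ᵐ m * ⟦ ρ ⟧ᵖ p
    mulTerm-sound c m [] = sym (*-zeroʳ (c * ⟦ ρ ⟧ᵐ m))
    mulTerm-sound c m ((d , n) ∷ p) = trans
      (cong₂ _+_ (trans (cong (c * d *_) (mulMono-sound m n)) ([m*n]*[o*p]≡[m*o]*[n*p] c d _ _))
                 (mulTerm-sound c m p))
      (sym (*-distribˡ-+ (c * ⟦ ρ ⟧ᵐ m) _ _))

    ++-sound : ∀ p q → ⟦ ρ ⟧ᵖ (p ++ q) ≡ ⟦ ρ ⟧ᵖ p + ⟦ ρ ⟧ᵖ q
    ++-sound []            q = refl
    ++-sound ((c , m) ∷ p) q = trans (cong (c * ⟦ ρ ⟧ᵐ m +_) (++-sound p q)) (sym (+-assoc (c * ⟦ ρ ⟧ᵐ m) _ _))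

    mulPoly-sound : ∀ p q → ⟦ ρ ⟧ᵖ (mulPoly p q) ≡ ⟦ ρ ⟧ᵖ p * ⟦ ρ ⟧ᵖ q
    mulPoly-sound []            q = refl
    mulPoly-sound ((c , m) ∷ p) q = trans (++-sound (mulTerm c m q) (mulPoly p q))
      (trans (cong₂ _+_ (mulTerm-sound c m q) (mulPoly-sound p q))
             (sym (*-distribʳ-+ (⟦ ρ ⟧ᵖ q) (c * ⟦ ρ ⟧ᵐ m) _)))

    norm-sound : ∀ e → ⟦ ρ ⟧ᵖ (norm e) ≡ ⟦ ρ ⟧ e
    norm-sound (# c) = trans (+-identityʳ _) (*-identityʳ c)
    norm-sound (χ i) = trans (+-identityʳ _) (trans (+-identityʳ _) (*-identityʳ _))
    norm-sound (a ⊞ b)  = trans (++-sound (norm a) (norm b)) (cong₂ _+_ (norm-sound a) (norm-sound b))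
    norm-sound (a ⊠ b)  = trans (mulPoly-sound (norm a) (norm b)) (cong₂ _*_ (norm-sound a) (norm-sound b))

    eqMono-sound : ∀ m n → eqMono m n ≡ true → m ≡ n
    eqMono-sound []      []      _ = refl
    eqMono-sound (i ∷ m) (j ∷ n) e with i ≡ᵇ j in eq
    ... | true = cong₂ _∷_ (≡ᵇ⇒≡ i j (subst (T) (sym eq) tt)) (eqMono-sound m n e)

    private
      swap : ∀ a b c → a + (b + c) ≡ b + (a + c)
      swap a b c = trans (sym (+-assoc a b c)) (trans (cong (_+ c) (+-comm a b)) (+-assoc b a c))

    remove-sound : ∀ c m q q′ → remove c m q ≡ just q′ → c * ⟦ ρ ⟧ᵐ m + ⟦ ρ ⟧ᵖ q′ ≤ ⟦ ρ ⟧ᵖ q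
    remove-sound zero    m q q′ refl = ≤-refl
    remove-sound (suc c) m ((d , n) ∷ q) q′ e with eqMono m n in eq
    ... | true with suc c ≤ᵇ d in le
    remove-sound (suc c) m ((d , n) ∷ q) q′ refl | true | true
      rewrite eqMono-sound m n eq = ≤-reflexive (trans (sym (+-assoc (suc c * ⟦ ρ ⟧ᵐ n) _ _))
        (cong (_+ ⟦ ρ ⟧ᵖ q) (trans (sym (*-distribʳ-+ (⟦ ρ ⟧ᵐ n) (suc c) (d ∸ suc c)))
          (cong (_* ⟦ ρ ⟧ᵐ n) (m+[n∸m]≡n (≤ᵇ⇒≤ (suc c) d (subst T (sym le) tt)))))))
    remove-sound (suc c) m ((d , n) ∷ q) q′ e | true | false
      rewrite eqMono-sound m n eq = ≤-trans
        (+-monoˡ-≤ (⟦ ρ ⟧ᵖ q′) (*-monoˡ-≤ (⟦ ρ ⟧ᵐ n) (m≤n+m∸n (suc c) d)))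
        (≤-trans (≤-reflexive (trans (cong (_+ ⟦ ρ ⟧ᵖ q′) (*-distribʳ-+ (⟦ ρ ⟧ᵐ n) d (suc c ∸ d)))
          (+-assoc (d * ⟦ ρ ⟧ᵐ n) _ _)))
          (+-monoʳ-≤ (d * ⟦ ρ ⟧ᵐ n) (remove-sound (suc c ∸ d) n q q′ e)))
    remove-sound (suc c) m ((d , n) ∷ q) q′ e | false with remove (suc c) m q in eq′
    remove-sound (suc c) m ((d , n) ∷ q) .((d , n) ∷ q″) refl | false | just q″ =
      ≤-trans (≤-reflexive (swap (suc c * ⟦ ρ ⟧ᵐ m) (d * ⟦ ρ ⟧ᵐ n) _)) (+-monoʳ-≤ (d * ⟦ ρ ⟧ᵐ n) (remove-sound (suc c) m q q″ eq′))

    leq-sound : ∀ p q → leq p q ≡ true → ⟦ ρ ⟧ᵖ p ≤ ⟦ ρ ⟧ᵖ q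
    leq-sound []            q _ = z≤n
    leq-sound ((c , m) ∷ p) q e with remove c m q in eq
    ... | just q′ = ≤-trans (+-monoʳ-≤ (c * ⟦ ρ ⟧ᵐ m) (leq-sound p q′ e)) (remove-sound c m q q′ eq)

  Derives : Inequality → Inequality → Bool
  Derives (l ⩽ r) (a ⩽ b) = leq (norm (a ⊞ r)) (norm (b ⊞ l))

  opaque
    linear : ∀ ρ goal hyp {_ : T (Derives hyp goal)} → ⟦ ρ ⟧≤ hyp → ⟦ ρ ⟧≤ goal
    linear ρ (a ⩽ b) (l ⩽ r) {ok} h = +-cancelʳ-≤ (⟦ ρ ⟧ r) _ _ (≤-trans
      (subst₂ _≤_ (norm-sound ρ (a ⊞ r)) (norm-sound ρ (b ⊞ l))
        (leq-sound ρ (norm (a ⊞ r)) (norm (b ⊞ l)) (Equivalence.to T-≡ ok)))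
      (+-monoʳ-≤ (⟦ ρ ⟧ b) h))

open Certificate using (_⩽_; #_; χ; _⊞_; _⊠_; linear)

infixr 5 _⊕_
infixr 6 _⊛_

_⊕_ : ∀ {a b c d} → a ≤ b → c ≤ d → a + c ≤ b + d
_⊕_ = +-mono-≤

-- `k` need not be a numeral: multiplying a hypothesis by a variable quantity is how linear
-- certificates reach products.
_⊛_ : ∀ {a b} k → a ≤ b → k * a ≤ k * b
k ⊛ h = *-monoʳ-≤ k h

eq≤ : ∀ {a b : ℕ} → a ≡ b → a ≤ b
eq≤ = ≤-reflexive

eq≥ : ∀ {a b : ℕ} → a ≡ b → b ≤ a
eq≥ e = ≤-reflexive (sym e)

1≰0 : 1 ≤ 0 → ⊥
1≰0 ()

-- Vertex sets and their cardinalities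

VSet : ℕ → Set
VSet N = Fin N → Bool

infix 4 _∈_ _∉_ _⊆_ _∈?_

-- A record instead of the bare equation, so that unification recovers `x` and `A` from the type;
-- the set operations are opaque for the same reason.
record _∈_ {N} (x : Fin N) (A : VSet N) : Set where
  constructor mem
  field holds : A x ≡ true
open _∈_ public

_∉_ : ∀ {N} → Fin N → VSet N → Set
x ∉ A = ¬ x ∈ A

_∈?_ : ∀ {N} (x : Fin N) (A : VSet N) → x ∈ A ⊎ x ∉ A
x ∈? A with A x in eq
... | true  = inj₁ (mem eq)
... | false = inj₂ λ (mem e) → case trans (sym eq) e of λ ()

∉⇒false : ∀ {N} {x : Fin N} {A} → x ∉ A → A x ≡ false
∉⇒false {x = x} {A} h with A x in eq
... | true  = ⊥-elim (h (mem eq))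
... | false = refl

false⇒∉ : ∀ {N} {x : Fin N} {A} → A x ≡ false → x ∉ A
false⇒∉ e (mem t) = case trans (sym e) t of λ ()

_⊆_ : ∀ {N} → VSet N → VSet N → Set
A ⊆ B = ∀ {x} → x ∈ A → x ∈ B

Disjoint : ∀ {N} → VSet N → VSet N → Set
Disjoint A B = ∀ {x} → x ∈ A → x ∈ B → ⊥

infixr 7 _∩_
infixr 6 _∪_
infixl 6 _∖_

opaque
  _∩_ _∪_ _∖_ : ∀ {N} → VSet N → VSet N → VSet N
  (A ∩ B) x = A x ∧ B x
  (A ∪ B) x = A x ∨ B x
  (A ∖ B) x = A x ∧ not (B x)

  full ∅ : ∀ {N} → VSet N
  full _ = true
  ∅ _ = false

  ⁅_⁆ : ∀ {N} → Fin N → VSet N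
  ⁅ x ⁆ y = does (x ≟ y)


  ∈full : ∀ {N} {x : Fin N} → x ∈ full
  ∈full = mem refl

  ∩⁺ : ∀ {N} {x : Fin N} {A B} → x ∈ A → x ∈ B → x ∈ A ∩ B
  ∩⁺ (mem p) (mem q) = mem (cong₂ _∧_ p q)

  ∩⁻ : ∀ {N} {x : Fin N} {A B} → x ∈ A ∩ B → x ∈ A × x ∈ B
  ∩⁻ {x = x} {A} {B} (mem p) with A x in eq
  ... | true = mem eq , mem p

  ∩₁ : ∀ {N} {x : Fin N} {A B} → x ∈ A ∩ B → x ∈ A
  ∩₁ h = proj₁ (∩⁻ h)

  ∩₂ : ∀ {N} {x : Fin N} {A B} → x ∈ A ∩ B → x ∈ B
  ∩₂ h = proj₂ (∩⁻ h)

  ∪ˡ : ∀ {N} {x : Fin N} {A B} → x ∈ A → x ∈ A ∪ B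
  ∪ˡ {x = x} {A} {B} (mem p) = mem (cong (_∨ B x) p)

  ∪ʳ : ∀ {N} {x : Fin N} {A B} → x ∈ B → x ∈ A ∪ B
  ∪ʳ {x = x} {A} {B} (mem p) with A x in eq
  ... | true  = mem (cong (_∨ B x) eq)
  ... | false = mem (trans (cong (_∨ B x) eq) p)

  ∪⁻ : ∀ {N} {x : Fin N} {A B} → x ∈ A ∪ B → x ∈ A ⊎ x ∈ B
  ∪⁻ {x = x} {A} (mem p) with A x in eq
  ... | true  = inj₁ (mem eq)
  ... | false = inj₂ (mem p)

  ∖⁺ : ∀ {N} {x : Fin N} {A B} → x ∈ A → x ∉ B → x ∈ A ∖ B
  ∖⁺ {x = x} {A} {B} (mem p) q = mem (cong₂ (λ a b → a ∧ not b) p (∉⇒false {A = B} q))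

  ∖₁ : ∀ {N} {x : Fin N} {A B} → x ∈ A ∖ B → x ∈ A
  ∖₁ {x = x} {A} {B} (mem p) with A x in eq
  ... | true = mem eq

  ∖₂ : ∀ {N} {x : Fin N} {A B} → x ∈ A ∖ B → x ∉ B
  ∖₂ {x = x} {A} {B} (mem p) (mem q) with A x | B x
  ∖₂ {x = x} {A} {B} (mem ()) (mem refl) | true  | .true
  ∖₂ {x = x} {A} {B} (mem ()) (mem refl) | false | .true

  ∈⁅⁆ : ∀ {N} {x : Fin N} {y} → y ≡ x → x ∈ ⁅ y ⁆
  ∈⁅⁆ {x = x} {y} e with y ≟ x in eq
  ... | yes _ = mem (cong does eq)
  ... | no ¬e = contradiction e ¬e

  ⁅⁆⁻ : ∀ {N} {x : Fin N} {y} → x ∈ ⁅ y ⁆ → y ≡ x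
  ⁅⁆⁻ {x = x} {y} (mem p) with y ≟ x
  ... | yes e = e

  ∉∅ : ∀ {N} {x : Fin N} → x ∉ ∅
  ∉∅ (mem ())

𝟙 : Bool → ℕ
𝟙 true  = 1
𝟙 false = 0

sumOver : ∀ n → (Fin n → ℕ) → ℕ
sumOver zero    f = 0
sumOver (suc n) f = f zero + sumOver n (λ i → f (suc i))

-- Opaque, so that unification can recover the summand.
opaque
  sum : ∀ {n} → (Fin n → ℕ) → ℕ
  sum {n} f = sumOver n f

opaque
  unfolding sum

  sum-zero : (f : Fin zero → ℕ) → sum f ≡ 0
  sum-zero f = refl

  sum-suc : ∀ {n} (f : Fin (suc n) → ℕ) → sum f ≡ f zero + sum (λ i → f (suc i))
  sum-suc f = refl

sum-cong-≗ : ∀ {n} {f g : Fin n → ℕ} → f ≗ g → sum f ≡ sum g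
sum-cong-≗ {zero} {f} {g} h = trans (sum-zero f) (sym (sum-zero g))
sum-cong-≗ {suc n} {f} {g} h = trans (sum-suc f)
  (trans (cong₂ _+_ (h zero) (sum-cong-≗ (λ i → h (suc i)))) (sym (sum-suc g)))

∑-distrib-+ : ∀ {n} (f g : Fin n → ℕ) → sum (λ i → f i + g i) ≡ sum f + sum g
∑-distrib-+ {zero}  f g = trans (sum-zero _) (sym (cong₂ _+_ (sum-zero f) (sum-zero g)))
∑-distrib-+ {suc n} f g = trans (sum-suc _)
  (trans (cong (f zero + g zero +_) (∑-distrib-+ (λ i → f (suc i)) (λ i → g (suc i))))
  (trans (interchange +-commutativeSemigroup (f zero) (g zero) _ _)
         (sym (cong₂ _+_ (sum-suc f) (sum-suc g)))))

sum-const : ∀ n c → sum {n} (λ _ → c) ≡ n * c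
sum-const zero    c = sum-zero _
sum-const (suc n) c = trans (sum-suc {n} _) (cong (c +_) (sum-const n c))

∑-comm : ∀ {m n} (f : Fin m → Fin n → ℕ) → sum (λ i → sum (f i)) ≡ sum (λ j → sum (λ i → f i j))
∑-comm {zero}  {n} f = trans (sum-zero _) (sym (trans (sum-cong-≗ (λ j → sum-zero (λ i → f i j)))
    (trans (sum-const n 0) (*-zeroʳ n))))
∑-comm {suc m} {n} f = trans (sum-suc _) (trans (cong (sum (f zero) +_) (∑-comm (λ i → f (suc i))))
  (trans (sym (∑-distrib-+ (f zero) (λ j → sum (λ i → f (suc i) j))))
         (sum-cong-≗ λ j → sym (sum-suc (λ i → f i j)))))

sum-mono : ∀ {n} {f g : Fin n → ℕ} → (∀ i → f i ≤ g i) → sum f ≤ sum g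
sum-mono {zero}  {f} {g} h = ≤-trans (≤-reflexive (sum-zero f)) z≤n
sum-mono {suc n} {f} {g} h = linear (sum f ∷ sum g ∷ f zero ∷ sum (λ i → f (suc i)) ∷ g zero ∷ sum (λ i →
    g (suc i)) ∷ [])
  (χ 0 ⩽ χ 1) (χ 0 ⊞ χ 2 ⊞ χ 3 ⊞ χ 4 ⊞ χ 5 ⩽ (χ 2 ⊞ χ 3) ⊞ χ 4 ⊞ χ 5 ⊞ χ 1)
  (eq≤ (sum-suc f) ⊕ h zero ⊕ sum-mono {f = λ i → f (suc i)} {λ i → g (suc i)} (λ i → h (suc i)) ⊕
      eq≥ (sum-suc g))

sum-scale : ∀ {n} c (f : Fin n → ℕ) → sum (λ i → c * f i) ≡ c * sum f
sum-scale {zero}  c f = trans (sum-zero _) (sym (trans (cong (c *_) (sum-zero f)) (*-zeroʳ c)))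
sum-scale {suc n} c f = trans (sum-suc _) (trans (cong (c * f zero +_) (sum-scale c (λ i → f (suc i))))
  (trans (sym (*-distribˡ-+ c (f zero) _)) (cong (c *_) (sym (sum-suc f)))))

term≤sum : ∀ {n} (f : Fin n → ℕ) i → f i ≤ sum f
term≤sum {suc n} f zero    = linear (f zero ∷ sum f ∷ sum (λ i → f (suc i)) ∷ []) (χ 0 ⩽ χ 1)
  (χ 0 ⊞ χ 2 ⩽ χ 1) (eq≥ (sum-suc f))
term≤sum {suc n} f (suc i) = linear (f (suc i) ∷ sum f ∷ f zero ∷ sum (λ i → f (suc i)) ∷ []) (χ 0 ⩽ χ 1)
  ((χ 2 ⊞ χ 3) ⊞ χ 0 ⩽ χ 1 ⊞ χ 3) (eq≥ (sum-suc f) ⊕ term≤sum (λ i → f (suc i)) i)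

sum-pigeon : ∀ {n} (f g : Fin n → ℕ) → sum f < sum g → ∃ λ i → f i < g i
sum-pigeon {zero}  f g lt = ⊥-elim (1≰0 (linear (sum f ∷ sum g ∷ []) (# 1 ⩽ # 0)
  ((# 1 ⊞ χ 0) ⊞ χ 1 ⩽ χ 1 ⊞ # 0) (lt ⊕ eq≤ (sum-zero g))))
sum-pigeon {suc n} f g lt with suc (f zero) ≤? g zero
... | yes p = zero , p
... | no ¬p = let i , h = sum-pigeon (λ i → f (suc i)) (λ i → g (suc i))
                            (linear (sum (λ i → f (suc i)) ∷ sum (λ i → g (suc i)) ∷ sum f ∷ g zero ∷ f zero ∷
                              sum g ∷ [])
                              (# 1 ⊞ χ 0 ⩽ χ 1)
                              ((# 1 ⊞ χ 2) ⊞ χ 3 ⊞ (χ 4 ⊞ χ 0) ⊞ χ 5 ⩽ χ 5 ⊞ χ 4 ⊞ χ 2 ⊞ χ 3 ⊞ χ 1)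
                              (lt ⊕ ≮⇒≥ ¬p ⊕ eq≥ (sum-suc f) ⊕ eq≤ (sum-suc g)))
              in suc i , h

opaque
  count : ∀ {N} → VSet N → ℕ
  count A = sum (λ x → 𝟙 (A x))

  ∑∈ : ∀ {N} → VSet N → (Fin N → ℕ) → ℕ
  ∑∈ A f = sum (λ x → 𝟙 (A x) * f x)

opaque
  unfolding count ∑∈ _∩_

  count-mono : ∀ {N} {A B : VSet N} → A ⊆ B → count A ≤ count B
  count-mono {A = A} {B} A⊆B = sum-mono h
    where
    h : ∀ x → 𝟙 (A x) ≤ 𝟙 (B x)
    h x with A x in eq
    ... | false = z≤n
    ... | true rewrite holds (A⊆B (mem eq)) = ≤-refl

  count-split : ∀ {N} (A B : VSet N) → count A ≡ count (A ∩ B) + count (A ∖ B)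
  count-split A B = trans (sum-cong-≗ λ x → h (A x) (B x)) (∑-distrib-+ _ _)
    where
    h : ∀ a b → 𝟙 a ≡ 𝟙 (a ∧ b) + 𝟙 (a ∧ not b)
    h true  true  = refl
    h true  false = refl
    h false _     = refl

  count-∪ : ∀ {N} (A B : VSet N) → count (A ∪ B) ≤ count A + count B
  count-∪ A B = ≤-trans (sum-mono λ x → h (A x) (B x)) (≤-reflexive (∑-distrib-+ _ _))
    where
    h : ∀ a b → 𝟙 (a ∨ b) ≤ 𝟙 a + 𝟙 b
    h true  b = s≤s z≤n
    h false b = ≤-refl

  count-⊎ : ∀ {N} (A B : VSet N) → Disjoint A B → count A + count B ≤ count (A ∪ B)
  count-⊎ A B d = ≤-trans (≤-reflexive (sym (∑-distrib-+ _ _))) (sum-mono h)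
    where
    h : ∀ x → 𝟙 (A x) + 𝟙 (B x) ≤ 𝟙 (A x ∨ B x)
    h x with A x in p | B x in q
    ... | true  | true  = ⊥-elim (d (mem p) (mem q))
    ... | true  | false = ≤-refl
    ... | false | _     = ≤-refl

  count-full : ∀ {N} → count {N} full ≡ N
  count-full {N} = trans (sum-const N 1) (*-identityʳ N)

  count-∅ : ∀ {N} → count {N} ∅ ≡ 0
  count-∅ {N} = trans (sum-const N 0) (*-zeroʳ N)

  count-⁅⁆ : ∀ {N} (x : Fin N) → count ⁅ x ⁆ ≡ 1
  count-⁅⁆ {suc N} zero    = trans (sum-suc (λ y → 𝟙 (does (zero ≟ y)))) (cong suc (count-∅ {N}))
  count-⁅⁆ {suc N} (suc x) = trans (sum-suc (λ y → 𝟙 (does (suc x ≟ y)))) (count-⁅⁆ x)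

  inhabited : ∀ {N} {A : VSet N} → 1 ≤ count A → ∃ λ x → x ∈ A
  inhabited {N} {A} h with sum-pigeon (λ _ → 0) (λ x → 𝟙 (A x))
                         (≤-trans (≤-reflexive (cong suc (trans (sum-const N 0) (*-zeroʳ N)))) h)
  ... | x , p with A x in eq
  ...   | true = x , mem eq

  ∑∈-mono : ∀ {N} (A : VSet N) (f g : Fin N → ℕ) → (∀ {x} → x ∈ A → f x ≤ g x) → ∑∈ A f ≤ ∑∈ A g
  ∑∈-mono A f g h = sum-mono p
    where
    p : ∀ x → 𝟙 (A x) * f x ≤ 𝟙 (A x) * g x
    p x with A x in eq
    ... | true  = *-monoʳ-≤ 1 (h (mem eq))
    ... | false = z≤n

  ∑∈-⊆ : ∀ {N} (A B : VSet N) (f : Fin N → ℕ) → A ⊆ B → ∑∈ A f ≤ ∑∈ B f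
  ∑∈-⊆ A B f A⊆B = sum-mono p
    where
    p : ∀ x → 𝟙 (A x) * f x ≤ 𝟙 (B x) * f x
    p x with A x in eq
    ... | false = z≤n
    ... | true rewrite holds (A⊆B (mem eq)) = ≤-refl

  ∑∈-split : ∀ {N} (A B : VSet N) (f : Fin N → ℕ) → ∑∈ A f ≡ ∑∈ (A ∩ B) f + ∑∈ (A ∖ B) f
  ∑∈-split A B f = trans (sum-cong-≗ λ x → h (A x) (B x) (f x)) (∑-distrib-+ _ _)
    where
    h : ∀ a b c → 𝟙 a * c ≡ 𝟙 (a ∧ b) * c + 𝟙 (a ∧ not b) * c
    h true  true  c = sym (+-identityʳ _)
    h true  false c = refl
    h false _     c = refl

  ∑∈-+ : ∀ {N} (A : VSet N) (f g : Fin N → ℕ) → ∑∈ A (λ x → f x + g x) ≡ ∑∈ A f + ∑∈ A g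
  ∑∈-+ A f g = trans (sum-cong-≗ λ x → *-distribˡ-+ (𝟙 (A x)) (f x) (g x)) (∑-distrib-+ _ _)

  ∑∈-const : ∀ {N} (A : VSet N) (c : ℕ) → ∑∈ A (λ _ → c) ≡ count A * c
  ∑∈-const A c = trans (sum-cong-≗ λ x → *-comm (𝟙 (A x)) c) (trans (sum-scale c _) (*-comm c _))

  ∑∈-scale : ∀ {N} (A : VSet N) (c : ℕ) (f : Fin N → ℕ) → ∑∈ A (λ x → c * f x) ≡ c * ∑∈ A f
  ∑∈-scale A c f = trans (sum-cong-≗ λ x → trans (sym (*-assoc (𝟙 (A x)) c (f x)))
    (trans (cong (_* f x) (*-comm (𝟙 (A x)) c)) (*-assoc c (𝟙 (A x)) (f x)))) (sum-scale c _)

  ∑∈-count : ∀ {N} (A B : VSet N) → ∑∈ A (λ x → 𝟙 (B x)) ≡ count (A ∩ B)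
  ∑∈-count A B = sum-cong-≗ λ x → h (A x) (B x)
    where
    h : ∀ a b → 𝟙 a * 𝟙 b ≡ 𝟙 (a ∧ b)
    h true  b = *-identityˡ (𝟙 b)
    h false b = refl

  -- Double counting of the related pairs in `A × B`.
  ∑∈-swap : ∀ {N} (A B : VSet N) (r : Fin N → VSet N) → (∀ x y → r x y ≡ r y x) →
            ∑∈ A (λ x → count (B ∩ r x)) ≡ ∑∈ B (λ y → count (A ∩ r y))
  ∑∈-swap A B r r-sym = trans (sum-cong-≗ λ x → sym (sum-scale (𝟙 (A x)) _))
    (trans (∑-comm _) (sum-cong-≗ λ y →
      trans (sum-cong-≗ λ x → h (A x) (B y) (r x y) (r y x) (r-sym x y)) (sum-scale (𝟙 (B y)) _)))
    where
    h : ∀ a b c d → c ≡ d → 𝟙 a * 𝟙 (b ∧ c) ≡ 𝟙 b * 𝟙 (a ∧ d)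
    h true  true  c .c refl = refl
    h true  false c .c refl = refl
    h false true  c .c refl = refl
    h false false c .c refl = refl

  ∑∈-swap-∖ : ∀ {N} (A B : VSet N) (r : Fin N → VSet N) → (∀ x y → r x y ≡ r y x) →
              ∑∈ A (λ x → count (B ∖ r x)) ≡ ∑∈ B (λ y → count (A ∖ r y))
  ∑∈-swap-∖ A B r r-sym = ∑∈-swap A B (λ x y → not (r x y)) (λ x y → cong not (r-sym x y))

  ∑∈-∑ : ∀ {N q} (A : VSet N) (f : Fin q → Fin N → ℕ) → sum (λ j → ∑∈ A (f j)) ≡ ∑∈ A (λ x → sum (λ j → f j x))
  ∑∈-∑ A f = trans (∑-comm _) (sum-cong-≗ λ x → sum-scale (𝟙 (A x)) _)

count-pos : ∀ {N} {A : VSet N} {x} → x ∈ A → 1 ≤ count A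
count-pos {A = A} {x} x∈ = ≤-trans (≤-reflexive (sym (count-⁅⁆ x))) (count-mono λ y∈ → subst (_∈ A) (⁅⁆⁻ y∈) x∈)

∑∈-≥ : ∀ {N} (A : VSet N) (f : Fin N → ℕ) (c : ℕ) → (∀ {x} → x ∈ A → c ≤ f x) → count A * c ≤ ∑∈ A f
∑∈-≥ A f c h = ≤-trans (≤-reflexive (sym (∑∈-const A c))) (∑∈-mono A (λ _ → c) f h)

∑∈-≤ : ∀ {N} (A : VSet N) (f : Fin N → ℕ) (c : ℕ) → (∀ {x} → x ∈ A → f x ≤ c) → ∑∈ A f ≤ count A * c
∑∈-≤ A f c h = ≤-trans (∑∈-mono A f (λ _ → c) h) (≤-reflexive (∑∈-const A c))

count-empty : ∀ {N} {A : VSet N} → (∀ {x} → x ∉ A) → count A ≡ 0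
count-empty {N} {A} h = n≤0⇒n≡0 (≤-trans (count-mono {A = A} {∅} (λ p → ⊥-elim (h p))) (≤-reflexive count-∅))

module _ {N : ℕ} where

  count-∖ : (A B : VSet N) → count A ≤ count (A ∖ B) + count B
  count-∖ A B = linear (count A ∷ count (A ∖ B) ∷ count B ∷ count (A ∩ B) ∷ []) (χ 0 ⩽ χ 1 ⊞ χ 2)
    (χ 0 ⊞ χ 3 ⩽ (χ 3 ⊞ χ 1) ⊞ χ 2) (eq≤ (count-split A B) ⊕ count-mono {A = A ∩ B} {B} ∩₂)

  count-delete : {A : VSet N} (x : Fin N) → count A ≤ suc (count (A ∖ ⁅ x ⁆))
  count-delete {A} x = linear (count A ∷ count (A ∖ ⁅ x ⁆) ∷ count ⁅ x ⁆ ∷ []) (χ 0 ⩽ # 1 ⊞ χ 1)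
    (χ 0 ⊞ χ 2 ⩽ (χ 1 ⊞ χ 2) ⊞ # 1) (count-∖ A ⁅ x ⁆ ⊕ eq≤ (count-⁅⁆ x))

  count-delete< : {A : VSet N} {x : Fin N} → x ∈ A → suc (count (A ∖ ⁅ x ⁆)) ≤ count A
  count-delete< {A} {x} x∈ = linear (count (A ∖ ⁅ x ⁆) ∷ count A ∷ count (A ∩ ⁅ x ⁆) ∷ count ⁅ x ⁆ ∷ [])
    (# 1 ⊞ χ 0 ⩽ χ 1) ((χ 2 ⊞ χ 0) ⊞ # 1 ⊞ χ 3 ⩽ χ 1 ⊞ χ 3 ⊞ χ 2) (eq≥ (count-split A ⁅ x ⁆) ⊕
      eq≥ (count-⁅⁆ x) ⊕
    count-mono {A = ⁅ x ⁆} {A ∩ ⁅ x ⁆} λ y∈ → ∩⁺ (subst (_∈ A) (⁅⁆⁻ y∈) x∈) y∈)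

  count-insert : {A : VSet N} {x : Fin N} → x ∉ A → suc (count A) ≤ count (A ∪ ⁅ x ⁆)
  count-insert {A} {x} x∉ = linear (count A ∷ count (A ∪ ⁅ x ⁆) ∷ count ⁅ x ⁆ ∷ []) (# 1 ⊞ χ 0 ⩽ χ 1)
    ((χ 0 ⊞ χ 2) ⊞ # 1 ⩽ χ 1 ⊞ χ 2) (count-⊎ A ⁅ x ⁆ (λ p q → x∉ (subst (_∈ A) (sym (⁅⁆⁻ q)) p)) ⊕
      eq≥ (count-⁅⁆ x))

  subset-of-size : (A : VSet N) → ∀ m → m ≤ count A → ∃ λ B → B ⊆ A × count B ≡ m
  subset-of-size A zero    h = ∅ , (λ p → ⊥-elim (∉∅ p)) , count-∅
  subset-of-size A (suc m) h with inhabited {A = A} (≤-trans (s≤s z≤n) h)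
  ... | x , x∈ with subset-of-size (A ∖ ⁅ x ⁆) m (linear (m ∷ count (A ∖ ⁅ x ⁆) ∷ count A ∷ [])
    (χ 0 ⩽ χ 1) ((# 1 ⊞ χ 0) ⊞ χ 2 ⩽ χ 2 ⊞ # 1 ⊞ χ 1) (h ⊕ count-delete {A} x))
  ...   | B , B⊆ , cB = B ∪ ⁅ x ⁆
     , (λ p → [ (λ q → ∖₁ (B⊆ q)) , (λ q → subst (_∈ A) (⁅⁆⁻ q) x∈) ]′ (∪⁻ p))
     , ≤-antisym (linear (count (B ∪ ⁅ x ⁆) ∷ m ∷ count ⁅ x ⁆ ∷ count B ∷ []) (χ 0 ⩽ # 1 ⊞ χ 1)
       (χ 0 ⊞ χ 2 ⊞ χ 3 ⩽ (χ 3 ⊞ χ 2) ⊞ # 1 ⊞ χ 1) (count-∪ B ⁅ x ⁆ ⊕ eq≤ (count-⁅⁆ x) ⊕ eq≤ cB)) (linear (m ∷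
         count (B ∪ ⁅ x ⁆) ∷ count B ∷ [])
         (# 1 ⊞ χ 0 ⩽ χ 1) ((# 1 ⊞ χ 2) ⊞ χ 0 ⩽ χ 1 ⊞ χ 2) (count-insert {B} x∉B ⊕ eq≥ cB))
    where
    x∉B : x ∉ B
    x∉B p = ∖₂ (B⊆ p) (∈⁅⁆ refl)

  enumerate : ∀ m (A : VSet N) → m ≤ count A → ∃ λ (f : Fin m → Fin N) → Injective _≡_ _≡_ f × (∀ i → f i ∈ A)
  enumerate zero    A h = (λ ()) , (λ { {()} }) , λ ()
  enumerate (suc m) A h with inhabited {A = A} (≤-trans (s≤s z≤n) h)
  ... | x , x∈ with enumerate m (A ∖ ⁅ x ⁆) (linear (m ∷ count (A ∖ ⁅ x ⁆) ∷ count A ∷ []) (χ 0 ⩽ χ 1)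
    ((# 1 ⊞ χ 0) ⊞ χ 2 ⩽ χ 2 ⊞ # 1 ⊞ χ 1) (h ⊕ count-delete {A} x))
  ...   | f , inj , f∈ = (λ { zero → x ; (suc i) → f i })
     , (λ { {zero} {zero} _ → refl ; {zero} {suc j} e → ⊥-elim (f≢ j e)
          ; {suc i} {zero} e → ⊥-elim (f≢ i (sym e)) ; {suc i} {suc j} e → cong suc (inj e) })
     , (λ { zero → x∈ ; (suc i) → ∖₁ (f∈ i) })
    where
    f≢ : ∀ i → x ≢ f i
    f≢ i e = ∖₂ (f∈ i) (∈⁅⁆ e)

  image : ∀ {m} → (Fin m → Fin N) → VSet N
  image {zero}  f = ∅
  image {suc m} f = image (λ i → f (suc i)) ∪ ⁅ f zero ⁆

  image⁻ : ∀ {m} (f : Fin m → Fin N) {x} → x ∈ image f → ∃ λ i → f i ≡ x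
  image⁻ {zero}  f p = ⊥-elim (∉∅ p)
  image⁻ {suc m} f p with ∪⁻ p
  ... | inj₁ q = let i , e = image⁻ (λ i → f (suc i)) q in suc i , e
  ... | inj₂ q = zero , ⁅⁆⁻ q

  count-image : ∀ {m} (f : Fin m → Fin N) → Injective _≡_ _≡_ f → m ≤ count (image f)
  count-image {zero}  f inj = z≤n
  count-image {suc m} f inj = ≤-trans (s≤s (count-image (λ i → f (suc i)) (suc-injective ∘ inj)))
    (count-insert {image (λ i → f (suc i))} λ p → let i , e = image⁻ (λ i → f (suc i)) p in 0≢1+n (inj (sym e)))

opaque
  ⟪_≼_⟫ : ∀ {N} → (Fin N → ℕ) → (Fin N → ℕ) → VSet N
  ⟪ f ≼ g ⟫ x = f x ≤ᵇ g x

  ≼⁺ : ∀ {N} {f g : Fin N → ℕ} {x} → f x ≤ g x → x ∈ ⟪ f ≼ g ⟫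
  ≼⁺ h = mem (Equivalence.to T-≡ (≤⇒≤ᵇ h))

  ≼⁻ : ∀ {N} {f g : Fin N → ℕ} {x} → x ∈ ⟪ f ≼ g ⟫ → f x ≤ g x
  ≼⁻ (mem p) = ≤ᵇ⇒≤ _ _ (Equivalence.from T-≡ p)

≼-dichotomy : ∀ {N} (U : VSet N) (f : Fin N → ℕ) c → (∃ λ x → x ∈ U × c ≤ f x) ⊎ (∀ {x} → x ∈ U → f x < c)
≼-dichotomy U f c with 1 ≤? count (U ∩ ⟪ (λ _ → c) ≼ f ⟫)
... | yes h with inhabited h
...   | x , x∈ = inj₁ (x , ∩₁ x∈ , ≼⁻ (∩₂ x∈))
≼-dichotomy U f c | no ¬h = inj₂ λ x∈ → ≰⇒> λ c≤ → ¬h (≤-trans (≤-reflexive (sym (count-⁅⁆ _)))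
  (count-mono {A = ⁅ _ ⁆} λ y∈ → subst (_∈ (U ∩ ⟪ (λ _ → c) ≼ f ⟫)) (⁅⁆⁻ y∈) (∩⁺ x∈ (≼⁺ c≤))))

count-⊆0 : ∀ {N} {A : VSet N} {x : Fin N} → x ∉ A → count (⁅ x ⁆ ∩ A) ≤ 0
count-⊆0 {A = A} x∉ = ≤-reflexive (count-empty λ p → x∉ (subst (_∈ A) (sym (⁅⁆⁻ (∩₁ p))) (∩₂ p)))

count-∩⁅⁆ : ∀ {N} (A : VSet N) (x : Fin N) → count (⁅ x ⁆ ∩ A) ≤ 1
count-∩⁅⁆ A x = ≤-trans (count-mono {B = ⁅ x ⁆} ∩₁) (≤-reflexive (count-⁅⁆ x))

count-∖∩ : ∀ {N} (U P A : VSet N) → count (U ∩ A) ≤ count ((U ∖ P) ∩ A) + count (P ∩ A)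
count-∖∩ U P A = ≤-trans (count-mono h) (count-∪ ((U ∖ P) ∩ A) (P ∩ A))
  where
  h : U ∩ A ⊆ (U ∖ P) ∩ A ∪ P ∩ A
  h {x} x∈ with x ∈? P
  ... | inj₁ x∈P = ∪ʳ (∩⁺ x∈P (∩₂ x∈))
  ... | inj₂ x∉P = ∪ˡ (∩⁺ (∖⁺ (∩₁ x∈) x∉P) (∩₂ x∈))

count-∪∩ : ∀ {N} (A B C : VSet N) → count ((A ∪ B) ∩ C) ≤ count (A ∩ C) + count (B ∩ C)
count-∪∩ A B C = ≤-trans (count-mono h) (count-∪ (A ∩ C) (B ∩ C))
  where
  h : (A ∪ B) ∩ C ⊆ A ∩ C ∪ B ∩ C
  h x∈ = [ (λ p → ∪ˡ (∩⁺ p (∩₂ x∈))) , (λ p → ∪ʳ (∩⁺ p (∩₂ x∈))) ]′ (∪⁻ (∩₁ x∈))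

∖-mono : ∀ {N} {A B C : VSet N} → A ⊆ B → A ∖ C ⊆ B ∖ C
∖-mono h p = ∖⁺ (h (∖₁ p)) (∖₂ p)

∩-monoˡ : ∀ {N} {A B C : VSet N} → A ⊆ B → A ∩ C ⊆ B ∩ C
∩-monoˡ h p = ∩⁺ (h (∩₁ p)) (∩₂ p)

-- Rooted forests and their small pieces

-- A rooted forest in first-child/next-sibling form: `cons c s` is a tree whose
-- root has children c, followed by the trees of s. A rooted tree is identified
-- with the forest of its root's children.
data Forest : Set where
  nil  : Forest
  cons : (c s : Forest) → Forest

size : Forest → ℕ
size nil        = 0
size (cons c s) = suc (size c + size s)

data AllSmall (g : ℕ) : Forest → Set where
  nil  : AllSmall g nil
  cons : ∀ {c s} → suc (size c) ≤ g → AllSmall g s → AllSmall g (cons c s)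

-- Marked roots are cut off: `Cut g f p m` says that p is what remains of f
-- after removing the subtrees of the topmost marked vertices, m counts all marked
-- vertices, and each marked vertex carries an unmarked remainder of at least
-- g vertices (itself included) while all other remainders have fewer.
data Cut (g : ℕ) : Forest → Forest → ℕ → Set where
  nil  : Cut g nil nil 0
  keep : ∀ {c s pc ps m m′} → Cut g c pc m → Cut g s ps m′ → suc (size pc) ≤ g →
         Cut g (cons c s) (cons pc ps) (m + m′)
  mark : ∀ {c s pc ps m m′} → Cut g c pc m → Cut g s ps m′ → g ≤ suc (size pc) →
         Cut g (cons c s) ps (suc (m + m′))

-- The cut proceeds from the leaves upwards: a vertex is marked as soon as the remainder hanging at
-- it, itself included, exceeds `g`. Remainders of different marked vertices are disjoint, so their
-- number stays bounded when `g` is a fixed fraction of the tree.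
cut : ∀ g f → ∃₂ λ p m → Cut g f p m × m * g + size p ≤ size f
cut g nil = nil , 0 , nil , z≤n
cut g (cons c s) with cut g c | cut g s
... | pc , m , cc , hc | ps , m′ , cs , hs with suc (size pc) ≤? g
...   | yes h = cons pc ps , m + m′ , keep cc cs h , linear (m ∷ m′ ∷ g ∷ size pc ∷ size ps ∷ size c ∷
    size s ∷ [])
  ((χ 0 ⊞ χ 1) ⊠ χ 2 ⊞ # 1 ⊞ χ 3 ⊞ χ 4 ⩽ # 1 ⊞ χ 5 ⊞ χ 6)
  ((χ 0 ⊠ χ 2 ⊞ χ 3) ⊞ χ 1 ⊠ χ 2 ⊞ χ 4 ⩽ χ 5 ⊞ χ 6) (hc ⊕ hs)
...   | no ¬h = ps , suc (m + m′) , mark cc cs (≤-trans (n≤1+n g) (≰⇒> ¬h)) , linear (m ∷ m′ ∷ g ∷ size ps ∷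
    size c ∷ size s ∷ size pc ∷ [])
  ((# 1 ⊞ χ 0 ⊞ χ 1) ⊠ χ 2 ⊞ χ 3 ⩽ # 1 ⊞ χ 4 ⊞ χ 5)
  ((χ 0 ⊠ χ 2 ⊞ χ 6) ⊞ (χ 1 ⊠ χ 2 ⊞ χ 3) ⊞ # 1 ⊞ χ 2 ⩽ χ 4 ⊞ χ 5 ⊞ # 1 ⊞ χ 6)
  (hc ⊕ hs ⊕ ≰⇒> ¬h)

cut-size : ∀ {g f p m} → Cut g f p m → size p ≤ size f
cut-size nil = z≤n
cut-size (keep {c} {s} {pc} {ps} cc cs _) = linear (size pc ∷ size ps ∷ size c ∷ size s ∷ [])
  (# 1 ⊞ χ 0 ⊞ χ 1 ⩽ # 1 ⊞ χ 2 ⊞ χ 3) (χ 0 ⊞ χ 1 ⩽ χ 2 ⊞ χ 3) (cut-size cc ⊕ cut-size cs)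
cut-size (mark {c} {s} {ps = ps} cc cs _) = linear (size ps ∷ size c ∷ size s ∷ [])
  (χ 0 ⩽ # 1 ⊞ χ 1 ⊞ χ 2) (χ 0 ⩽ χ 2) (cut-size cs)

-- Red forests in the complement of a blue graph

record BlueGraph (N : ℕ) : Set where
  field
    b     : Fin N → VSet N
    b-sym : ∀ x y → b x y ≡ b y x
    b-irr : ∀ x → b x x ≡ false

module Embedding {N} (G : BlueGraph N) where
  open BlueGraph G public

  bsym : ∀ {x y} → y ∈ b x → x ∈ b y
  bsym {x} {y} (mem p) = mem (trans (sym (b-sym x y)) p)

  birr : ∀ {x} → x ∉ b x
  birr {x} = false⇒∉ (b-irr x)

  -- `Emb P v f`: red copies of the trees of f hang below v, using distinct vertices of P.
  data Emb (P : VSet N) (v : Fin N) : Forest → Set where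
    nil  : Emb P v nil
    cons : ∀ {c s} w (A B : VSet N) → w ∈ P → w ∉ b v → A ⊆ P → B ⊆ P → w ∉ A → w ∉ B →
           Disjoint A B → Emb A w c → Emb B v s → Emb P v (cons c s)

  join : ∀ {w v A B c s} → w ∉ b v → w ∉ A → w ∉ B → Disjoint A B → Emb A w c → Emb B v s →
         Emb (⁅ w ⁆ ∪ A ∪ B) v (cons c s)
  join r w∉A w∉B d ec es = cons _ _ _ (∪ˡ (∈⁅⁆ refl)) r (λ p → ∪ʳ (∪ˡ p)) (λ p → ∪ʳ (∪ʳ p)) w∉A w∉B d ec es

  join-⊆ : ∀ {w : Fin N} {A B U} → w ∈ U → A ⊆ U → B ⊆ U → ⁅ w ⁆ ∪ A ∪ B ⊆ U
  join-⊆ {U = U} w∈ A⊆ B⊆ p with ∪⁻ p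
  ... | inj₁ q = subst (_∈ U) (⁅⁆⁻ q) w∈
  ... | inj₂ q = [ A⊆ , B⊆ ]′ (∪⁻ q)

  join-count : ∀ (w : Fin N) A B → count (⁅ w ⁆ ∪ A ∪ B) ≤ suc (count A + count B)
  join-count w A B = linear (count (⁅ w ⁆ ∪ A ∪ B) ∷ count A ∷ count B ∷ count (A ∪ B) ∷ count ⁅ w ⁆ ∷ [])
    (χ 0 ⩽ # 1 ⊞ χ 1 ⊞ χ 2) (χ 0 ⊞ χ 3 ⊞ χ 4 ⩽ (χ 4 ⊞ χ 3) ⊞ (χ 1 ⊞ χ 2) ⊞ # 1)
    (count-∪ ⁅ w ⁆ (A ∪ B) ⊕ count-∪ A B ⊕ eq≤ (count-⁅⁆ w))

  join-count∩ : ∀ (w : Fin N) A B C → count ((⁅ w ⁆ ∪ A ∪ B) ∩ C) ≤ count (⁅ w ⁆ ∩ C) + (count (A ∩ C) +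
      count (B ∩ C))
  join-count∩ w A B C = linear (count ((⁅ w ⁆ ∪ A ∪ B) ∩ C) ∷ count (⁅ w ⁆ ∩ C) ∷ count (A ∩ C) ∷
      count (B ∩ C) ∷ count ((A ∪ B) ∩ C) ∷ [])
    (χ 0 ⩽ χ 1 ⊞ χ 2 ⊞ χ 3) (χ 0 ⊞ χ 4 ⩽ (χ 1 ⊞ χ 4) ⊞ χ 2 ⊞ χ 3) (count-∪∩ ⁅ w ⁆ (A ∪ B) C ⊕ count-∪∩ A B C)

  -- Red means not blue, so a vertex is red to itself; `v ∉ P` keeps the root apart from the
  -- vertices below it.
  Rooted : Forest → Set
  Rooted f = ∃₂ λ v P → v ∉ P × Emb P v f

  -- Whenever a vertex is to be placed, fewer than `size f` vertices of `U` are taken and at most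
  -- `β` are blue to its parent, so a red one is free.
  greedy : ∀ f v U β → count (U ∩ b v) ≤ β → (∀ {x} → x ∈ U → count (U ∩ b x) ≤ β) →
           size f + β ≤ count U → ∃ λ P → P ⊆ U × count P ≤ size f × Emb P v f
  greedy nil v U β hv hU h = ∅ , (λ p → ⊥-elim (∉∅ p)) , ≤-reflexive count-∅ , nil
  greedy (cons c s) v U β hv hU h
    with inhabited {A = U ∖ b v} (linear (count (U ∖ b v) ∷ size c ∷ size s ∷ β ∷ count U ∷ count (U ∩ b v) ∷
        [])
      (# 1 ⩽ χ 0) (((# 1 ⊞ χ 1 ⊞ χ 2) ⊞ χ 3) ⊞ χ 4 ⊞ χ 5 ⩽ χ 4 ⊞ (χ 5 ⊞ χ 0) ⊞ χ 3)
      (h ⊕ eq≤ (count-split U (b v)) ⊕ hv))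
  ... | w , w∈ with greedy c w (U ∖ ⁅ w ⁆) β
           (≤-trans (count-mono (∩-monoˡ ∖₁)) (hU (∖₁ w∈)))
           (λ x∈ → ≤-trans (count-mono (∩-monoˡ ∖₁)) (hU (∖₁ x∈)))
           (linear (size c ∷ β ∷ count (U ∖ ⁅ w ⁆) ∷ size s ∷ count U ∷ []) (χ 0 ⊞ χ 1 ⩽ χ 2)
             (((# 1 ⊞ χ 0 ⊞ χ 3) ⊞ χ 1) ⊞ χ 4 ⩽ χ 4 ⊞ # 1 ⊞ χ 2) (h ⊕ count-delete {A = U} w))
  ...   | P , P⊆ , cP , eP with greedy s v (U ∖ ⁅ w ⁆ ∖ P) β
           (≤-trans (count-mono (∩-monoˡ (λ p → ∖₁ (∖₁ p)))) hv)
           (λ x∈ → ≤-trans (count-mono (∩-monoˡ (λ p → ∖₁ (∖₁ p)))) (hU (∖₁ (∖₁ x∈))))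
           (linear (size s ∷ β ∷ count (U ∖ ⁅ w ⁆ ∖ P) ∷ size c ∷ count U ∷ count (U ∖ ⁅ w ⁆) ∷ count P ∷ [])
             (χ 0 ⊞ χ 1 ⩽ χ 2)
             (((# 1 ⊞ χ 3 ⊞ χ 0) ⊞ χ 1) ⊞ χ 4 ⊞ χ 5 ⊞ χ 6 ⩽ χ 4 ⊞ (# 1 ⊞ χ 5) ⊞ (χ 2 ⊞ χ 6) ⊞ χ 3)
             (h ⊕ count-delete {A = U} w ⊕ count-∖ (U ∖ ⁅ w ⁆) P ⊕ cP))
  ...     | Q , Q⊆ , cQ , eQ = ⁅ w ⁆ ∪ P ∪ Q
    , join-⊆ (∖₁ w∈) (λ p → ∖₁ (P⊆ p)) (λ p → ∖₁ (∖₁ (Q⊆ p)))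
    , linear (count (⁅ w ⁆ ∪ P ∪ Q) ∷ size c ∷ size s ∷ count P ∷ count Q ∷ []) (χ 0 ⩽ # 1 ⊞ χ 1 ⊞ χ 2)
      (χ 0 ⊞ χ 3 ⊞ χ 4 ⩽ (# 1 ⊞ χ 3 ⊞ χ 4) ⊞ χ 1 ⊞ χ 2) (join-count w P Q ⊕ cP ⊕ cQ)
    , join (∖₂ w∈) (λ p → ∖₂ (P⊆ p) (∈⁅⁆ refl)) (λ p → ∖₂ (∖₁ (Q⊆ p)) (∈⁅⁆ refl))
           (λ p q → ∖₂ (Q⊆ q) p) eP eQ

  data Clique : ℕ → VSet N → Set where
    nil  : ∀ {P} → Clique 0 P
    cons : ∀ {a P} x Q → x ∈ P → Q ⊆ P → Q ⊆ b x → Clique a Q → Clique (suc a) P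

  Clique-mono : ∀ {a P Q} → P ⊆ Q → Clique a P → Clique a Q
  Clique-mono h nil = nil
  Clique-mono h (cons x R x∈ R⊆ R⊆b K) = cons x R (h x∈) (λ p → h (R⊆ p)) R⊆b K

  -- Chvátal's argument for trees against complete graphs.
  tree-or-clique : ∀ a g U c → suc (size c) ≤ g → a * g ≤ count U →
    Clique a U ⊎ (∃₂ λ w P → w ∈ U × P ⊆ U × w ∉ P × count P ≤ size c × Emb P w c)
  tree-or-clique zero g U c hc hU = inj₁ nil
  tree-or-clique (suc a) g U c hc hU with ≼-dichotomy U (λ x → count (U ∩ b x)) (a * g)
  ... | inj₁ (x , x∈ , h) with tree-or-clique a g (U ∩ b x) c hc h
  ...   | inj₁ K = inj₁ (cons x (U ∩ b x) x∈ ∩₁ ∩₂ K)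
  ...   | inj₂ (w , P , w∈ , P⊆ , rest) = inj₂ (w , P , ∩₁ w∈ , (λ p → ∩₁ (P⊆ p)) , rest)
  tree-or-clique (suc a) g U c hc hU | inj₂ small
    with inhabited {A = U} (linear (count U ∷ size c ∷ g ∷ a ∷ []) (# 1 ⩽ χ 0)
      ((# 1 ⊞ χ 1) ⊞ χ 2 ⊞ χ 3 ⊠ χ 2 ⩽ χ 2 ⊞ χ 0) (hc ⊕ hU))
  ... | w , w∈ with greedy c w (U ∖ ⁅ w ⁆) (a * g)
           (≤-trans (count-mono (∩-monoˡ ∖₁)) (<⇒≤ (small w∈)))
           (λ x∈ → ≤-trans (count-mono (∩-monoˡ ∖₁)) (<⇒≤ (small (∖₁ x∈))))
           (linear (size c ∷ a ∷ g ∷ count (U ∖ ⁅ w ⁆) ∷ count U ∷ []) (χ 0 ⊞ χ 1 ⊠ χ 2 ⩽ χ 3)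
             ((χ 2 ⊞ χ 1 ⊠ χ 2) ⊞ (# 1 ⊞ χ 0) ⊞ χ 4 ⩽ χ 4 ⊞ χ 2 ⊞ # 1 ⊞ χ 3)
             (hU ⊕ hc ⊕ count-delete {A = U} w))
  ...   | P , P⊆ , cP , eP = inj₂ (w , P , w∈ , (λ p → ∖₁ (P⊆ p)) , (λ p → ∖₂ (P⊆ p) (∈⁅⁆ refl)) , cP , eP)

  module NoClique (K : ℕ) (noClique : ¬ Clique K full) where

    smallTree : ∀ g U c → suc (size c) ≤ g → K * g ≤ count U →
                ∃₂ λ w P → w ∈ U × P ⊆ U × w ∉ P × count P ≤ size c × Emb P w c
    smallTree g U c hc hU with tree-or-clique K g U c hc hU
    ... | inj₁ cl = ⊥-elim (noClique (Clique-mono (λ _ → ∈full) cl))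
    ... | inj₂ r  = r

    -- As long as a piece is missing, `K * g` vertices of `Q` are free, and these contain a red copy
    -- of any tree with at most `g` vertices. Its root may land anywhere, since all of `Q` is red to
    -- `z`.
    smallTrees : ∀ g s z Q → (∀ {x} → x ∈ Q → x ∉ b z) → AllSmall g s → size s + K * g ≤ count Q →
                 ∃ λ P → P ⊆ Q × Emb P z s
    smallTrees g nil z Q red sm h = ∅ , (λ p → ⊥-elim (∉∅ p)) , nil
    smallTrees g (cons c s) z Q red (cons hc sm) h
      with smallTree g Q c hc (linear (K ∷ g ∷ count Q ∷ size c ∷ size s ∷ []) (χ 0 ⊠ χ 1 ⩽ χ 2)
        ((# 1 ⊞ χ 3 ⊞ χ 4) ⊞ χ 0 ⊠ χ 1 ⩽ χ 2) h)
    ... | w , P , w∈ , P⊆ , w∉ , cP , eP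
      with smallTrees g s z (Q ∖ ⁅ w ⁆ ∖ P) (λ p → red (∖₁ (∖₁ p))) sm
             (linear (size s ∷ K ∷ g ∷ count (Q ∖ ⁅ w ⁆ ∖ P) ∷ size c ∷ count Q ∷ count (Q ∖ ⁅ w ⁆) ∷
               count P ∷ [])
               (χ 0 ⊞ χ 1 ⊠ χ 2 ⩽ χ 3)
               (((# 1 ⊞ χ 4 ⊞ χ 0) ⊞ χ 1 ⊠ χ 2) ⊞ χ 5 ⊞ χ 6 ⊞ χ 7 ⩽ χ 5 ⊞ (# 1 ⊞ χ 6) ⊞ (χ 3 ⊞ χ 7) ⊞ χ 4)
               (h ⊕ count-delete {A = Q} w ⊕ count-∖ (Q ∖ ⁅ w ⁆) P ⊕ cP))
    ... | R , R⊆ , eR = ⁅ w ⁆ ∪ P ∪ R , join-⊆ w∈ P⊆ (λ p → ∖₁ (∖₁ (R⊆ p)))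
      , join (red w∈) w∉ (λ p → ∖₂ (∖₁ (R⊆ p)) (∈⁅⁆ refl)) (λ p q → ∖₂ (R⊆ q) p) eP eR

    -- Marked vertices are placed into the red clique A, the small remainders anywhere in V.
    module Hub (g : ℕ) (A V : VSet N) (A∩V : Disjoint A V) (redA : ∀ {x y} → x ∈ A → y ∈ A → y ∉ b x)
               (redAV : ∀ {x y} → x ∈ A → y ∈ V → y ∉ b x) where

      redVA : ∀ {x y} → x ∈ V → y ∈ A → y ∉ b x
      redVA x∈ y∈ p = redAV y∈ x∈ (bsym p)

      record Below (U : VSet N) (v : Fin N) (f : Forest) (m : ℕ) : Set where
        constructor below
        field
          P   : VSet N
          P⊆  : P ⊆ U
          cA  : count (P ∩ A) ≤ m
          cV  : count (P ∩ V) ≤ size f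
          emb : Emb P v f

      -- The remainder `p` of `f` already hangs below `w` on vertices of `P`, and the subtrees that
      -- were cut off are to be added from `U`. The count in `V` is restricted to `U` because the
      -- `size p` vertices of the remainder are already paid for.
      record Filled (U P : VSet N) (w : Fin N) (f p : Forest) (m : ℕ) : Set where
        constructor filled
        field
          Q   : VSet N
          Q⊆  : Q ⊆ P ∪ U
          cA  : count (Q ∩ A) ≤ m
          cV  : count (Q ∩ (U ∩ V)) + size p ≤ size f
          emb : Emb Q w f

      filled-count : ∀ {U P w f p m} → (r : Filled (U ∖ (⁅ w ⁆ ∪ P)) P w f p m) → count P ≤ size p →
                     count (Filled.Q r ∩ V) ≤ size f
      filled-count {U} {P} {w} {f} {p} (filled Q Q⊆ _ cV _) cP = linear (count (Q ∩ V) ∷ size f ∷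
          count (P ∪ Q ∩ (U ∖ (⁅ w ⁆ ∪ P)) ∩ V) ∷ count P ∷ count (Q ∩ (U ∖ (⁅ w ⁆ ∪ P)) ∩ V) ∷ size p ∷ [])
        (χ 0 ⩽ χ 1) (χ 0 ⊞ χ 2 ⊞ χ 3 ⊞ χ 4 ⊞ χ 5 ⩽ χ 2 ⊞ (χ 3 ⊞ χ 4) ⊞ χ 5 ⊞ χ 1)
        (count-mono sub ⊕ count-∪ P (Q ∩ ((U ∖ (⁅ w ⁆ ∪ P)) ∩ V)) ⊕ cP ⊕ cV)
        where
        sub : Q ∩ V ⊆ P ∪ Q ∩ ((U ∖ (⁅ w ⁆ ∪ P)) ∩ V)
        sub p = [ ∪ˡ , (λ q → ∪ʳ (∩⁺ (∩₁ p) (∩⁺ q (∩₂ p)))) ]′ (∪⁻ (Q⊆ (∩₁ p)))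

      -- Marked vertices sit in `A`, which is red to itself and to `V`, so all edges at them are red
      -- wherever the other end lies. Unmarked vertices come in whole remainders, so only trees with
      -- at most `g` vertices have to be found inside `V`, where `K * g` vertices always remain
      -- free.
      hang : ∀ {f p m} → Cut g f p m → ∀ a U → a ∈ A → m ≤ count (U ∩ A) →
             size f + K * g ≤ count (U ∩ V) → Below U a f m
      fill : ∀ {f p m} → Cut g f p m → ∀ w U P → w ∈ V → P ⊆ V → Disjoint P U → Emb P w p →
             m ≤ count (U ∩ A) → size f + K * g ≤ count (U ∩ V) + size p → Filled U P w f p m

      hang nil a U a∈ hA hV = below ∅ (λ p → ⊥-elim (∉∅ p)) (≤-reflexive (count-empty λ p → ∉∅ (∩₁ p)))
        (≤-reflexive (count-empty λ p → ∉∅ (∩₁ p))) nil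
      hang (keep {c} {s} {pc} {ps} {m} {m′} cc cs small) a U a∈ hA hV
        -- The whole remainder at this child is placed at once; `fill` then puts back what was cut
        -- off below it.
        with smallTree g (U ∩ V) pc small (linear (K ∷ g ∷ count (U ∩ V) ∷ size c ∷ size s ∷ [])
          (χ 0 ⊠ χ 1 ⩽ χ 2) ((# 1 ⊞ χ 3 ⊞ χ 4) ⊞ χ 0 ⊠ χ 1 ⩽ χ 2) hV)
      ... | w , P , w∈ , P⊆ , w∉ , cP , eP
        with fill cc w (U ∖ (⁅ w ⁆ ∪ P)) P (∩₂ w∈) (λ p → ∩₂ (P⊆ p)) (λ p q → ∖₂ q (∪ʳ p)) eP
               (linear (m ∷ count ((U ∖ (⁅ w ⁆ ∪ P)) ∩ A) ∷ m′ ∷ count (U ∩ A) ∷ count ((⁅ w ⁆ ∪ P) ∩ A) ∷ [])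
                 (χ 0 ⩽ χ 1) ((χ 0 ⊞ χ 2) ⊞ χ 3 ⊞ χ 4 ⩽ χ 3 ⊞ (χ 1 ⊞ χ 4) ⊞ # 0)
                 (hA ⊕ count-∖∩ U (⁅ w ⁆ ∪ P) A ⊕ wP∩A))
               (linear (size c ∷ K ∷ g ∷ count ((U ∖ (⁅ w ⁆ ∪ P)) ∩ V) ∷ size pc ∷ size s ∷ count (U ∩ V) ∷
                 count ((⁅ w ⁆ ∪ P) ∩ V) ∷ [])
                 (χ 0 ⊞ χ 1 ⊠ χ 2 ⩽ χ 3 ⊞ χ 4)
                 (((# 1 ⊞ χ 0 ⊞ χ 5) ⊞ χ 1 ⊠ χ 2) ⊞ χ 6 ⊞ χ 7 ⩽ χ 6 ⊞ (χ 3 ⊞ χ 7) ⊞ # 1 ⊞ χ 4)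
                 (hV ⊕ count-∖∩ U (⁅ w ⁆ ∪ P) V ⊕ wP∩V))
        where
        wP∩A : count ((⁅ w ⁆ ∪ P) ∩ A) ≤ 0
        wP∩A = ≤-reflexive (count-empty λ {x} p → A∩V (∩₂ p)
          ([ (λ q → subst (_∈ V) (⁅⁆⁻ q) (∩₂ w∈)) , (λ q → ∩₂ (P⊆ q)) ]′ (∪⁻ (∩₁ p))))
        wP∩V : count ((⁅ w ⁆ ∪ P) ∩ V) ≤ suc (size pc)
        wP∩V = linear (count ((⁅ w ⁆ ∪ P) ∩ V) ∷ size pc ∷ count (⁅ w ⁆ ∪ P) ∷ count ⁅ w ⁆ ∷ count P ∷ [])
          (χ 0 ⩽ # 1 ⊞ χ 1) (χ 0 ⊞ χ 2 ⊞ χ 3 ⊞ χ 4 ⩽ χ 2 ⊞ (χ 3 ⊞ χ 4) ⊞ # 1 ⊞ χ 1)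
          (count-mono {A = (⁅ w ⁆ ∪ P) ∩ V} {⁅ w ⁆ ∪ P} ∩₁ ⊕ count-∪ ⁅ w ⁆ P ⊕ eq≤ (count-⁅⁆ w) ⊕ cP)
      ... | filled Q Q⊆ cA cV eQ
        with hang cs a (U ∖ (⁅ w ⁆ ∪ Q)) a∈
               (linear (m′ ∷ count ((U ∖ (⁅ w ⁆ ∪ Q)) ∩ A) ∷ m ∷ count (U ∩ A) ∷ count ((⁅ w ⁆ ∪ Q) ∩ A) ∷
                 count (⁅ w ⁆ ∩ A) ∷ count (Q ∩ A) ∷ [])
                 (χ 0 ⩽ χ 1)
                 ((χ 2 ⊞ χ 0) ⊞ χ 3 ⊞ χ 4 ⊞ χ 5 ⊞ χ 6 ⩽ χ 3 ⊞ (χ 1 ⊞ χ 4) ⊞ (χ 5 ⊞ χ 6) ⊞ # 0 ⊞ χ 2)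
                 (hA ⊕ count-∖∩ U (⁅ w ⁆ ∪ Q) A ⊕ count-∪∩ ⁅ w ⁆ Q A ⊕ count-⊆0 w∉A ⊕ cA))
               (linear (size s ∷ K ∷ g ∷ count ((U ∖ (⁅ w ⁆ ∪ Q)) ∩ V) ∷ size c ∷ count (U ∩ V) ∷
                 count ((⁅ w ⁆ ∪ Q) ∩ V) ∷ count (⁅ w ⁆ ∩ V) ∷ count (Q ∩ V) ∷ [])
                 (χ 0 ⊞ χ 1 ⊠ χ 2 ⩽ χ 3)
                 (((# 1 ⊞ χ 4 ⊞ χ 0) ⊞ χ 1 ⊠ χ 2) ⊞ χ 5 ⊞ χ 6 ⊞ χ 7 ⊞ χ 8 ⩽ χ 5 ⊞ (χ 3 ⊞ χ 6) ⊞ (χ 7 ⊞ χ 8) ⊞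
                   # 1 ⊞ χ 4)
                 (hV ⊕ count-∖∩ U (⁅ w ⁆ ∪ Q) V ⊕ count-∪∩ ⁅ w ⁆ Q V ⊕ count-∩⁅⁆ V w ⊕
                     filled-count {f = c} {pc} (filled Q Q⊆ cA cV eQ) cP))
        where
        w∉A : w ∉ A
        w∉A p = A∩V p (∩₂ w∈)
      ... | below R R⊆ cA′ cV′ eR = below (⁅ w ⁆ ∪ Q ∪ R)
        (join-⊆ (∩₁ w∈) (λ p → [ (λ q → ∩₁ (P⊆ q)) , ∖₁ ]′ (∪⁻ (Q⊆ p))) (λ p → ∖₁ (R⊆ p)))
        (linear (count ((⁅ w ⁆ ∪ Q ∪ R) ∩ A) ∷ m ∷ m′ ∷ count (⁅ w ⁆ ∩ A) ∷ count (Q ∩ A) ∷ count (R ∩ A) ∷ [])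
          (χ 0 ⩽ χ 1 ⊞ χ 2) (χ 0 ⊞ χ 3 ⊞ χ 4 ⊞ χ 5 ⩽ (χ 3 ⊞ χ 4 ⊞ χ 5) ⊞ # 0 ⊞ χ 1 ⊞ χ 2)
          (join-count∩ w Q R A ⊕ count-⊆0 {A = A} (λ p → A∩V p (∩₂ w∈)) ⊕ cA ⊕ cA′))
        (linear (count ((⁅ w ⁆ ∪ Q ∪ R) ∩ V) ∷ size c ∷ size s ∷ count (⁅ w ⁆ ∩ V) ∷ count (Q ∩ V) ∷
          count (R ∩ V) ∷ [])
          (χ 0 ⩽ # 1 ⊞ χ 1 ⊞ χ 2) (χ 0 ⊞ χ 3 ⊞ χ 4 ⊞ χ 5 ⩽ (χ 3 ⊞ χ 4 ⊞ χ 5) ⊞ # 1 ⊞ χ 1 ⊞ χ 2)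
          (join-count∩ w Q R V ⊕ count-∩⁅⁆ V w ⊕ filled-count {f = c} {pc} (filled Q Q⊆ cA cV eQ) cP ⊕ cV′))
        (join (redAV a∈ (∩₂ w∈)) (λ p → [ w∉ , (λ q → ∖₂ q (∪ˡ (∈⁅⁆ refl))) ]′ (∪⁻ (Q⊆ p)))
              (λ p → ∖₂ (R⊆ p) (∪ˡ (∈⁅⁆ refl))) (λ p q → ∖₂ (R⊆ q) (∪ʳ p)) eQ eR)
      hang (mark {c} {s} {pc} {ps} {m} {m′} cc cs _) a U a∈ hA hV
        with inhabited {A = U ∩ A} (≤-trans (s≤s z≤n) hA)
      ... | a′ , a′∈
        with hang cc a′ (U ∖ ⁅ a′ ⁆) (∩₂ a′∈)
               (linear (m ∷ count ((U ∖ ⁅ a′ ⁆) ∩ A) ∷ m′ ∷ count (U ∩ A) ∷ count (⁅ a′ ⁆ ∩ A) ∷ [])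
                 (χ 0 ⩽ χ 1) ((# 1 ⊞ χ 0 ⊞ χ 2) ⊞ χ 3 ⊞ χ 4 ⩽ χ 3 ⊞ (χ 1 ⊞ χ 4) ⊞ # 1)
                 (hA ⊕ count-∖∩ U ⁅ a′ ⁆ A ⊕ count-∩⁅⁆ A a′))
               (linear (size c ∷ K ∷ g ∷ count ((U ∖ ⁅ a′ ⁆) ∩ V) ∷ size s ∷ count (U ∩ V) ∷
                 count (⁅ a′ ⁆ ∩ V) ∷ [])
                 (χ 0 ⊞ χ 1 ⊠ χ 2 ⩽ χ 3)
                 ((# 1 ⊞ (χ 0 ⊞ χ 4) ⊞ χ 1 ⊠ χ 2) ⊞ χ 5 ⊞ χ 6 ⩽ χ 5 ⊞ (χ 3 ⊞ χ 6) ⊞ # 1)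
                 (hV ⊕ count-∖∩ U ⁅ a′ ⁆ V ⊕ count-∩⁅⁆ V a′))
      ... | below P P⊆ cA cV eP
        with hang cs a (U ∖ ⁅ a′ ⁆ ∖ P) a∈
               (linear (m′ ∷ count ((U ∖ ⁅ a′ ⁆ ∖ P) ∩ A) ∷ m ∷ count (U ∩ A) ∷ count (⁅ a′ ⁆ ∩ A) ∷
                 count ((U ∖ ⁅ a′ ⁆) ∩ A) ∷ count (P ∩ A) ∷ [])
                 (χ 0 ⩽ χ 1)
                 ((# 1 ⊞ χ 2 ⊞ χ 0) ⊞ χ 3 ⊞ χ 4 ⊞ χ 5 ⊞ χ 6 ⩽ χ 3 ⊞ (χ 5 ⊞ χ 4) ⊞ # 1 ⊞ (χ 1 ⊞ χ 6) ⊞ χ 2)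
                 (hA ⊕ count-∖∩ U ⁅ a′ ⁆ A ⊕ count-∩⁅⁆ A a′ ⊕ count-∖∩ (U ∖ ⁅ a′ ⁆) P A ⊕ cA))
               (linear (size s ∷ K ∷ g ∷ count ((U ∖ ⁅ a′ ⁆ ∖ P) ∩ V) ∷ size c ∷ count (U ∩ V) ∷
                 count (⁅ a′ ⁆ ∩ V) ∷ count ((U ∖ ⁅ a′ ⁆) ∩ V) ∷ count (P ∩ V) ∷ [])
                 (χ 0 ⊞ χ 1 ⊠ χ 2 ⩽ χ 3)
                 ((# 1 ⊞ (χ 4 ⊞ χ 0) ⊞ χ 1 ⊠ χ 2) ⊞ χ 5 ⊞ χ 6 ⊞ χ 7 ⊞ χ 8 ⩽ χ 5 ⊞ (χ 7 ⊞ χ 6) ⊞ # 1 ⊞ (χ 3 ⊞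
                   χ 8) ⊞ χ 4)
                 (hV ⊕ count-∖∩ U ⁅ a′ ⁆ V ⊕ count-∩⁅⁆ V a′ ⊕ count-∖∩ (U ∖ ⁅ a′ ⁆) P V ⊕ cV))
      ... | below R R⊆ cA′ cV′ eR = below (⁅ a′ ⁆ ∪ P ∪ R)
        (join-⊆ (∩₁ a′∈) (λ p → ∖₁ (P⊆ p)) (λ p → ∖₁ (∖₁ (R⊆ p))))
        (linear (count ((⁅ a′ ⁆ ∪ P ∪ R) ∩ A) ∷ m ∷ m′ ∷ count (⁅ a′ ⁆ ∩ A) ∷ count (P ∩ A) ∷ count (R ∩ A) ∷
          [])
          (χ 0 ⩽ # 1 ⊞ χ 1 ⊞ χ 2) (χ 0 ⊞ χ 3 ⊞ χ 4 ⊞ χ 5 ⩽ (χ 3 ⊞ χ 4 ⊞ χ 5) ⊞ # 1 ⊞ χ 1 ⊞ χ 2)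
          (join-count∩ a′ P R A ⊕ count-∩⁅⁆ A a′ ⊕ cA ⊕ cA′))
        (linear (count ((⁅ a′ ⁆ ∪ P ∪ R) ∩ V) ∷ size c ∷ size s ∷ count (⁅ a′ ⁆ ∩ V) ∷ count (P ∩ V) ∷
          count (R ∩ V) ∷ [])
          (χ 0 ⩽ # 1 ⊞ χ 1 ⊞ χ 2) (χ 0 ⊞ χ 3 ⊞ χ 4 ⊞ χ 5 ⩽ (χ 3 ⊞ χ 4 ⊞ χ 5) ⊞ # 1 ⊞ χ 1 ⊞ χ 2)
          (join-count∩ a′ P R V ⊕ count-∩⁅⁆ V a′ ⊕ cV ⊕ cV′))
        (join (redA a∈ (∩₂ a′∈)) (λ p → ∖₂ (P⊆ p) (∈⁅⁆ refl)) (λ p → ∖₂ (∖₁ (R⊆ p)) (∈⁅⁆ refl))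
              (λ p q → ∖₂ (R⊆ q) p) eP eR)

      fill nil w U P w∈ P⊆ d e hA hV = filled ∅ (λ p → ⊥-elim (∉∅ p))
        (≤-reflexive (count-empty λ p → ∉∅ (∩₁ p)))
        (≤-reflexive (trans (+-identityʳ _) (count-empty λ p → ∉∅ (∩₁ p)))) nil
      fill (keep {c} {s} {pc} {ps} {m} {m′} cc cs _) w U P w∈ P⊆ d (cons w′ A₁ B₁ w′∈ r A₁⊆ B₁⊆ w′∉A w′∉B dAB ec es) hA hV
        with fill cc w′ U A₁ (P⊆ w′∈) (λ p → P⊆ (A₁⊆ p)) (λ p → d (A₁⊆ p)) ec
               (linear (m ∷ count (U ∩ A) ∷ m′ ∷ []) (χ 0 ⩽ χ 1) (χ 0 ⊞ χ 2 ⩽ χ 1)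
                 hA) (linear (size c ∷ K ∷ g ∷ count (U ∩ V) ∷ size pc ∷ size s ∷ size ps ∷ [])
                   (χ 0 ⊞ χ 1 ⊠ χ 2 ⩽ χ 3 ⊞ χ 4)
                   (((# 1 ⊞ χ 0 ⊞ χ 5) ⊞ χ 1 ⊠ χ 2) ⊞ χ 6 ⩽ (χ 3 ⊞ # 1 ⊞ χ 4 ⊞ χ 6) ⊞ χ 5)
                   (hV ⊕ cut-size cs))
      ... | filled Q Q⊆ cA cV eQ
        with fill cs w (U ∖ Q) B₁ w∈ (λ p → P⊆ (B₁⊆ p)) (λ p q → d (B₁⊆ p) (∖₁ q)) es
               (linear (m′ ∷ count ((U ∖ Q) ∩ A) ∷ m ∷ count (U ∩ A) ∷ count (Q ∩ A) ∷ []) (χ 0 ⩽ χ 1)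
                 ((χ 2 ⊞ χ 0) ⊞ χ 3 ⊞ χ 4 ⩽ χ 3 ⊞ (χ 1 ⊞ χ 4) ⊞ χ 2) (hA ⊕ count-∖∩ U Q A ⊕ cA))
               (linear (size s ∷ K ∷ g ∷ count ((U ∖ Q) ∩ V) ∷ size ps ∷ size c ∷ count (Q ∩ U ∩ V) ∷
                 size pc ∷ count (U ∩ V) ∷ [])
                 (χ 0 ⊞ χ 1 ⊠ χ 2 ⩽ χ 3 ⊞ χ 4)
                 (((# 1 ⊞ χ 5 ⊞ χ 0) ⊞ χ 1 ⊠ χ 2) ⊞ (χ 6 ⊞ χ 7) ⊞ χ 8 ⩽ (χ 8 ⊞ # 1 ⊞ χ 7 ⊞ χ 4) ⊞ χ 5 ⊞ χ 3 ⊞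
                   χ 6)
                 (hV ⊕ cV ⊕ U∩V))
        where
        h : U ∩ V ⊆ (U ∖ Q) ∩ V ∪ Q ∩ (U ∩ V)
        h {x} p with x ∈? Q
        ... | inj₁ q = ∪ʳ (∩⁺ q p)
        ... | inj₂ q = ∪ˡ (∩⁺ (∖⁺ (∩₁ p) q) (∩₂ p))
        U∩V : count (U ∩ V) ≤ count ((U ∖ Q) ∩ V) + count (Q ∩ (U ∩ V))
        U∩V = ≤-trans (count-mono h) (count-∪ ((U ∖ Q) ∩ V) (Q ∩ (U ∩ V)))
      ... | filled R R⊆ cA′ cV′ eR = filled (⁅ w′ ⁆ ∪ Q ∪ R)
        (join-⊆ (∪ˡ w′∈) (λ p → [ (λ q → ∪ˡ (A₁⊆ q)) , ∪ʳ ]′ (∪⁻ (Q⊆ p)))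
                         (λ p → [ (λ q → ∪ˡ (B₁⊆ q)) , (λ q → ∪ʳ (∖₁ q)) ]′ (∪⁻ (R⊆ p))))
        (linear (count ((⁅ w′ ⁆ ∪ Q ∪ R) ∩ A) ∷ m ∷ m′ ∷ count (⁅ w′ ⁆ ∩ A) ∷ count (Q ∩ A) ∷ count (R ∩ A) ∷
          [])
          (χ 0 ⩽ χ 1 ⊞ χ 2) (χ 0 ⊞ χ 3 ⊞ χ 4 ⊞ χ 5 ⩽ (χ 3 ⊞ χ 4 ⊞ χ 5) ⊞ # 0 ⊞ χ 1 ⊞ χ 2)
          (join-count∩ w′ Q R A ⊕ count-⊆0 {A = A} (λ p → A∩V p (P⊆ w′∈)) ⊕ cA ⊕ cA′))
        (linear (count ((⁅ w′ ⁆ ∪ Q ∪ R) ∩ U ∩ V) ∷ size pc ∷ size ps ∷ size c ∷ size s ∷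
          count (⁅ w′ ⁆ ∩ U ∩ V) ∷ count (Q ∩ U ∩ V) ∷ count (R ∩ (U ∖ Q) ∩ V) ∷ count (R ∩ U ∩ V) ∷ [])
          (χ 0 ⊞ # 1 ⊞ χ 1 ⊞ χ 2 ⩽ # 1 ⊞ χ 3 ⊞ χ 4)
          (χ 0 ⊞ χ 5 ⊞ (χ 6 ⊞ χ 1) ⊞ (χ 7 ⊞ χ 2) ⊞ χ 8 ⩽ (χ 5 ⊞ χ 6 ⊞ χ 8) ⊞ # 0 ⊞ χ 3 ⊞ χ 4 ⊞ χ 7)
          (join-count∩ w′ Q R (U ∩ V) ⊕ count-⊆0 {A = U ∩ V} (λ p → d w′∈ (∩₁ p)) ⊕ cV ⊕ cV′ ⊕ count-mono R-⊆))
        (join r (λ p → [ w′∉A , d w′∈ ]′ (∪⁻ (Q⊆ p)))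
                (λ p → [ w′∉B , (λ q → d w′∈ (∖₁ q)) ]′ (∪⁻ (R⊆ p)))
                (λ p q → [ (λ r′ → [ (λ s′ → dAB s′ r′) , d (B₁⊆ r′) ]′ (∪⁻ (Q⊆ p))) , (λ r′ →
                  ∖₂ r′ p) ]′ (∪⁻ (R⊆ q)))
                eQ eR)
        where
        R-⊆ : R ∩ (U ∩ V) ⊆ R ∩ ((U ∖ Q) ∩ V)
        R-⊆ p = ∩⁺ (∩₁ p) (∩⁺ ([ (λ q → ⊥-elim (d (B₁⊆ q) (∩₁ (∩₂ p)))) , (λ q → q) ]′ (∪⁻ (R⊆ (∩₁ p))))
            (∩₂ (∩₂ p)))
      fill (mark {c} {s} {pc} {ps} {m} {m′} cc cs _) w U P w∈ P⊆ d e hA hV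
        with inhabited {A = U ∩ A} (≤-trans (s≤s z≤n) hA)
      ... | a′ , a′∈
        with hang cc a′ (U ∖ ⁅ a′ ⁆) (∩₂ a′∈)
               (linear (m ∷ count ((U ∖ ⁅ a′ ⁆) ∩ A) ∷ m′ ∷ count (U ∩ A) ∷ count (⁅ a′ ⁆ ∩ A) ∷ [])
                 (χ 0 ⩽ χ 1) ((# 1 ⊞ χ 0 ⊞ χ 2) ⊞ χ 3 ⊞ χ 4 ⩽ χ 3 ⊞ (χ 1 ⊞ χ 4) ⊞ # 1)
                 (hA ⊕ count-∖∩ U ⁅ a′ ⁆ A ⊕ count-∩⁅⁆ A a′))
               (linear (size c ∷ K ∷ g ∷ count ((U ∖ ⁅ a′ ⁆) ∩ V) ∷ size s ∷ count (U ∩ V) ∷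
                 count (⁅ a′ ⁆ ∩ V) ∷ size ps ∷ [])
                 (χ 0 ⊞ χ 1 ⊠ χ 2 ⩽ χ 3)
                 ((# 1 ⊞ (χ 0 ⊞ χ 4) ⊞ χ 1 ⊠ χ 2) ⊞ χ 5 ⊞ χ 6 ⊞ χ 7 ⩽ (χ 5 ⊞ χ 7) ⊞ (χ 3 ⊞ χ 6) ⊞ # 1 ⊞ χ 4)
                 (hV ⊕ count-∖∩ U ⁅ a′ ⁆ V ⊕ count-∩⁅⁆ V a′ ⊕ cut-size cs))
      ... | below Q Q⊆ cA cV eQ
        with fill cs w (U ∖ ⁅ a′ ⁆ ∖ Q) P w∈ P⊆ (λ p q → d p (∖₁ (∖₁ q))) e
               (linear (m′ ∷ count ((U ∖ ⁅ a′ ⁆ ∖ Q) ∩ A) ∷ m ∷ count (U ∩ A) ∷ count (⁅ a′ ⁆ ∩ A) ∷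
                 count ((U ∖ ⁅ a′ ⁆) ∩ A) ∷ count (Q ∩ A) ∷ [])
                 (χ 0 ⩽ χ 1)
                 ((# 1 ⊞ χ 2 ⊞ χ 0) ⊞ χ 3 ⊞ χ 4 ⊞ χ 5 ⊞ χ 6 ⩽ χ 3 ⊞ (χ 5 ⊞ χ 4) ⊞ # 1 ⊞ (χ 1 ⊞ χ 6) ⊞ χ 2)
                 (hA ⊕ count-∖∩ U ⁅ a′ ⁆ A ⊕ count-∩⁅⁆ A a′ ⊕ count-∖∩ (U ∖ ⁅ a′ ⁆) Q A ⊕ cA))
               (linear (size s ∷ K ∷ g ∷ count ((U ∖ ⁅ a′ ⁆ ∖ Q) ∩ V) ∷ size ps ∷ size c ∷ count (U ∩ V) ∷
                 count (⁅ a′ ⁆ ∩ V) ∷ count ((U ∖ ⁅ a′ ⁆) ∩ V) ∷ count (Q ∩ V) ∷ [])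
                 (χ 0 ⊞ χ 1 ⊠ χ 2 ⩽ χ 3 ⊞ χ 4)
                 ((# 1 ⊞ (χ 5 ⊞ χ 0) ⊞ χ 1 ⊠ χ 2) ⊞ χ 6 ⊞ χ 7 ⊞ χ 8 ⊞ χ 9 ⩽ (χ 6 ⊞ χ 4) ⊞ (χ 8 ⊞ χ 7) ⊞ # 1 ⊞
                   (χ 3 ⊞ χ 9) ⊞ χ 5)
                 (hV ⊕ count-∖∩ U ⁅ a′ ⁆ V ⊕ count-∩⁅⁆ V a′ ⊕ count-∖∩ (U ∖ ⁅ a′ ⁆) Q V ⊕ cV))
      ... | filled R R⊆ cA′ cV′ eR = filled (⁅ a′ ⁆ ∪ Q ∪ R)
        (join-⊆ (∪ʳ (∩₁ a′∈)) (λ p → ∪ʳ (∖₁ (Q⊆ p))) (λ p → [ ∪ˡ , (λ q → ∪ʳ (∖₁ (∖₁ q))) ]′ (∪⁻ (R⊆ p))))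
        (linear (count ((⁅ a′ ⁆ ∪ Q ∪ R) ∩ A) ∷ m ∷ m′ ∷ count (⁅ a′ ⁆ ∩ A) ∷ count (Q ∩ A) ∷ count (R ∩ A) ∷
          [])
          (χ 0 ⩽ # 1 ⊞ χ 1 ⊞ χ 2) (χ 0 ⊞ χ 3 ⊞ χ 4 ⊞ χ 5 ⩽ (χ 3 ⊞ χ 4 ⊞ χ 5) ⊞ # 1 ⊞ χ 1 ⊞ χ 2)
          (join-count∩ a′ Q R A ⊕ count-∩⁅⁆ A a′ ⊕ cA ⊕ cA′))
        (linear (count ((⁅ a′ ⁆ ∪ Q ∪ R) ∩ U ∩ V) ∷ size ps ∷ size c ∷ size s ∷ count (⁅ a′ ⁆ ∩ U ∩ V) ∷
          count (Q ∩ U ∩ V) ∷ count (Q ∩ V) ∷ count (R ∩ (U ∖ ⁅ a′ ⁆ ∖ Q) ∩ V) ∷ count (R ∩ U ∩ V) ∷ [])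
          (χ 0 ⊞ χ 1 ⩽ # 1 ⊞ χ 2 ⊞ χ 3)
          (χ 0 ⊞ χ 4 ⊞ χ 5 ⊞ χ 6 ⊞ (χ 7 ⊞ χ 1) ⊞ χ 8 ⩽ (χ 4 ⊞ χ 5 ⊞ χ 8) ⊞ # 1 ⊞ χ 6 ⊞ χ 2 ⊞ χ 3 ⊞ χ 7)
          (join-count∩ a′ Q R (U ∩ V) ⊕ count-∩⁅⁆ (U ∩ V) a′ ⊕ Q∩ ⊕ cV ⊕ cV′ ⊕ count-mono R-⊆))
        (join (redVA w∈ (∩₂ a′∈)) (λ p → ∖₂ (Q⊆ p) (∈⁅⁆ refl))
          (λ p → [ (λ q → d q (∩₁ a′∈)) , (λ q → ∖₂ (∖₁ q) (∈⁅⁆ refl)) ]′ (∪⁻ (R⊆ p)))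
          (λ p q → [ (λ r′ → d r′ (∖₁ (Q⊆ p))) , (λ r′ → ∖₂ r′ p) ]′ (∪⁻ (R⊆ q))) eQ eR)
        where
        Q∩ : count (Q ∩ (U ∩ V)) ≤ count (Q ∩ V)
        Q∩ = count-mono λ p → ∩⁺ (∩₁ p) (∩₂ (∩₂ p))
        R-⊆ : R ∩ (U ∩ V) ⊆ R ∩ ((U ∖ ⁅ a′ ⁆ ∖ Q) ∩ V)
        R-⊆ p = ∩⁺ (∩₁ p) (∩⁺ ([ (λ q → ⊥-elim (d q (∩₁ (∩₂ p)))) , (λ q → q) ]′ (∪⁻ (R⊆ (∩₁ p)))) (∩₂ (∩₂ p)))

-- Re-rooting

_⊹_ : Forest → Forest → Forest
nil      ⊹ f = f
cons c s ⊹ f = cons c (s ⊹ f)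

size-⊹ : ∀ t f → size (t ⊹ f) ≡ size t + size f
size-⊹ nil        f = refl
size-⊹ (cons c s) f = cong suc (trans (cong (size c +_) (size-⊹ s f)) (sym (+-assoc (size c) _ _)))

module Reroot {N} (G : BlueGraph N) where
  open Embedding G

  swap : ∀ {P v c d s} → Emb P v (cons c (cons d s)) → Emb P v (cons d (cons c s))
  swap (cons w A B w∈ r A⊆ B⊆ w∉A w∉B dAB ec (cons w′ C D w′∈ r′ C⊆ D⊆ w′∉C w′∉D dCD ed es)) =
    cons w′ C (⁅ w ⁆ ∪ A ∪ D) (B⊆ w′∈) r′ (λ p → B⊆ (C⊆ p)) (join-⊆ w∈ A⊆ (λ p → B⊆ (D⊆ p))) w′∉C
      (λ p → [ (λ q → w∉B (subst (_∈ B) (sym (⁅⁆⁻ q)) w′∈)) , (λ q → [ (λ a → dAB a w′∈) ,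
        w′∉D ]′ (∪⁻ q)) ]′ (∪⁻ p))
      (λ p q → [ (λ e → w∉B (subst (_∈ B) (sym (⁅⁆⁻ e)) (C⊆ p))) , (λ e → [ (λ a → dAB a (C⊆ p)) ,
        dCD p ]′ (∪⁻ e)) ]′ (∪⁻ q))
      ed (join r w∉A (λ p → w∉B (D⊆ p)) (λ a d → dAB a (D⊆ d)) ec es)

  on-siblings : ∀ {c s t} → (∀ {P v} → Emb P v s → Emb P v t) → ∀ {P v} → Emb P v (cons c s) →
      Emb P v (cons c t)
  on-siblings h (cons w A B w∈ r A⊆ B⊆ w∉A w∉B d ec es) = cons w A B w∈ r A⊆ B⊆ w∉A w∉B d ec (h es)

  shift : ∀ d t s {P v} → Emb P v (cons d (t ⊹ s)) → Emb P v (t ⊹ cons d s)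
  shift d nil        s e = e
  shift d (cons c t) s e = on-siblings (shift d t s) (swap e)

  -- Moving the root along an edge exchanges the two sides of that edge.
  flip : ∀ {c s} → Rooted (cons c s) → Rooted (cons s c)
  flip (v , P , v∉P , cons w A B w∈ r A⊆ B⊆ w∉A w∉B d ec es) = w , ⁅ v ⁆ ∪ B ∪ A
    , (λ p → [ (λ e → v∉P (subst (_∈ P) (sym (⁅⁆⁻ e)) w∈)) , (λ q → [ w∉B , w∉A ]′ (∪⁻ q)) ]′ (∪⁻ p))
    , join (λ p → r (bsym p)) (λ p → v∉P (B⊆ p)) (λ p → v∉P (A⊆ p)) (λ p q → d q p) es ec

  -- Only the branch `up` at the new root may be large. The small branches can be found in any large
  -- set of red neighbours, so `up` is placed without them, and `enough` says how much room this
  -- saves.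
  record Balanced (g : ℕ) (f : Forest) : Set where
    constructor balanced
    field
      up smalls : Forest
      small     : AllSmall g smalls
      enough    : g ≤ suc (size smalls)
      total     : suc (size up + size smalls) ≡ size f
      reroot    : Rooted (cons up smalls) → Rooted f

  -- At the current vertex, `u` is the branch left behind, `t` the children found to be small, `s`
  -- those not yet inspected. A child whose subtree has at least `g` vertices becomes the current
  -- vertex, and everything else its branch left behind. If all children are small, the walk stops,
  -- and the hypothesis that the current subtree has at least `g` vertices becomes `enough`.
  descend : ∀ g u t s → AllSmall g t → g ≤ suc (size t + size s) → Balanced g (cons u (t ⊹ s))
  descend g u t nil sm h = balanced u t sm (linear (g ∷ size t ∷ []) (χ 0 ⩽ # 1 ⊞ χ 1)
    (χ 0 ⩽ # 1 ⊠ (# 1 ⊞ χ 1)) h)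
    (cong (λ n → suc (size u + n)) (sym (trans (size-⊹ t nil) (+-identityʳ (size t)))))
    (λ (v , P , v∉ , e) → v , P , v∉ , on-siblings (⊹nil t) e)
    where
    ⊹nil : ∀ t {P v} → Emb P v t → Emb P v (t ⊹ nil)
    ⊹nil nil        e = e
    ⊹nil (cons c t) e = on-siblings (⊹nil t) e
  descend g u t (cons d s) sm h with g ≤? suc (size d)
  ... | yes p with descend g (cons u (t ⊹ s)) nil d nil p
  ...   | balanced u′ s′ sm′ enough total reroot = balanced u′ s′ sm′ enough
    (trans total (cong suc (≤-antisym
      (linear (size u ∷ size (t ⊹ s) ∷ size d ∷ size (t ⊹ cons d s) ∷ size t ∷ size s ∷ [])
        (# 1 ⊞ (χ 0 ⊞ χ 1) ⊞ χ 2 ⩽ χ 0 ⊞ χ 3) (χ 1 ⊞ χ 4 ⊞ # 1 ⊞ χ 2 ⊞ χ 5 ⩽ (χ 4 ⊞ χ 5) ⊞ χ 3)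
        (eq≤ (size-⊹ t s) ⊕ eq≥ (size-⊹ t (cons d s))))
      (linear (size u ∷ size (t ⊹ cons d s) ∷ size (t ⊹ s) ∷ size d ∷ size t ∷ size s ∷ [])
        (χ 0 ⊞ χ 1 ⩽ # 1 ⊞ (χ 0 ⊞ χ 2) ⊞ χ 3) ((χ 4 ⊞ χ 5) ⊞ χ 1 ⩽ χ 2 ⊞ χ 4 ⊞ # 1 ⊞ χ 3 ⊞ χ 5)
        (eq≥ (size-⊹ t s) ⊕ eq≤ (size-⊹ t (cons d s)))))))
    (λ r → let v , P , v∉ , e = flip (reroot r) in v , P , v∉ , on-siblings (shift d t s) (swap e))
  descend g u t (cons d s) sm h | no ¬p with descend g u (cons d t) s (cons (≤-trans (n≤1+n _) (≰⇒> ¬p)) sm)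
      (linear (g ∷ size d ∷ size t ∷ size s ∷ [])
    (χ 0 ⩽ # 1 ⊞ (# 1 ⊞ χ 1 ⊞ χ 2) ⊞ χ 3) (χ 0 ⩽ # 1 ⊞ χ 2 ⊞ # 1 ⊞ χ 1 ⊞ χ 3)
    h)
  ... | balanced u′ s′ sm′ enough total reroot = balanced u′ s′ sm′ enough
    (trans total (cong (λ n → suc (size u + n)) (≤-antisym
      (linear (size d ∷ size (t ⊹ s) ∷ size (t ⊹ cons d s) ∷ size t ∷ size s ∷ [])
        (# 1 ⊞ χ 0 ⊞ χ 1 ⩽ χ 2) (χ 1 ⊞ χ 3 ⊞ # 1 ⊞ χ 0 ⊞ χ 4 ⩽ (χ 3 ⊞ χ 4) ⊞ χ 2)
        (eq≤ (size-⊹ t s) ⊕ eq≥ (size-⊹ t (cons d s))))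
      (linear (size (t ⊹ cons d s) ∷ size d ∷ size (t ⊹ s) ∷ size t ∷ size s ∷ [])
        (χ 0 ⩽ # 1 ⊞ χ 1 ⊞ χ 2) ((χ 3 ⊞ χ 4) ⊞ χ 0 ⩽ χ 2 ⊞ χ 3 ⊞ # 1 ⊞ χ 1 ⊞ χ 4)
        (eq≥ (size-⊹ t s) ⊕ eq≤ (size-⊹ t (cons d s)))))))
    (λ r → let v , P , v∉ , e = reroot r in v , P , v∉ , on-siblings (shift d t s) e)

  -- The two sides of the first edge have at least `2 * g` vertices together, so one of them has
  -- `g`; the descent enters that side.
  balance : ∀ g f → 1 ≤ g → 2 * g ≤ suc (size f) → Balanced g f
  balance g nil h₁ h = ⊥-elim (1≰0 (linear (g ∷ []) (# 1 ⩽ # 0)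
    (# 2 ⊠ χ 0 ⊞ # 2 ⊠ # 1 ⩽ (# 1 ⊞ # 0) ⊞ # 2 ⊠ χ 0) (h ⊕ 2 ⊛ h₁)))
  balance g (cons c s) h₁ h with g ≤? suc (size s)
  ... | yes p = descend g c nil s nil p
  ... | no ¬p with descend g s nil c nil (linear (g ∷ size c ∷ size s ∷ []) (χ 0 ⩽ # 1 ⊞ # 0 ⊞ χ 1)
    (# 2 ⊠ χ 0 ⊞ # 1 ⊞ # 1 ⊞ χ 2 ⩽ (# 1 ⊞ # 1 ⊞ χ 1 ⊞ χ 2) ⊞ χ 0) (h ⊕ ≰⇒> ¬p))
  ...   | balanced u′ s′ sm′ enough total reroot = balanced u′ s′ sm′ enough
    (trans total (cong suc (+-comm (size s) (size c)))) (λ r → flip (reroot r))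

  module _ (K : ℕ) (noClique : ¬ Clique K full) where
    open NoClique K noClique

    -- All of `P` may lie in the red neighbourhood of `z`, so its size is subtracted there. The `2`
    -- stands for `z` and for the root of the large branch; `σ` allows for a `P` that is larger than
    -- this branch.
    attach : ∀ σ g z u s P → AllSmall g s → z ∉ P → Emb P z (cons u nil) → count P ≤ suc (size u) + σ →
             size u + size s + 2 + σ + K * g ≤ count (full ∖ b z) → Rooted (cons u s)
    attach σ g z u s P sm z∉P (cons w A B w∈ r A⊆ B⊆ w∉A w∉B d e nil) cP h
      with smallTrees g s z (full ∖ b z ∖ ⁅ z ⁆ ∖ P) (λ p → ∖₂ (∖₁ (∖₁ p))) sm
             (linear (size s ∷ K ∷ g ∷ count (full ∖ b z ∖ ⁅ z ⁆ ∖ P) ∷ size u ∷ σ ∷ count P ∷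
               count (full ∖ b z) ∷ count (full ∖ b z ∖ ⁅ z ⁆) ∷ [])
               (χ 0 ⊞ χ 1 ⊠ χ 2 ⩽ χ 3)
               (((((χ 4 ⊞ χ 0) ⊞ # 2) ⊞ χ 5) ⊞ χ 1 ⊠ χ 2) ⊞ χ 6 ⊞ χ 7 ⊞ χ 8 ⩽ χ 7 ⊞ ((# 1 ⊞ χ 4) ⊞ χ 5) ⊞
                 (# 1 ⊞ χ 8) ⊞ χ 3 ⊞ χ 6)
               (h ⊕ cP ⊕ count-delete {A = full ∖ b z} z ⊕ count-∖ (full ∖ b z ∖ ⁅ z ⁆) P))
    ... | Q , Q⊆ , eQ = z , ⁅ w ⁆ ∪ A ∪ Q
      , (λ p → [ (λ q → z∉P (subst (_∈ P) (⁅⁆⁻ q) w∈)) ,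
                 (λ q → [ (λ a → z∉P (A⊆ a)) , (λ a → ∖₂ (∖₁ (Q⊆ a)) (∈⁅⁆ refl)) ]′ (∪⁻ q)) ]′ (∪⁻ p))
      , join r w∉A (λ q → ∖₂ (Q⊆ q) w∈) (λ a q → ∖₂ (Q⊆ q) (A⊆ a)) e eQ

-- Kővári–Sós–Turán counting

module Counting {N} (G : BlueGraph N) where
  open Embedding G using (b; b-sym; bsym)

  Constant : VSet N → VSet N → Set
  Constant E X = ∀ {z} → z ∈ E → X ⊆ b z ⊎ Disjoint X (b z)

  1≤2^ : ∀ e → 1 ≤ 2 ^ e
  1≤2^ e = m^n>0 2 e

  -- Each vertex of `E` splits the current set into its blue and its red neighbours, and the larger
  -- half is kept.
  trace : ∀ e E U → count E ≤ e → ∃ λ X → X ⊆ U × count U ≤ count X * 2 ^ e × Constant E X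
  trace e E U cE with 1 ≤? count E
  ... | no ¬h = U , (λ p → p) , linear (count U ∷ 2 ^ e ∷ []) (χ 0 ⩽ χ 0 ⊠ χ 1) (χ 0 ⊠ # 1 ⩽ χ 0 ⊠ χ 1)
    (count U ⊛ 1≤2^ e)
      , λ {z} z∈ → ⊥-elim (¬h (≤-trans (≤-reflexive (sym (count-⁅⁆ z)))
          (count-mono λ p → subst (_∈ E) (⁅⁆⁻ p) z∈)))
  trace zero    E U cE | yes h = ⊥-elim (1≰0 (≤-trans h cE))
  trace (suc e) E U cE | yes h with inhabited h
  ... | z , z∈ with count (U ∖ b z) ≤? count (U ∩ b z)
  ...   | yes p with trace e (E ∖ ⁅ z ⁆) (U ∩ b z) (linear (count (E ∖ ⁅ z ⁆) ∷ e ∷ count E ∷ [])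
    (χ 0 ⩽ χ 1) (χ 2 ⊞ # 1 ⊞ χ 0 ⩽ (# 1 ⊞ χ 1) ⊞ χ 2) (cE ⊕ count-delete< {A = E} z∈))
  ...     | X , X⊆ , cX , const = X , (λ q → ∩₁ (X⊆ q)) , linear (count U ∷ count X ∷ 2 ^ e ∷
      count (U ∩ b z) ∷ count (U ∖ b z) ∷ [])
    (χ 0 ⩽ χ 1 ⊠ (# 2 ⊠ χ 2)) (# 2 ⊠ χ 3 ⊞ χ 4 ⊞ χ 0 ⩽ # 2 ⊠ (χ 1 ⊠ χ 2) ⊞ χ 3 ⊞ χ 3 ⊞ χ 4)
    (2 ⊛ cX ⊕ p ⊕ eq≤ (count-split U (b z))) , const′
    where
    const′ : Constant E X
    const′ {y} y∈ with y ∈? ⁅ z ⁆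
    ... | inj₂ y≢ = const (∖⁺ y∈ y≢)
    ... | inj₁ y≡ with ⁅⁆⁻ y≡
    ...   | refl = inj₁ λ q → ∩₂ (X⊆ q)
  trace (suc e) E U cE | yes h | z , z∈ | no ¬p
    with trace e (E ∖ ⁅ z ⁆) (U ∖ b z) (linear (count (E ∖ ⁅ z ⁆) ∷ e ∷ count E ∷ []) (χ 0 ⩽ χ 1)
      (χ 2 ⊞ # 1 ⊞ χ 0 ⩽ (# 1 ⊞ χ 1) ⊞ χ 2) (cE ⊕ count-delete< {A = E} z∈))
  ...     | X , X⊆ , cX , const = X , (λ q → ∖₁ (X⊆ q)) , linear (count U ∷ count X ∷ 2 ^ e ∷
      count (U ∖ b z) ∷ count (U ∩ b z) ∷ [])
    (χ 0 ⩽ χ 1 ⊠ (# 2 ⊠ χ 2)) (# 2 ⊠ χ 3 ⊞ χ 4 ⊞ χ 0 ⩽ # 2 ⊠ (χ 1 ⊠ χ 2) ⊞ χ 3 ⊞ χ 4 ⊞ χ 3)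
    (2 ⊛ cX ⊕ ≰⇒≥ ¬p ⊕ eq≤ (count-split U (b z))) , const′
    where
    const′ : Constant E X
    const′ {y} y∈ with y ∈? ⁅ z ⁆
    ... | inj₂ y≢ = const (∖⁺ y∈ y≢)
    ... | inj₁ y≡ with ⁅⁆⁻ y≡
    ...   | refl = inj₂ λ q → ∖₂ (X⊆ q)

  cancel-2^ : ∀ {p c} e → p * 2 ^ e ≤ c * 2 ^ e → p ≤ c
  cancel-2^ {p} {c} e h = *-cancelʳ-≤ p c (2 ^ e) {{m^n≢0 2 e}} h

  record Biclique (s p : ℕ) (D U : VSet N) : Set where
    constructor biclique
    field
      D′ X : VSet N
      D′⊆  : D′ ⊆ D
      cD′  : count D′ ≡ s
      X⊆   : X ⊆ U
      cX   : p ≤ count X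
      blue : ∀ {d x} → d ∈ D′ → x ∈ X → x ∈ b d

  opaque
    Heavy : VSet N → ℕ → VSet N
    Heavy D s = ⟪ (λ _ → s) ≼ (λ x → count (D ∩ b x)) ⟫

    heavy⁺ : ∀ {D s x} → s ≤ count (D ∩ b x) → x ∈ Heavy D s
    heavy⁺ h = ≼⁺ h

    heavy⁻ : ∀ {D s x} → x ∈ Heavy D s → s ≤ count (D ∩ b x)
    heavy⁻ h = ≼⁻ h

  -- If fewer than `p * 2 ^ e` vertices of `U` had `s` blue neighbours in `D`, they would contribute
  -- at most `e` each and all others at most `s` each, which is too little. Among so many heavy
  -- vertices, `p` have the same blue neighbours in `D`. The crude factor `2 ^ e` does no harm, as
  -- `e` will be bounded.
  kst : ∀ D U e s p → 1 ≤ p → count D ≤ e →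
        s * count U + e * (p * 2 ^ e) < ∑∈ D (λ d → count (U ∩ b d)) → Biclique s p D U
  kst D U e s p 1≤p cD h with p * 2 ^ e ≤? count (U ∩ Heavy D s)
  ... | no ¬q = ⊥-elim (1≰0 (linear (s ∷ count U ∷ e ∷ p ∷ 2 ^ e ∷ ∑∈ D (λ x → count (U ∩ b x)) ∷ ∑∈ U (λ x →
      count (D ∩ b x)) ∷ ∑∈ (U ∩ Heavy D s) (λ x → count (D ∩ b x)) ∷ ∑∈ (U ∖ Heavy D s) (λ x →
      count (D ∩ b x)) ∷ count (U ∖ Heavy D s) ∷ count (U ∩ Heavy D s) ∷ [])
    (# 1 ⩽ # 0)
    ((# 1 ⊞ χ 0 ⊠ χ 1 ⊞ χ 2 ⊠ (χ 3 ⊠ χ 4)) ⊞ χ 5 ⊞ χ 6 ⊞ χ 7 ⊞ χ 8 ⊞ χ 0 ⊠ χ 9 ⊞ χ 2 ⊠ χ 10 ⩽ χ 5 ⊞ χ 6 ⊞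
      (χ 7 ⊞ χ 8) ⊞ χ 10 ⊠ χ 2 ⊞ χ 9 ⊠ χ 0 ⊞ χ 0 ⊠ χ 1 ⊞ χ 2 ⊠ (χ 3 ⊠ χ 4))
    (h ⊕ eq≤ (∑∈-swap D U b b-sym) ⊕ eq≤ (∑∈-split U (Heavy D s) (λ x → count (D ∩ b x))) ⊕
                  ∑∈-≤ (U ∩ Heavy D s) (λ x → count (D ∩ b x)) e (λ _ → ≤-trans (count-mono ∩₁) cD) ⊕
                  ∑∈-≤ (U ∖ Heavy D s) (λ x → count (D ∩ b x)) s (λ x∈ → ≰⇒≥ λ s≤ → ∖₂ x∈ (heavy⁺ s≤)) ⊕
                  s ⊛ count-mono {A = U ∖ Heavy D s} {U} ∖₁ ⊕ e ⊛ few)))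
    where
    few : count (U ∩ Heavy D s) ≤ p * 2 ^ e
    few = ≰⇒≥ ¬q
  ... | yes q with trace e D (U ∩ Heavy D s) cD
  ...   | X , X⊆ , cX , const with cancel-2^ e (≤-trans q cX)
  ...     | p≤ with inhabited {A = X} (≤-trans 1≤p p≤)
  ...       | x₀ , x₀∈ with subset-of-size (D ∩ b x₀) s (heavy⁻ (∩₂ (X⊆ x₀∈)))
  ...         | D′ , D′⊆ , cD′ = biclique D′ X (λ d → ∩₁ (D′⊆ d)) cD′ (λ x → ∩₁ (X⊆ x)) p≤ blue
    where
    blue : ∀ {d x} → d ∈ D′ → x ∈ X → x ∈ b d
    blue d∈ x∈ with const (∩₁ (D′⊆ d∈))
    ... | inj₁ X⊆b = X⊆b x∈
    ... | inj₂ dis = ⊥-elim (dis x₀∈ (bsym (∩₂ (D′⊆ d∈))))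

  -- `τ` is the `(w + 1)`-st smallest value of `f` on `Y`.
  level : ∀ (f : Fin N → ℕ) Y w n → w < count (Y ∩ ⟪ f ≼ (λ _ → n) ⟫) →
          ∃ λ τ → τ ≤ n × w < count (Y ∩ ⟪ f ≼ (λ _ → τ) ⟫) × count (Y ∩ ⟪ (λ x → suc (f x)) ≼ (λ _ → τ) ⟫) ≤ w
  level f Y w zero h = 0 , ≤-refl , h , ≤-trans (≤-reflexive (count-empty λ p → 1≰0 (≤-trans (s≤s z≤n)
      (≼⁻ (∩₂ p))))) z≤n
  level f Y w (suc n) h with suc w ≤? count (Y ∩ ⟪ f ≼ (λ _ → n) ⟫)
  ... | yes p with level f Y w n p
  ...   | τ , τ≤ , rest = τ , ≤-trans τ≤ (n≤1+n n) , rest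
  level f Y w (suc n) h | no ¬p = suc n , ≤-refl , h , ≤-trans (count-mono λ q → ∩⁺ (∩₁ q)
      (≼⁺ (≤-pred (≼⁻ (∩₂ q))))) (≮⇒≥ ¬p)

  record EssMin (p e : ℕ) (Y E : VSet N) : Set where
    constructor essMin
    field
      lv    : ℕ
      x     : Fin N
      X     : VSet N
      x∈    : x ∈ X
      X⊆    : X ⊆ Y
      cX    : p ≤ count X
      const : Constant E X
      x≤lv  : count (E ∖ b x) ≤ lv
      lv≤e  : lv ≤ e
      above : p * 2 ^ e < count (Y ∩ ⟪ (λ y → count (E ∖ b y)) ≼ (λ _ → lv) ⟫)
      below : count (Y ∩ ⟪ (λ y → suc (count (E ∖ b y))) ≼ (λ _ → lv) ⟫) ≤ p * 2 ^ e

  -- `lv` is the essential minimum over Y of the number of red neighbours in E; it is attained on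
  -- a large set X of vertices that all have the same neighbours in E.
  essmin : ∀ p e Y E → count E ≤ e → p * 2 ^ e < count Y → EssMin p e Y E
  essmin p e Y E cE h
    with level (λ y → count (E ∖ b y)) Y (p * 2 ^ e) e (≤-trans h (count-mono λ y∈ →
      ∩⁺ y∈ (≼⁺ (≤-trans (count-mono ∖₁) cE))))
  ... | τ , τ≤e , hτ , few with trace e E (Y ∩ ⟪ (λ y → count (E ∖ b y)) ≼ (λ _ → τ) ⟫) cE
  ...   | X , X⊆ , cX , const with inhabited {A = X} (1≤X hτ cX)
    where
    1≤X : ∀ {a b c d} → a < b → b ≤ c * d → 1 ≤ c
    1≤X {c = suc c} _ _ = s≤s z≤n
    1≤X {c = zero} p q = ⊥-elim (1≰0 (≤-trans (s≤s z≤n) (≤-trans p q)))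
  ...     | x , x∈ = essMin τ x X x∈ (λ p → ∩₁ (X⊆ p))
      (cancel-2^ e (≤-trans (<⇒≤ hτ) cX)) const (≼⁻ (∩₂ (X⊆ x∈))) τ≤e hτ few

  -- All but `p * 2 ^ e` vertices of `Y` have at least `lv` red neighbours in `E`, and an
  -- exceptional one falls short by at most `lv ≤ e`.
  essmin-average : ∀ {p e Y E} → (m : EssMin p e Y E) → ∀ Z → Z ⊆ Y →
                   count Z * EssMin.lv m ≤ ∑∈ Z (λ y → count (E ∖ b y)) + p * 2 ^ e * e
  essmin-average {p} {e} {Y} {E} m Z Z⊆ = linear (count Z ∷ lv ∷ ∑∈ Z (λ y → count (E ∖ b y)) ∷ p ∷ 2 ^ e ∷
      e ∷ count (Z ∖ Low) ∷ ∑∈ (Z ∖ Low) (λ y → count (E ∖ b y)) ∷ count (Z ∩ Low) ∷ [])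
    (χ 0 ⊠ χ 1 ⩽ χ 2 ⊞ χ 3 ⊠ χ 4 ⊠ χ 5)
    (χ 1 ⊠ χ 0 ⊞ χ 6 ⊠ χ 1 ⊞ χ 7 ⊞ χ 8 ⊠ χ 1 ⩽ χ 1 ⊠ (χ 8 ⊞ χ 6) ⊞ χ 7 ⊞ χ 2 ⊞ χ 3 ⊠ χ 4 ⊠ χ 5)
    (lv ⊛ eq≤ (count-split Z Low) ⊕
      ∑∈-≥ (Z ∖ Low) (λ y → count (E ∖ b y)) lv (λ y∈ → ≮⇒≥ λ lt → ∖₂ y∈ (≼⁺ lt)) ⊕
      ∑∈-⊆ (Z ∖ Low) Z (λ y → count (E ∖ b y)) ∖₁ ⊕
      *-mono-≤ (≤-trans (count-mono {A = Z ∩ Low} (∩-monoˡ Z⊆)) below) lv≤e)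
    where
    open EssMin m
    Low : VSet N
    Low = ⟪ (λ y → suc (count (E ∖ b y))) ≼ (λ _ → lv) ⟫

-- Blue complete multipartite graphs

total : List ℕ → ℕ
total []       = 0
total (m ∷ ms) = m + total ms

module Multipartite {N} (G : BlueGraph N) where
  open Embedding G using (b; b-sym; bsym; birr; Clique; Clique-mono; nil; cons)

  -- A blue complete multipartite graph in P with parts of at least the given sizes.
  data Multi : List ℕ → VSet N → Set where
    []   : ∀ {P} → Multi [] P
    step : ∀ {m ms P} A P′ → A ⊆ P → m ≤ count A → P′ ⊆ P → (∀ {a x} → a ∈ A → x ∈ P′ → x ∈ b a) →
           Multi ms P′ → Multi (m ∷ ms) P

  peel : ∀ m r P → Clique (m + r) P →
         ∃₂ λ A Q → A ⊆ P × m ≤ count A × Q ⊆ P × (∀ {a x} → a ∈ A → x ∈ Q → x ∈ b a) × Clique r Q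
  peel zero r P K = ∅ , P , (λ p → ⊥-elim (∉∅ p)) , z≤n , (λ p → p) , (λ p → ⊥-elim (∉∅ p)) , K
  peel (suc m) r P (cons x Q x∈ Q⊆ Q⊆b K) with peel m r Q K
  ... | A , R , A⊆ , cA , R⊆ , bl , K′ = A ∪ ⁅ x ⁆ , R
    , (λ p → [ (λ q → Q⊆ (A⊆ q)) , (λ q → subst (_∈ P) (⁅⁆⁻ q) x∈) ]′ (∪⁻ p))
    , ≤-trans (s≤s cA) (count-insert {A = A} (λ p → birr (Q⊆b (A⊆ p))))
    , (λ p → Q⊆ (R⊆ p))
    , (λ p q → [ (λ a → bl a q) , (λ a → subst (λ y → _ ∈ b y) (⁅⁆⁻ a) (Q⊆b (R⊆ q))) ]′ (∪⁻ p)) , K′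

  clique⇒multi : ∀ ms P → Clique (total ms) P → Multi ms P
  clique⇒multi []       P K = []
  clique⇒multi (m ∷ ms) P K with peel m (total ms) P K
  ... | A , Q , A⊆ , cA , Q⊆ , bl , K′ = step A Q A⊆ cA Q⊆ bl (clique⇒multi ms Q K′)

  opaque
    common : VSet N → VSet N
    common A = ⟪ (λ x → count (A ∖ b x)) ≼ (λ _ → 0) ⟫

    common⁺ : ∀ {A x} → count (A ∖ b x) ≤ 0 → x ∈ common A
    common⁺ h = ≼⁺ h

    common⁻ : ∀ {A a x} → a ∈ A → x ∈ common A → x ∈ b a
    common⁻ {A} {a} {x} a∈ x∈ with a ∈? b x
    ... | inj₁ p = bsym p
    ... | inj₂ p = ⊥-elim (1≰0 (≤-trans (count-pos (∖⁺ a∈ p)) (≼⁻ x∈)))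

  common-loss-∑ : ∀ A Y → count Y ≤ count (Y ∩ common A) + ∑∈ A (λ a → count (Y ∖ b a))
  common-loss-∑ A Y = linear (count Y ∷ count (Y ∩ common A) ∷ ∑∈ A (λ a → count (Y ∖ b a)) ∷
      count (Y ∖ common A) ∷ ∑∈ (Y ∖ common A) (λ y → count (A ∖ b y)) ∷ ∑∈ Y (λ x → count (A ∖ b x)) ∷ [])
    (χ 0 ⩽ χ 1 ⊞ χ 2) (χ 0 ⊞ χ 3 ⊠ # 1 ⊞ χ 4 ⊞ χ 5 ⩽ (χ 1 ⊞ χ 3) ⊞ χ 4 ⊞ χ 5 ⊞ χ 2)
    (eq≤ (count-split Y (common A)) ⊕
    ∑∈-≥ (Y ∖ common A) (λ y → count (A ∖ b y)) 1 (λ y∈ → ≮⇒≥ λ lt → ∖₂ y∈ (common⁺ (≤-pred lt))) ⊕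
    ∑∈-⊆ (Y ∖ common A) Y (λ y → count (A ∖ b y)) ∖₁ ⊕ eq≤ (∑∈-swap-∖ Y A b b-sym))

  common-loss : ∀ A Y w → (∀ {a} → a ∈ A → count (Y ∖ b a) ≤ w) → count Y ≤ count (Y ∩ common A) + count A * w
  common-loss A Y w h = linear (count Y ∷ count (Y ∩ common A) ∷ count A ∷ w ∷ ∑∈ A (λ a → count (Y ∖ b a)) ∷
      [])
    (χ 0 ⩽ χ 1 ⊞ χ 2 ⊠ χ 3) (χ 0 ⊞ χ 4 ⩽ (χ 1 ⊞ χ 4) ⊞ χ 2 ⊠ χ 3) (common-loss-∑ A Y ⊕ ∑∈-≤ A (λ a →
      count (Y ∖ b a)) w h)

  LowRed : ℕ → VSet N → VSet N → Set
  LowRed w X Y = ∀ x → x ∈ X → count (Y ∖ b x) ≤ w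

  -- Parts are chosen one after the other inside the hosts Xs; a chosen part of size m costs at most
  -- m * w vertices of every later host.
  select : ∀ M w ms Xs P → length ms ≤ length Xs → All (_≤ M) ms → AllPairs (LowRed w) Xs →
           All (λ X → total ms * w + M ≤ count (P ∩ X)) Xs → Multi ms P
  select M w [] Xs P _ _ _ _ = []
  select M w (m ∷ ms) (X ∷ Xs) P (s≤s len) (m≤ ∷ ms≤) (low ∷ lows) (cX ∷ cXs)
    with subset-of-size (P ∩ X) m (linear (m ∷ count (P ∩ X) ∷ total ms ∷ w ∷ M ∷ []) (χ 0 ⩽ χ 1)
      (((χ 0 ⊞ χ 2) ⊠ χ 3 ⊞ χ 4) ⊞ χ 0 ⩽ χ 1 ⊞ χ 4) (cX ⊕ m≤))
  ... | A , A⊆ , cA = step A (P ∩ common A) (λ p → ∩₁ (A⊆ p)) (≤-reflexive (sym cA)) ∩₁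
      (λ a∈ x∈ → common⁻ a∈ (∩₂ x∈))
      (select M w ms Xs (P ∩ common A) len ms≤ lows (All.zipWith (λ (l , c) → bound _ l c) (low , cXs)))
    where
    bound : ∀ Y → LowRed w X Y → (m + total ms) * w + M ≤ count (P ∩ Y) →
            total ms * w + M ≤ count ((P ∩ common A) ∩ Y)
    bound Y l c = linear (total ms ∷ w ∷ M ∷ count ((P ∩ common A) ∩ Y) ∷ m ∷ count (P ∩ Y) ∷ count A ∷
        count ((P ∩ Y) ∩ common A) ∷ [])
      (χ 0 ⊠ χ 1 ⊞ χ 2 ⩽ χ 3)
      (((χ 4 ⊞ χ 0) ⊠ χ 1 ⊞ χ 2) ⊞ χ 5 ⊞ χ 6 ⊠ χ 1 ⊞ χ 7 ⩽ χ 5 ⊞ (χ 7 ⊞ χ 6 ⊠ χ 1) ⊞ χ 4 ⊠ χ 1 ⊞ χ 3)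
      (c ⊕ common-loss A (P ∩ Y) w
      (λ a∈ → ≤-trans (count-mono (∖-mono ∩₂)) (l _ (∩₂ (A⊆ a∈)))) ⊕
      *-monoˡ-≤ w (≤-reflexive cA) ⊕
      count-mono {A = (P ∩ Y) ∩ common A} {(P ∩ common A) ∩ Y} (λ p → ∩⁺ (∩⁺ (∩₁ (∩₁ p)) (∩₂ p)) (∩₂ (∩₁ p))))

  ramsey : ∀ a c U → 2 ^ (a + c) ≤ count U →
           (∃ λ A → A ⊆ U × a ≤ count A × (∀ {x y} → x ∈ A → y ∈ A → y ∉ b x)) ⊎ Clique c U
  ramsey zero c U h = inj₁ (∅ , (λ p → ⊥-elim (∉∅ p)) , z≤n , λ p → ⊥-elim (∉∅ p))
  ramsey (suc a) zero U h = inj₂ nil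
  ramsey (suc a) (suc c) U h with inhabited {A = U} (≤-trans (m^n>0 2 (suc a + suc c)) h)
  ... | x , x∈ with 2 ^ (a + suc c) ≤? count (U ∖ ⁅ x ⁆ ∖ b x)
  ...   | yes p with ramsey a (suc c) (U ∖ ⁅ x ⁆ ∖ b x) p
  ...     | inj₂ K = inj₂ (Clique-mono (λ q → ∖₁ (∖₁ q)) K)
  ...     | inj₁ (A , A⊆ , cA , red) = inj₁ (A ∪ ⁅ x ⁆
    , (λ q → [ (λ r → ∖₁ (∖₁ (A⊆ r))) , (λ r → subst (_∈ U) (⁅⁆⁻ r) x∈) ]′ (∪⁻ q))
    , ≤-trans (s≤s cA) (count-insert {A = A} λ q → ∖₂ (∖₁ (A⊆ q)) (∈⁅⁆ refl))
    , red′)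
    where
    red′ : ∀ {y z} → y ∈ A ∪ ⁅ x ⁆ → z ∈ A ∪ ⁅ x ⁆ → z ∉ b y
    red′ y∈ z∈ with ∪⁻ y∈ | ∪⁻ z∈
    ... | inj₁ p | inj₁ q = red p q
    ... | inj₁ p | inj₂ q with ⁅⁆⁻ q
    ...   | refl = λ r → ∖₂ (A⊆ p) (bsym r)
    red′ y∈ z∈ | inj₂ p | inj₁ q with ⁅⁆⁻ p
    ...   | refl = ∖₂ (A⊆ q)
    red′ y∈ z∈ | inj₂ p | inj₂ q with ⁅⁆⁻ p | ⁅⁆⁻ q
    ...   | refl | refl = birr
  ramsey (suc a) (suc c) U h | x , x∈ | no ¬p
    with ramsey (suc a) c ((U ∖ ⁅ x ⁆) ∩ b x) (subst (λ e → 2 ^ e ≤ count ((U ∖ ⁅ x ⁆) ∩ b x)) (+-suc a c)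
           (linear (2 ^ (a + suc c) ∷ count ((U ∖ ⁅ x ⁆) ∩ b x) ∷ count (U ∖ ⁅ x ⁆ ∖ b x) ∷ count U ∷
             count (U ∖ ⁅ x ⁆) ∷ [])
             (χ 0 ⩽ χ 1) (# 2 ⊠ χ 0 ⊞ (# 1 ⊞ χ 2) ⊞ χ 3 ⊞ χ 4 ⩽ χ 3 ⊞ χ 0 ⊞ (# 1 ⊞ χ 4) ⊞ χ 1 ⊞ χ 2)
             (h ⊕ ≰⇒> ¬p ⊕ count-delete {A = U} x ⊕ eq≤ (count-split (U ∖ ⁅ x ⁆) (b x)))))
  ... | inj₁ (A , A⊆ , rest) = inj₁ (A , (λ q → ∖₁ (∩₁ (A⊆ q))) , rest)
  ... | inj₂ K = inj₂ (cons x ((U ∖ ⁅ x ⁆) ∩ b x) x∈ (λ q → ∖₁ (∩₁ q)) ∩₂ K)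

sum-but-one : ∀ {n} (f : Fin n → ℕ) c → (∀ i → f i ≤ c) → ∀ i → sum f + c ≤ f i + n * c
sum-but-one {suc n} f c h zero = linear (sum f ∷ c ∷ f zero ∷ n ∷ sum (λ i → f (suc i)) ∷ sum (λ z → c) ∷ [])
  (χ 0 ⊞ χ 1 ⩽ χ 2 ⊞ (# 1 ⊞ χ 3) ⊠ χ 1) (χ 0 ⊞ χ 4 ⊞ χ 5 ⩽ (χ 2 ⊞ χ 4) ⊞ χ 5 ⊞ χ 3 ⊠ χ 1)
  (eq≤ (sum-suc f) ⊕ sum-mono {f = λ i → f (suc i)} {λ _ → c} (λ i → h (suc i)) ⊕ eq≤ (sum-const n c))
sum-but-one {suc n} f c h (suc i) = linear (sum f ∷ c ∷ f (suc i) ∷ n ∷ f zero ∷ sum (λ i → f (suc i)) ∷ [])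
  (χ 0 ⊞ χ 1 ⩽ χ 2 ⊞ (# 1 ⊞ χ 3) ⊠ χ 1) (χ 0 ⊞ χ 4 ⊞ χ 5 ⊞ χ 1 ⩽ (χ 4 ⊞ χ 5) ⊞ χ 1 ⊞ χ 2 ⊞ χ 3 ⊠ χ 1)
  (eq≤ (sum-suc f) ⊕ h zero ⊕ sum-but-one (λ i → f (suc i)) c (λ i → h (suc i)) i)

infixr 5 _◂_

_◂_ : ∀ {a} {X : Set a} {j} → X → (Fin j → X) → Fin (suc j) → X
(x ◂ f) zero    = x
(x ◂ f) (suc i) = f i

sum-◂ : ∀ {N j} (A : VSet N) (V : Fin j → VSet N) →
        sum (λ i → count ((A ◂ V) i)) ≡ count A + sum (λ i → count (V i))
sum-◂ A V = sum-suc _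

-- Hubs: red cliques that are completely red to a large set

module Hubs {N} (G : BlueGraph N) (K : ℕ) (noClique : ¬ Embedding.Clique G K full) where
  open Embedding G
  open NoClique K noClique
  open Reroot G
  open Counting G
  open Multipartite G

  record IsHub (S : ℕ) (A V : VSet N) : Set where
    field
      A∩V   : Disjoint A V
      redA  : ∀ {x y} → x ∈ A → y ∈ A → y ∉ b x
      redAV : ∀ {x y} → x ∈ A → y ∈ V → y ∉ b x
      cA    : count A ≡ S

  -- At most `size f / g` vertices are cut, and they go into `A`. There must be strictly fewer than
  -- `S` of them because `a` itself takes one of the `S` places.
  hub-embeds : ∀ {S A V} → IsHub S A V → ∀ g f a → a ∈ A → size f + K * g ≤ count V → size f < S * g →
               ∃ λ P → a ∉ P × Emb P a f × count P ≤ size f + S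
  hub-embeds {S} {A} {V} H g f a a∈ hV hS with cut g f
  ... | p , m , c , hm with Hub.hang g A V A∩V redA redAV c a ((A ∪ V) ∖ ⁅ a ⁆) a∈
         (≤-trans (≤-pred (≤-trans m<S (≤-trans (≤-reflexive (sym cA)) (count-delete {A = A} a))))
             (count-mono (λ p → ∩⁺ (∖⁺ (∪ˡ (∖₁ p)) (∖₂ p)) (∖₁ p))))
         (≤-trans hV (count-mono (λ p → ∩⁺ (∖⁺ (∪ʳ p) (λ q → A∩V (subst (_∈ A) (⁅⁆⁻ q) a∈) p)) p)))
    where
    open IsHub H
    m<S : m < S
    m<S = *-cancelʳ-< g m S (linear (m ∷ g ∷ S ∷ size p ∷ size f ∷ []) (# 1 ⊞ χ 0 ⊠ χ 1 ⩽ χ 2 ⊠ χ 1)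
      ((χ 0 ⊠ χ 1 ⊞ χ 3) ⊞ # 1 ⊞ χ 4 ⩽ χ 4 ⊞ χ 2 ⊠ χ 1) (hm ⊕ hS))
  ...   | Hub.below P P⊆ cPA cPV e = P , (λ p → ∖₂ (P⊆ p) (∈⁅⁆ refl)) , e
    , linear (count P ∷ size f ∷ S ∷ count (P ∩ A ∪ P ∩ V) ∷ count (P ∩ A) ∷ count (P ∩ V) ∷ m ∷ [])
      (χ 0 ⩽ χ 1 ⊞ χ 2) (χ 0 ⊞ χ 3 ⊞ χ 4 ⊞ χ 5 ⊞ χ 6 ⩽ χ 3 ⊞ (χ 4 ⊞ χ 5) ⊞ χ 6 ⊞ χ 1 ⊞ χ 2)
      (count-mono P⊆′ ⊕ count-∪ (P ∩ A) (P ∩ V) ⊕ cPA ⊕ cPV ⊕ m≤S)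
    where
    P⊆′ : P ⊆ P ∩ A ∪ P ∩ V
    P⊆′ p = [ (λ q → ∪ˡ (∩⁺ p q)) , (λ q → ∪ʳ (∩⁺ p q)) ]′ (∪⁻ (∖₁ (P⊆ p)))
    m≤S : m ≤ S
    m≤S = <⇒≤ (*-cancelʳ-< g m S (linear (m ∷ g ∷ S ∷ size p ∷ size f ∷ []) (# 1 ⊞ χ 0 ⊠ χ 1 ⩽ χ 2 ⊠ χ 1)
      ((χ 0 ⊠ χ 1 ⊞ χ 3) ⊞ # 1 ⊞ χ 4 ⩽ χ 4 ⊞ χ 2 ⊠ χ 1) (hm ⊕ hS)))

  module _ (f₀ : Forest) (noTree : ¬ Rooted f₀) where

    n : ℕ
    n = suc (size f₀)

    hub-size : ∀ {S A V a} → IsHub S A V → a ∈ A → ∀ g → n ≤ S * g → count V ≤ n + K * g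
    hub-size {S} {A} {V} {a} H a∈ g hS with count V ≤? n + K * g
    ... | yes p = p
    ... | no ¬p with hub-embeds H g f₀ a a∈ (linear (size f₀ ∷ K ∷ g ∷ count V ∷ [])
      (χ 0 ⊞ χ 1 ⊠ χ 2 ⩽ χ 3) (# 1 ⊞ # 1 ⊞ χ 0 ⊞ χ 1 ⊠ χ 2 ⩽ χ 3) (≰⇒> ¬p)) hS
    ...   | P , a∉ , e , _ = ⊥-elim (noTree (a , P , a∉ , e))

    -- `V` may be too small for the whole tree, but it has room for the large branch at the balanced
    -- vertex, since leaving out the small branches saves about `g₂` vertices. With a larger red
    -- degree of `a`, the small branches would fit into its red neighbourhood.
    hub-degree : ∀ {S A V a} → IsHub S A V → a ∈ A → ∀ g g₂ → n ≤ S * g → 1 ≤ g₂ → 2 * g₂ ≤ n →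
                 n + K * g ≤ count V + g₂ → count (full ∖ b a) ≤ n + S + K * g₂
    hub-degree {S} {A} {V} {a} H a∈ g g₂ hS h₁ h₂ hV with count (full ∖ b a) ≤? n + S + K * g₂
    ... | yes p = p
    ... | no ¬p with balance g₂ f₀ h₁ h₂
    ...   | balanced u s sm enough total reroot
      with hub-embeds H g (cons u nil) a a∈ (linear (size u ∷ K ∷ g ∷ count V ∷ size f₀ ∷ g₂ ∷ size s ∷ [])
        (# 1 ⊠ (# 1 ⊞ χ 0) ⊞ χ 1 ⊠ χ 2 ⩽ χ 3)
        ((# 1 ⊞ χ 4 ⊞ χ 1 ⊠ χ 2) ⊞ χ 5 ⊞ # 1 ⊞ χ 0 ⊞ χ 6 ⩽ (χ 3 ⊞ χ 5) ⊞ (# 1 ⊞ χ 6) ⊞ χ 4)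
        (hV ⊕ enough ⊕ eq≤ total)) (linear (size u ∷ S ∷ g ∷ size f₀ ∷ size s ∷ [])
          (# 1 ⊞ # 1 ⊠ (# 1 ⊞ χ 0) ⩽ χ 1 ⊠ χ 2) ((# 1 ⊞ χ 3) ⊞ # 1 ⊞ χ 0 ⊞ χ 4 ⩽ χ 1 ⊠ χ 2 ⊞ χ 3)
          (hS ⊕ eq≤ total))
    ...   | P , a∉ , e , cP = ⊥-elim (noTree (reroot (attach K noClique S g₂ a u s P sm a∉ e (linear (count P ∷ size u ∷ S ∷ [])
      (χ 0 ⩽ (# 1 ⊞ χ 1) ⊞ χ 2) (χ 0 ⩽ # 1 ⊞ (χ 1 ⊞ # 0) ⊞ χ 2) cP) (linear (size u ∷ size s ∷ S ∷ K ∷ g₂ ∷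
        count (full ∖ b a) ∷ size f₀ ∷ [])
        ((((χ 0 ⊞ χ 1) ⊞ # 2) ⊞ χ 2) ⊞ χ 3 ⊠ χ 4 ⩽ χ 5)
        ((# 1 ⊞ # 1 ⊞ (χ 6 ⊞ χ 2) ⊞ χ 3 ⊠ χ 4) ⊞ # 1 ⊞ χ 0 ⊞ χ 1 ⩽ χ 5 ⊞ χ 6)
        (≰⇒> ¬p ⊕ eq≤ total)))))

  opaque
    allRed : VSet N → VSet N
    allRed A = ⟪ (λ v → count (A ∩ b v)) ≼ (λ _ → 0) ⟫

    allRed⁺ : ∀ {A v} → count (A ∩ b v) ≤ 0 → v ∈ allRed A
    allRed⁺ h = ≼⁺ h

    allRed⁻ : ∀ {A v} → v ∈ allRed A → count (A ∩ b v) ≤ 0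
    allRed⁻ h = ≼⁻ h

  -- Each `a` in `A` costs `V` its blue neighbours and possibly itself, hence the `suc`.
  blue-loss : ∀ A V x → (∀ {a} → a ∈ A → suc (count (V ∩ b a)) ≤ x) →
              count V ≤ count ((V ∩ allRed A) ∖ A) + count A * x
  blue-loss A V x h = linear (count V ∷ count (V ∩ allRed A ∖ A) ∷ count A ∷ x ∷ count (V ∩ allRed A) ∷
      count (V ∖ allRed A) ∷ ∑∈ (V ∖ allRed A) (λ v → count (A ∩ b v)) ∷ ∑∈ V (λ x₁ → count (A ∩ b x₁)) ∷
      ∑∈ A (λ a → 1 + count (V ∩ b a)) ∷ ∑∈ A (λ z → 1) ∷ ∑∈ A (λ a → count (V ∩ b a)) ∷ [])
    (χ 0 ⩽ χ 1 ⊞ χ 2 ⊠ χ 3)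
    (χ 0 ⊞ χ 4 ⊞ χ 5 ⊠ # 1 ⊞ χ 6 ⊞ χ 7 ⊞ χ 8 ⊞ (χ 9 ⊞ χ 10) ⊞ χ 2 ⊠ # 1 ⩽ (χ 4 ⊞ χ 5) ⊞ (χ 1 ⊞ χ 2) ⊞ χ 6 ⊞
      χ 7 ⊞ χ 10 ⊞ χ 2 ⊠ χ 3 ⊞ χ 8 ⊞ χ 9)
    (eq≤ (count-split V (allRed A)) ⊕ count-∖ (V ∩ allRed A) A ⊕
    ∑∈-≥ (V ∖ allRed A) (λ v → count (A ∩ b v)) 1 (λ v∈ → ≮⇒≥ λ lt → ∖₂ v∈ (allRed⁺ (≤-pred lt))) ⊕
    ∑∈-⊆ (V ∖ allRed A) V (λ v → count (A ∩ b v)) ∖₁ ⊕ eq≤ (∑∈-swap V A b b-sym) ⊕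
    ∑∈-≤ A (λ a → 1 + count (V ∩ b a)) x h ⊕ eq≥ (∑∈-+ A (λ _ → 1) (λ a → count (V ∩ b a))) ⊕
      eq≥ (∑∈-const A 1))

  record Cleaned (S x : ℕ) (A V : VSet N) : Set where
    constructor cleaned
    field
      A′ V′ : VSet N
      A′⊆   : A′ ⊆ A
      V′⊆   : V′ ⊆ V
      hub   : IsHub S A′ V′
      loss  : count V ≤ count V′ + S * x

  -- By double counting, fewer than `t` vertices of `A` have `x` or more blue neighbours in `V`.
  -- Without them `A` is still large enough for Ramsey's theorem to yield a red clique of size `S`,
  -- as blue cliques of size `K` are excluded. Then the few vertices of `V` with a blue neighbour in
  -- that clique are discarded.
  clean : ∀ A V s x S t → (∀ {v} → v ∈ V → count (A ∩ b v) ≤ s) → count V * s < t * x →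
          t + 2 ^ (S + K) ≤ count A → Cleaned S x A V
  clean A V s x S t hs ht hA with ramsey S K (A ∖ Heavy V x)
      (linear (2 ^ (S + K) ∷ count (A ∖ Heavy V x) ∷ t ∷ count A ∷ count (A ∩ Heavy V x) ∷ [])
        (χ 0 ⩽ χ 1) ((χ 2 ⊞ χ 0) ⊞ χ 3 ⊞ χ 4 ⩽ χ 3 ⊞ (χ 4 ⊞ χ 1) ⊞ χ 2)
        (hA ⊕ eq≤ (count-split A (Heavy V x)) ⊕ <⇒≤ (*-cancelʳ-< x (count (A ∩ Heavy V x)) t bad)))
    where
    bad : count (A ∩ Heavy V x) * x < t * x
    bad = linear (count (A ∩ Heavy V x) ∷ x ∷ t ∷ count V ∷ s ∷ ∑∈ (A ∩ Heavy V x) (λ a → count (V ∩ b a)) ∷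
        ∑∈ A (λ x₁ → count (V ∩ b x₁)) ∷ ∑∈ V (λ v → count (A ∩ b v)) ∷ [])
      (# 1 ⊞ χ 0 ⊠ χ 1 ⩽ χ 2 ⊠ χ 1)
      ((# 1 ⊞ χ 3 ⊠ χ 4) ⊞ χ 0 ⊠ χ 1 ⊞ χ 5 ⊞ χ 6 ⊞ χ 7 ⩽ χ 2 ⊠ χ 1 ⊞ χ 5 ⊞ χ 6 ⊞ χ 7 ⊞ χ 3 ⊠ χ 4)
      (ht ⊕ ∑∈-≥ (A ∩ Heavy V x) (λ a → count (V ∩ b a)) x (λ p → heavy⁻ (∩₂ p)) ⊕
               ∑∈-⊆ (A ∩ Heavy V x) A (λ a → count (V ∩ b a)) ∩₁ ⊕ eq≤ (∑∈-swap A V b b-sym) ⊕ ∑∈-≤ V (λ v →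
                 count (A ∩ b v)) s hs)
  ... | inj₂ cl = ⊥-elim (noClique (Clique-mono (λ _ → ∈full) cl))
  ... | inj₁ (A₁ , A₁⊆ , cA₁ , red) with subset-of-size A₁ S cA₁
  ...   | A′ , A′⊆ , cA′ = cleaned A′ ((V ∩ allRed A′) ∖ A′)
    (λ p → ∖₁ (A₁⊆ (A′⊆ p))) (λ p → ∩₁ (∖₁ p))
    record { A∩V = λ p q → ∖₂ q p ; redA = λ p q → red (A′⊆ p) (A′⊆ q) ; cA = cA′
           ; redAV = λ p q r → 1≰0 (≤-trans (count-pos (∩⁺ p (bsym r))) (allRed⁻ (∩₂ (∖₁ q)))) }
    (linear (count V ∷ count (V ∩ allRed A′ ∖ A′) ∷ S ∷ x ∷ count A′ ∷ []) (χ 0 ⩽ χ 1 ⊞ χ 2 ⊠ χ 3)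
      (χ 0 ⊞ χ 4 ⊠ χ 3 ⩽ (χ 1 ⊞ χ 4 ⊠ χ 3) ⊞ χ 2 ⊠ χ 3) (blue-loss A′ V x (λ p → ≰⇒> λ h → ∖₂ (A₁⊆ (A′⊆ p))
        (heavy⁺ h)) ⊕ *-monoˡ-≤ x (≤-reflexive cA′)))

  record Refined {j} (s c : ℕ) (A : Fin j → VSet N) (D : VSet N) : Set where
    constructor refined
    field
      A′   : Fin j → VSet N
      D′   : VSet N
      A′⊆  : ∀ i → A′ i ⊆ A i
      cA′  : ∀ i → count (A′ i) ≡ s
      D′⊆  : D′ ⊆ D
      cD′  : c ≤ count D′
      blue : ∀ i {d x} → d ∈ D′ → x ∈ A′ i → x ∈ b d

  -- For each part, `trace` keeps at least a fraction `1 / 2 ^ l` of the candidates, all with the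
  -- same blue neighbours in that part; `s` of these neighbours form the new part.
  refine : ∀ j (A : Fin j → VSet N) l D s c → (∀ i → count (A i) ≤ l) →
           (∀ i {v} → v ∈ D → s ≤ count (A i ∩ b v)) → 1 ≤ c → c * (2 ^ l) ^ j ≤ count D → Refined s c A D
  refine zero A l D s c _ _ 1≤c h = refined (λ ()) D (λ ()) (λ ()) (λ p → p)
      (≤-trans (≤-reflexive (sym (*-identityʳ c))) h) λ ()
  refine (suc j) A l D s c hl hs 1≤c h with trace l (A zero) D (hl zero)
  ... | X , X⊆ , cX , const
    with refine j (λ i → A (suc i)) l X s c (λ i → hl (suc i)) (λ i p → hs (suc i) (X⊆ p)) 1≤c
           (cancel-2^ l (linear (c ∷ (2 ^ l) ^ j ∷ 2 ^ l ∷ count X ∷ count D ∷ [])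
             (χ 0 ⊠ χ 1 ⊠ χ 2 ⩽ χ 3 ⊠ χ 2) (χ 0 ⊠ (χ 2 ⊠ χ 1) ⊞ χ 4 ⩽ χ 4 ⊞ χ 3 ⊠ χ 2)
             (h ⊕ cX)))
  ... | refined A′ D′ A′⊆ cA′ D′⊆ cD′ bl with inhabited {A = D′} (≤-trans 1≤c cD′)
  ...   | d₀ , d₀∈ with subset-of-size (A zero ∩ b d₀) s (hs zero (X⊆ (D′⊆ d₀∈)))
  ...     | A₀ , A₀⊆ , cA₀ = refined (A₀ ◂ A′) D′
    (λ { zero p → ∩₁ (A₀⊆ p) ; (suc i) → A′⊆ i }) (λ { zero → cA₀ ; (suc i) → cA′ i })
    (λ p → X⊆ (D′⊆ p)) cD′ (λ { zero → blue₀ ; (suc i) → bl i })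
    where
    blue₀ : ∀ {d x} → d ∈ D′ → x ∈ A₀ → x ∈ b d
    blue₀ d∈ x∈ with const (∩₁ (A₀⊆ x∈))
    ... | inj₁ X⊆b = bsym (X⊆b (D′⊆ d∈))
    ... | inj₂ dis = ⊥-elim (dis (D′⊆ d₀∈) (bsym (∩₂ (A₀⊆ x∈))))

  record Classes {j} (s : ℕ) (A : Fin j → VSet N) (U : VSet N) : Set where
    constructor classes
    field
      V     : Fin j → VSet N
      D     : VSet N
      V⊆    : ∀ i → V i ⊆ U
      D⊆    : D ⊆ U
      low   : ∀ i {v} → v ∈ V i → count (A i ∩ b v) ≤ s
      high  : ∀ i {v} → v ∈ D → s ≤ count (A i ∩ b v)
      disj  : ∀ i i′ → i ≢ i′ → Disjoint (V i) (V i′)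
      cover : count U ≤ sum (λ i → count (V i)) + count D

  classify : ∀ j s (A : Fin j → VSet N) U → Classes s A U
  classify zero s A U = classes (λ ()) U (λ ()) (λ p → p) (λ ()) (λ ()) (λ ()) (m≤n+m _ (sum {0} _))
  classify (suc j) s A U with classify j s (λ i → A (suc i)) (U ∩ Heavy (A zero) s)
  ... | classes V D V⊆ D⊆ low high disj cover = classes
    (U ∖ Heavy (A zero) s ◂ V) D
    (λ { zero p → ∖₁ p ; (suc i) p → ∩₁ (V⊆ i p) }) (λ p → ∩₁ (D⊆ p))
    (λ { zero p → ≰⇒≥ (λ h → ∖₂ p (heavy⁺ h)) ; (suc i) → low i })
    (λ { zero p → heavy⁻ (∩₂ (D⊆ p)) ; (suc i) → high i })
    (λ { zero zero ne → ⊥-elim (ne refl) ; zero (suc i) _ p q → ∖₂ p (∩₂ (V⊆ i q))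
       ; (suc i) zero _ p q → ∖₂ q (∩₂ (V⊆ i p)) ; (suc i) (suc i′) ne → disj i i′ (λ e → ne (cong suc e)) })
    (subst (λ t → count U ≤ t + count D) (sym (sum-◂ (U ∖ Heavy (A zero) s) V))
      (linear (count U ∷ count (U ∖ Heavy (A zero) s) ∷ sum (λ i → count (V i)) ∷ count D ∷
        count (U ∩ Heavy (A zero) s) ∷ [])
        (χ 0 ⩽ (χ 1 ⊞ χ 2) ⊞ χ 3) (χ 0 ⊞ χ 4 ⩽ (χ 4 ⊞ χ 1) ⊞ χ 2 ⊞ χ 3)
        (eq≤ (count-split U (Heavy (A zero) s)) ⊕ cover)))

⋃ : ∀ {N n} → (Fin n → VSet N) → VSet N
⋃ {n = zero}  A = ∅
⋃ {n = suc n} A = A zero ∪ ⋃ (λ i → A (suc i))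

⋃⁺ : ∀ {N n} (A : Fin n → VSet N) i {x} → x ∈ A i → x ∈ ⋃ A
⋃⁺ A zero    p = ∪ˡ p
⋃⁺ A (suc i) p = ∪ʳ (⋃⁺ (λ j → A (suc j)) i p)

⋃⁻ : ∀ {N n} (A : Fin n → VSet N) {x} → x ∈ ⋃ A → ∃ λ i → x ∈ A i
⋃⁻ {n = zero}  A p = ⊥-elim (∉∅ p)
⋃⁻ {n = suc n} A p with ∪⁻ p
... | inj₁ q = zero , q
... | inj₂ q with ⋃⁻ (λ i → A (suc i)) q
...   | i , r = suc i , r

count-⋃ : ∀ {N n} (A : Fin n → VSet N) c → (∀ i → count (A i) ≤ c) → count (⋃ A) ≤ n * c
count-⋃ {n = zero}  A c h = ≤-reflexive count-∅
count-⋃ {n = suc n} A c h = ≤-trans (count-∪ (A zero) (⋃ (λ i → A (suc i)))) (+-mono-≤ (h zero)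
    (count-⋃ (λ i → A (suc i)) c (λ i → h (suc i))))

-- The interface between the two halves of the proof, with `w` a small fraction of `n`: the second
-- half never looks at the tree again, only at `n`, this structure and the Ramsey number for two
-- parts.
record Skeleton {N} (G : BlueGraph N) (q n w : ℕ) : Set where
  open BlueGraph G
  field
    V      : Fin q → VSet N
    disj   : ∀ i j → i ≢ j → Disjoint (V i) (V j)
    lower  : ∀ i → n ≤ count (V i) + w
    redsum : ∀ z → sum (λ j → count (V j ∖ b z)) ≤ n + w
    near   : ∀ i {v} → v ∈ V i → count (V i ∩ b v) ≤ w

-- This many candidates let `refine` turn `j` parts of size `L (suc m)` into parts of size `L m` and
-- one new part; `crowds` adds up the demand of all stages still to come.
crowd : (ℕ → ℕ) → ℕ → ℕ → ℕ
crowd L m j = L m * (2 ^ L (suc m)) ^ j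

crowds : (ℕ → ℕ) → ℕ → ℕ → ℕ
crowds L zero    j = crowd L zero j
crowds L (suc m) j = crowd L (suc m) j + crowds L m (suc j)

-- Extraction of one hub for each class

module Extraction {N} (G : BlueGraph N) (m₁ m₂ : ℕ) (ms : List ℕ) (q′ K : ℕ) (len : length ms ≡ q′)
  (ms≤K : All (_≤ K) (m₁ ∷ m₂ ∷ ms)) (noClique : ¬ Embedding.Clique G K full)
  (noMulti : ¬ Multipartite.Multi G (m₁ ∷ m₂ ∷ ms) full)
  (f₀ : Forest) (noTree : ¬ Embedding.Rooted G f₀) where

  open Embedding G
  open NoClique K noClique using (smallTree)
  open Reroot G
  open Counting G
  open Multipartite G
  open Hubs G K noClique

  n₀ : ℕ
  n₀ = suc (size f₀)

  record HubSystem (S E : ℕ) : Set where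
    field
      A V   : Fin (suc q′) → VSet N
      hub   : ∀ i → IsHub S (A i) (V i)
      blue  : ∀ i j → i ≢ j → ∀ {x y} → x ∈ A i → y ∈ A j → y ∈ b x
      disj  : ∀ i j → i ≢ j → Disjoint (V i) (V j)
      lower : ∀ i → n₀ ≤ count (V i) + E

  not-all-blue : ∀ (A : Fin (2 + q′) → VSet N) → (∀ i → K ≤ count (A i)) →
                 (∀ i j → i ≢ j → ∀ {x y} → x ∈ A i → y ∈ A j → y ∈ b x) → ⊥
  not-all-blue A cA blue = noMulti (select K 0 (m₁ ∷ m₂ ∷ ms) (tabulate A) full
    (≤-reflexive (trans (cong (2 +_) len) (sym (length-tabulate A)))) ms≤K
    (AllPairsₚ.tabulate⁺ λ {i} {j} ne x x∈ → ≤-reflexive (count-empty λ p → ∖₂ p (blue i j ne x∈ (∖₁ p))))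
    (Allₚ.tabulate⁺ λ i → ≤-trans (≤-reflexive (cong (_+ K) (*-zeroʳ (total (m₁ ∷ m₂ ∷ ms)))))
      (≤-trans (cA i) (count-mono λ p → ∩⁺ ∈full p))))

  module Build (S B x u E : ℕ) (L : ℕ → ℕ) (1≤x : 1 ≤ x) (Sx≤u : S * x ≤ u) (n≤Su : n₀ ≤ S * u) (1≤S : 1 ≤ S)
    (N≤ : N ≤ B * x) (N≥ : suc (suc q′ * size f₀) ≤ N) (L₀ : L zero ≡ K) (1≤L : ∀ m → 1 ≤ L m)
    (Lₛ : ∀ m → suc (L m * B) + 2 ^ (S + K) ≤ L (suc m))
    (hE : suc q′ * (suc K * u) + 2 * u ≤ E) (E<n : E < n₀) where

    cleanᵢ : ∀ m A V → (∀ {v} → v ∈ V → count (A ∩ b v) ≤ L m) → count A ≡ L (suc m) →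
             Cleaned S x A V
    cleanᵢ m A V low cA = clean A V (L m) x S (suc (L m * B)) low
      (linear (count V ∷ L m ∷ B ∷ x ∷ []) (# 1 ⊞ χ 0 ⊠ χ 1 ⩽ (# 1 ⊞ χ 1 ⊠ χ 2) ⊠ χ 3)
        (χ 1 ⊠ χ 0 ⊞ # 1 ⩽ χ 1 ⊠ (χ 2 ⊠ χ 3) ⊞ χ 3) (L m ⊛ ≤-trans (count-mono {A = V} {full} (λ _ → ∈full))
            (≤-trans (≤-reflexive count-full) N≤) ⊕ 1≤x))
      (≤-trans (Lₛ m) (≤-reflexive (sym cA)))

    hub-V≤ : ∀ {A V} → IsHub S A V → count V ≤ n₀ + K * u
    hub-V≤ {A} {V} H with inhabited {A = A} (≤-trans 1≤S (≤-reflexive (sym (IsHub.cA H))))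
    ... | a , a∈ = hub-size f₀ noTree H a∈ u n≤Su

    class≤ : ∀ {A V} → Cleaned S x A V → count V ≤ n₀ + suc K * u
    class≤ {A} {V} (cleaned A′ V′ _ _ H loss) = linear (count V ∷ size f₀ ∷ K ∷ u ∷ count V′ ∷ S ∷ x ∷ [])
      (χ 0 ⩽ (# 1 ⊞ χ 1) ⊞ (# 1 ⊞ χ 2) ⊠ χ 3)
      (χ 0 ⊞ χ 4 ⊞ χ 5 ⊠ χ 6 ⩽ (χ 4 ⊞ χ 5 ⊠ χ 6) ⊞ ((# 1 ⊞ χ 1) ⊞ χ 2 ⊠ χ 3) ⊞ χ 3)
      (loss ⊕ hub-V≤ H ⊕ Sx≤u)

    -- `j` parts are present and `m` more are wanted. If many vertices have blue neighbours in all
    -- parts, a further part arises; for `m = 0` this completes the forbidden graph. Otherwise the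
    -- classes cover nearly everything and none has much more than `n` vertices, so fewer than `q`
    -- classes do not suffice, and with exactly `q` none can be much smaller than `n`.
    build : ∀ m j → m + j ≡ suc q′ → (A : Fin j → VSet N) → (∀ i → count (A i) ≡ L (suc m)) →
            (∀ i i′ → i ≢ i′ → ∀ {x y} → x ∈ A i → y ∈ A i′ → y ∈ b x) → crowds L m j + suc q′ ≤ u →
              HubSystem S E
    build m j e A cA blue hu with classify j (L m) A full
    ... | classes V D V⊆ D⊆ low high disj cover with crowd L m j ≤? count D
    build m j e A cA blue hu | classes V D V⊆ D⊆ low high disj cover | yes p
      with refine j A (L (suc m)) D (L m) (L m) (λ i → ≤-reflexive (cA i)) high (1≤L m) p
    ... | refined A′ D′ A′⊆ cA′ D′⊆ cD′ bl with subset-of-size D′ (L m) cD′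
    ...   | D″ , D″⊆ , cD″ = next m e hu
      where
      A″ : Fin (suc j) → VSet N
      A″ = D″ ◂ A′
      cA″ : ∀ i → count (A″ i) ≡ L m
      cA″ zero    = cD″
      cA″ (suc i) = cA′ i
      blue″ : ∀ i i′ → i ≢ i′ → ∀ {x y} → x ∈ A″ i → y ∈ A″ i′ → y ∈ b x
      blue″ zero    zero     ne = ⊥-elim (ne refl)
      blue″ zero    (suc i′) ne p r = bl i′ (D″⊆ p) r
      blue″ (suc i) zero     ne p r = bsym (bl i (D″⊆ r) p)
      blue″ (suc i) (suc i′) ne p r = blue i i′ (λ e → ne (cong suc e)) (A′⊆ i p) (A′⊆ i′ r)
      next : ∀ m′ → m′ + j ≡ suc q′ → crowds L m′ j + suc q′ ≤ u → {{m′ ≡ m}} → HubSystem S E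
      next zero refl _ {{refl}} = ⊥-elim (not-all-blue A″ (λ i → ≤-reflexive (sym (trans (cA″ i) L₀))) blue″)
      next (suc m′) e h {{refl}} = build m′ (suc j)
          (trans (+-suc m′ j) e) A″ cA″ blue″ (≤-trans (+-monoˡ-≤ (suc q′) (m≤n+m (crowds L m′ (suc j)) _)) h)
    build m j e A cA blue hu | classes V D V⊆ D⊆ low high disj cover | no ¬p = finish m e hu (≰⇒≥ ¬p) cl
      where
      cl : ∀ i → Cleaned S x (A i) (V i)
      cl i = cleanᵢ m (A i) (V i) (low i) (cA i)
      V≤ : ∀ i → count (V i) ≤ n₀ + suc K * u
      V≤ i = class≤ (cl i)
      N≤sum : N ≤ sum (λ i → count (V i)) + count D
      N≤sum = ≤-trans (≤-reflexive (sym count-full)) cover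
      finish : ∀ m′ → m′ + j ≡ suc q′ → crowds L m′ j + suc q′ ≤ u → count D ≤ crowd L m′ j → (∀ i →
          Cleaned S x (A i) (V i)) → HubSystem S E
      finish zero refl h hD cl = record
        { A = λ i → Cleaned.A′ (cl i) ; V = λ i → Cleaned.V′ (cl i) ; hub = λ i → Cleaned.hub (cl i)
        ; blue = λ i i′ ne p r → blue i i′ ne (Cleaned.A′⊆ (cl i) p) (Cleaned.A′⊆ (cl i′) r)
        ; disj = λ i i′ ne p r → disj i i′ ne (Cleaned.V′⊆ (cl i) p) (Cleaned.V′⊆ (cl i′) r)
        ; lower = λ i → lower i (cl i) }
        where
        lower : ∀ i → (c : Cleaned S x (A i) (V i)) → n₀ ≤ count (Cleaned.V′ c) + E
        lower i (cleaned A′ V′ _ _ H loss) = linear (size f₀ ∷ count V′ ∷ E ∷ q′ ∷ N ∷ sum (λ i →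
            count (V i)) ∷ K ∷ u ∷ count (V i) ∷ S ∷ x ∷ count D ∷ L zero ∷ 2 ^ L 1 ∷ (2 ^ L 1) ^ q′ ∷ [])
          (# 1 ⊞ χ 0 ⩽ χ 1 ⊞ χ 2)
          ((# 1 ⊞ χ 0 ⊞ χ 3 ⊠ χ 0) ⊞ χ 4 ⊞ (χ 5 ⊞ (# 1 ⊞ χ 0) ⊞ (# 1 ⊞ χ 6) ⊠ χ 7) ⊞ χ 8 ⊞ χ 9 ⊠ χ 10 ⊞
            (((χ 7 ⊞ χ 6 ⊠ χ 7) ⊞ χ 3 ⊠ (χ 7 ⊞ χ 6 ⊠ χ 7)) ⊞ # 2 ⊠ χ 7) ⊞ χ 11 ⊞ χ 12 ⊠ (χ 13 ⊠ χ 14) ⊞ # 1 ⊞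
            χ 3 ⩽ χ 4 ⊞ (χ 5 ⊞ χ 11) ⊞ (χ 8 ⊞ (# 1 ⊞ χ 3) ⊠ ((# 1 ⊞ χ 0) ⊞ (# 1 ⊞ χ 6) ⊠ χ 7)) ⊞ (χ 1 ⊞
            χ 9 ⊠ χ 10) ⊞ χ 7 ⊞ χ 2 ⊞ χ 12 ⊠ (χ 13 ⊠ χ 14) ⊞ χ 7)
          (N≥ ⊕ N≤sum ⊕ sum-but-one (λ i → count (V i)) (n₀ + suc K * u) V≤ i ⊕
          loss ⊕ Sx≤u ⊕ hE ⊕ hD ⊕ h)
      finish (suc m′) e h hD _ = ⊥-elim (1≰0 (linear (size f₀ ∷ q′ ∷ N ∷ sum (λ z → count (V z)) ∷ sum (λ z →
          suc (size f₀) + suc K * u) ∷ E ∷ u ∷ K ∷ count D ∷ L (suc m′) ∷ (2 ^ L (suc (suc m′))) ^ j ∷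
          crowds L m′ (suc j) ∷ m′ ∷ j ∷ [])
        (# 1 ⩽ # 0)
        ((# 1 ⊞ χ 0 ⊞ χ 1 ⊠ χ 0) ⊞ χ 2 ⊞ χ 3 ⊞ χ 4 ⊞ (# 1 ⊞ χ 5) ⊞ (((χ 6 ⊞ χ 7 ⊠ χ 6) ⊞ χ 1 ⊠ (χ 6 ⊞
          χ 7 ⊠ χ 6)) ⊞ # 2 ⊠ χ 6) ⊞ χ 8 ⊞ ((χ 9 ⊠ χ 10 ⊞ χ 11) ⊞ # 1 ⊞ χ 1) ⊞ χ 0 ⊠ ((# 1 ⊞ χ 12) ⊞ χ 13) ⊞
          (# 1 ⊞ χ 7) ⊠ χ 6 ⊠ ((# 1 ⊞ χ 12) ⊞ χ 13) ⊞ (# 1 ⊞ χ 12) ⊞ χ 13 ⩽ χ 2 ⊞ (χ 3 ⊞ χ 8) ⊞ χ 4 ⊞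
          χ 13 ⊠ ((# 1 ⊞ χ 0) ⊞ (# 1 ⊞ χ 7) ⊠ χ 6) ⊞ (# 1 ⊞ χ 0) ⊞ χ 5 ⊞ χ 9 ⊠ χ 10 ⊞ χ 6 ⊞ χ 0 ⊠ (# 1 ⊞
          χ 1) ⊞ (# 1 ⊞ χ 7) ⊠ χ 6 ⊠ (# 1 ⊞ χ 1) ⊞ # 1 ⊞ χ 1)
        (N≥ ⊕ N≤sum ⊕ sum-mono V≤ ⊕ eq≤ (sum-const j (n₀ + suc K * u)) ⊕
          E<n ⊕ hE ⊕ hD ⊕ h ⊕ size f₀ ⊛ eq≤ e ⊕ (suc K * u) ⊛ eq≤ e ⊕ eq≤ e)))

-- Trimming the hub sets to nearly red cliques

module Trimming {N} (G : BlueGraph N) (m₁ m₂ : ℕ) (ms : List ℕ) (q′ K : ℕ) (len : length ms ≡ q′)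
  (ms≤K : All (_≤ K) (m₁ ∷ m₂ ∷ ms)) (noClique : ¬ Embedding.Clique G K full)
  (noMulti : ¬ Multipartite.Multi G (m₁ ∷ m₂ ∷ ms) full)
  (f₀ : Forest) (noTree : ¬ Embedding.Rooted G f₀)
  (S E u g Δ c E′ g′ w B x : ℕ)
  (H : Extraction.HubSystem G m₁ m₂ ms q′ K len ms≤K noClique noMulti f₀ noTree S E)
  (1≤K : 1 ≤ K) (K≤S : K ≤ S) (n≤Su : suc (size f₀) ≤ S * u) (1≤g : 1 ≤ g) (2g≤n : 2 * g ≤ suc (size f₀))
      (hg : E + K * u ≤ g)
  (hΔ : E + S + K * g ≤ Δ) (N≤ : N ≤ B * x) (hc : K * (B * x) + c * (K * 2 ^ c) < c * u) (hE′ : E +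
      q′ * K * Δ + c ≤ E′)
  (hg′ : 2 + E′ + u ≤ g′) (2g′≤n : 2 * g′ ≤ suc (size f₀)) (hw : K * g′ ≤ w) (u≤w : u ≤ w) (E′≤w : E′ ≤ w)
      (q≤n : suc q′ ≤ suc (size f₀)) where

  open Embedding G
  open Reroot G
  open Counting G
  open Multipartite G
  open Hubs G K noClique hiding (n)
  open Extraction.HubSystem H

  n : ℕ
  n = suc (size f₀)

  -- `a` is red to all of `V i`, which uses up nearly all of its red degree.
  hub-low-red : ∀ i j → i ≢ j → ∀ {a} → a ∈ A i → count (V j ∖ b a) ≤ Δ
  hub-low-red i j ne {a} a∈ = linear (count (V j ∖ b a) ∷ Δ ∷ count (full ∖ b a) ∷ count (V i ∪ (V j ∖ b a)) ∷
      count (V i) ∷ size f₀ ∷ E ∷ S ∷ K ∷ g ∷ [])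
    (χ 0 ⩽ χ 1)
    (χ 2 ⊞ χ 3 ⊞ (χ 4 ⊞ χ 0) ⊞ (# 1 ⊞ χ 5) ⊞ (χ 6 ⊞ χ 7) ⊞ χ 8 ⊠ χ 9 ⩽ (((# 1 ⊞ χ 5) ⊞ χ 7) ⊞ χ 8 ⊠ χ 9) ⊞
      χ 2 ⊞ χ 3 ⊞ (χ 4 ⊞ χ 6) ⊞ χ 1)
    (hub-degree f₀ noTree (hub i) a∈ u g n≤Su 1≤g 2g≤n (linear (size f₀ ∷ K ∷ u ∷ count (V i) ∷ g ∷ E ∷ [])
      ((# 1 ⊞ χ 0) ⊞ χ 1 ⊠ χ 2 ⩽ χ 3 ⊞ χ 4) ((# 1 ⊞ χ 0) ⊞ χ 5 ⊞ χ 1 ⊠ χ 2 ⩽ (χ 3 ⊞ χ 5) ⊞ χ 4)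
      (lower i ⊕ hg)) ⊕
    count-mono sub ⊕ count-⊎ (V i) (V j ∖ b a) (λ p q → disj i j ne p (∖₁ q)) ⊕ lower i ⊕ hΔ)
    where
    sub : V i ∪ (V j ∖ b a) ⊆ full ∖ b a
    sub p = [ (λ q → ∖⁺ ∈full (IsHub.redAV (hub i) a∈ q)) , (λ q → ∖⁺ ∈full (∖₂ q)) ]′ (∪⁻ p)

  core : ∀ i → ∃ λ C → C ⊆ A i × count C ≡ K
  core i = subset-of-size (A i) K (≤-trans K≤S (≤-reflexive (sym (IsHub.cA (hub i)))))

  C : Fin (suc q′) → VSet N
  C i = proj₁ (core i)

  C⊆ : ∀ i → C i ⊆ A i
  C⊆ i = proj₁ (proj₂ (core i))

  cC : ∀ i → count (C i) ≡ K
  cC i = proj₂ (proj₂ (core i))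

  opaque
    -- The cores of all hubs except the `i`-th: together they host the last `k - 2` parts of the
    -- forbidden graph for any blue `K_{m₁,m₂}` that is completely blue to them.
    O : Fin (suc q′) → VSet N
    O i = ⋃ (λ j → C (punchIn i j))

    O⁺ : ∀ i j {y} → y ∈ C (punchIn i j) → y ∈ O i
    O⁺ i j = ⋃⁺ (λ j → C (punchIn i j)) j

    cO : ∀ i → count (O i) ≤ q′ * K
    cO i = count-⋃ (λ j → C (punchIn i j)) K (λ j → ≤-reflexive (cC _))

    O-low-red : ∀ i {a} → a ∈ O i → count (V i ∖ b a) ≤ Δ
    O-low-red i p with ⋃⁻ (λ j → C (punchIn i j)) p
    ... | j , q = hub-low-red (punchIn i j) i (punchInᵢ≢i i j) (C⊆ _ q)

  opaque
    W : Fin (suc q′) → VSet N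
    W i = V i ∩ common (O i)

    W⊆V : ∀ i → W i ⊆ V i
    W⊆V i = ∩₁

    W-blue : ∀ i {a v} → a ∈ O i → v ∈ W i → v ∈ b a
    W-blue i a∈ v∈ = common⁻ a∈ (∩₂ v∈)

    cW : ∀ i → count (V i) ≤ count (W i) + q′ * K * Δ
    cW i = linear (count (V i) ∷ count (W i) ∷ q′ ∷ K ∷ Δ ∷ count (O i) ∷ count (V i ∩ common (O i)) ∷ [])
      (χ 0 ⩽ χ 1 ⊞ χ 2 ⊠ χ 3 ⊠ χ 4) (χ 0 ⊞ χ 5 ⊠ χ 4 ⊞ χ 6 ⩽ (χ 6 ⊞ χ 5 ⊠ χ 4) ⊞ χ 2 ⊠ χ 3 ⊠ χ 4 ⊞ χ 1)
      (common-loss (O i) (V i) Δ (O-low-red i) ⊕ *-monoˡ-≤ Δ (cO i) ⊕ unfold)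
      where
      unfold : count (V i ∩ common (O i)) ≤ count (W i)
      unfold = ≤-refl

  -- From `c` vertices with `u` blue neighbours in `W i`, `kst` would produce a blue complete
  -- bipartite graph inside `W i`, and `O i` would supply the remaining parts.
  sparse : ∀ i → count (W i ∩ Heavy (W i) u) ≤ c
  sparse i with c ≤? count (W i ∩ Heavy (W i) u)
  ... | no ¬p = ≰⇒≥ ¬p
  ... | yes p with subset-of-size (W i ∩ Heavy (W i) u) c p
  ...   | D , D⊆ , cD with kst D (W i) c K K 1≤K (≤-reflexive cD)
            (≤-trans {j = c * u} (linear (K ∷ count (W i) ∷ c ∷ 2 ^ c ∷ u ∷ B ∷ x ∷ [])
              (# 1 ⊞ χ 0 ⊠ χ 1 ⊞ χ 2 ⊠ (χ 0 ⊠ χ 3) ⩽ χ 2 ⊠ χ 4)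
              ((# 1 ⊞ χ 0 ⊠ (χ 5 ⊠ χ 6) ⊞ χ 2 ⊠ (χ 0 ⊠ χ 3)) ⊞ χ 0 ⊠ χ 1 ⩽ χ 2 ⊠ χ 4 ⊞ χ 0 ⊠ (χ 5 ⊠ χ 6))
              (hc ⊕ K ⊛ ≤-trans (count-mono {A = W i} {full} (λ _ → ∈full))
                  (≤-trans (≤-reflexive count-full) N≤)))
              (≤-trans (≤-reflexive (cong (_* u) (sym cD)))
                (∑∈-≥ D (λ d → count (W i ∩ b d)) u (λ d∈ → heavy⁻ (∩₂ (D⊆ d∈))))))
  ...     | biclique D′ X D′⊆ cD′ X⊆ cX bl = ⊥-elim (noMulti
    (step D′ (X ∪ O i) (λ _ → ∈full) (≤-trans (All.head ms≤K) (≤-reflexive (sym cD′))) (λ _ → ∈full)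
      (λ d∈ y∈ → [ bl d∈ , (λ o → bsym (W-blue i o (∩₁ (D⊆ (D′⊆ d∈))))) ]′ (∪⁻ y∈))
    (step X (O i) ∪ˡ (≤-trans (All.head (All.tail ms≤K)) cX) ∪ʳ (λ x∈ o → bsym (W-blue i o (X⊆ x∈)))
    (select K 0 ms (tabulate (λ j → C (punchIn i j))) (O i)
      (≤-reflexive (trans len (sym (length-tabulate (λ j → C (punchIn i j)))))) (All.tail (All.tail ms≤K))
      (AllPairsₚ.tabulate⁺ λ {j} {j′} ne y y∈ → ≤-reflexive (count-empty λ p → ∖₂ p
        (blue (punchIn i j) (punchIn i j′) (λ e → ne (punchIn-injective i j j′ e)) (C⊆ _ y∈) (C⊆ _ (∖₁ p)))))
      (Allₚ.tabulate⁺ λ j → ≤-trans (≤-reflexive (cong (_+ K) (*-zeroʳ (total ms))))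
        (≤-trans (≤-reflexive (sym (cC (punchIn i j)))) (count-mono (λ p → ∩⁺ (O⁺ i j p) p))))))))

  opaque
    Y : Fin (suc q′) → VSet N
    Y i = W i ∖ Heavy (W i) u

    Y⊆V : ∀ i → Y i ⊆ V i
    Y⊆V i p = W⊆V i (∖₁ p)

    Y-near : ∀ i {v} → v ∈ Y i → count (Y i ∩ b v) ≤ u
    Y-near i v∈ = ≤-trans (count-mono (∩-monoˡ ∖₁)) (≰⇒≥ λ h → ∖₂ v∈ (heavy⁺ h))

    cY : ∀ i → n ≤ count (Y i) + E′
    cY i = linear (size f₀ ∷ count (Y i) ∷ E′ ∷ count (V i) ∷ count (W i) ∷ count (W i ∩ Heavy (W i) u) ∷ E ∷
        q′ ∷ K ∷ Δ ∷ c ∷ count (W i ∖ Heavy (W i) u) ∷ [])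
      (# 1 ⊞ χ 0 ⩽ χ 1 ⊞ χ 2)
      ((# 1 ⊞ χ 0) ⊞ χ 3 ⊞ χ 4 ⊞ χ 5 ⊞ ((χ 6 ⊞ χ 7 ⊠ χ 8 ⊠ χ 9) ⊞ χ 10) ⊞ χ 11 ⩽ (χ 3 ⊞ χ 6) ⊞ (χ 4 ⊞
        χ 7 ⊠ χ 8 ⊠ χ 9) ⊞ (χ 5 ⊞ χ 11) ⊞ χ 10 ⊞ χ 2 ⊞ χ 1)
      (lower i ⊕ cW i ⊕ eq≤ (count-split (W i) (Heavy (W i) u)) ⊕ sparse i ⊕ hE′ ⊕ unfold)
      where
      unfold : count (W i ∖ Heavy (W i) u) ≤ count (Y i)
      unfold = ≤-refl

  -- The argument of `hub-degree` for an arbitrary host `z`: a single red neighbour `y` in some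
  -- class lets the large branch enter `Y i`, where blue degrees of at most `u` permit a greedy
  -- embedding.
  red-degree : ∀ i z y → y ∈ Y i → y ∉ b z → y ≢ z → count (full ∖ b z) ≤ n + K * g′
  red-degree i z y y∈ red y≢z with count (full ∖ b z) ≤? n + K * g′
  ... | yes p = p
  ... | no ¬p with balance g′ f₀ (≤-trans (s≤s z≤n) hg′) 2g′≤n
  ...   | balanced up s sm enough total reroot
    with greedy up y (Y i ∖ ⁅ y ⁆ ∖ ⁅ z ⁆) u (near∖ y∈) (λ p → near∖ (∖₁ (∖₁ p)))
           (linear (size up ∷ u ∷ count (Y i ∖ ⁅ y ⁆ ∖ ⁅ z ⁆) ∷ size f₀ ∷ E′ ∷ g′ ∷ size s ∷ count (Y i) ∷
             count (Y i ∖ ⁅ y ⁆) ∷ [])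
             (χ 0 ⊞ χ 1 ⩽ χ 2)
             ((# 1 ⊞ χ 3) ⊞ (# 1 ⊞ # 1 ⊞ χ 4 ⊞ χ 1) ⊞ χ 5 ⊞ (# 1 ⊞ χ 0 ⊞ χ 6) ⊞ χ 7 ⊞ χ 8 ⩽ (χ 7 ⊞ χ 4) ⊞
               χ 5 ⊞ (# 1 ⊞ χ 6) ⊞ χ 3 ⊞ (# 1 ⊞ χ 8) ⊞ # 1 ⊞ χ 2)
             (cY i ⊕ hg′ ⊕ enough ⊕ eq≤ total ⊕ count-delete {A = Y i} y ⊕ count-delete {A = Y i ∖ ⁅ y ⁆} z))
    where
    near∖ : ∀ {v} → v ∈ Y i → count ((Y i ∖ ⁅ y ⁆ ∖ ⁅ z ⁆) ∩ b v) ≤ u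
    near∖ v∈ = ≤-trans (count-mono (∩-monoˡ (λ p → ∖₁ (∖₁ p)))) (Y-near i v∈)
  ...   | P , P⊆ , cP , eP = ⊥-elim (noTree (reroot (attach K noClique 0 g′ z up s (⁅ y ⁆ ∪ P ∪ ∅) sm z∉
      (join red (λ p → ∖₂ (∖₁ (P⊆ p)) (∈⁅⁆ refl)) ∉∅ (λ _ → ∉∅) eP nil)
      (linear (count (⁅ y ⁆ ∪ P ∪ ∅) ∷ size up ∷ count P ∷ count ∅ ∷ []) (χ 0 ⩽ (# 1 ⊞ χ 1) ⊞ # 0)
        (χ 0 ⊞ χ 2 ⊞ χ 3 ⩽ (# 1 ⊞ χ 2 ⊞ χ 3) ⊞ χ 1 ⊞ # 0) (join-count y P ∅ ⊕ cP ⊕ eq≤ (count-∅ {N})))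
      (linear (size up ∷ size s ∷ K ∷ g′ ∷ count (full ∖ b z) ∷ size f₀ ∷ [])
        ((((χ 0 ⊞ χ 1) ⊞ # 2) ⊞ # 0) ⊞ χ 2 ⊠ χ 3 ⩽ χ 4)
        ((# 1 ⊞ # 1 ⊞ χ 5 ⊞ χ 2 ⊠ χ 3) ⊞ # 1 ⊞ χ 0 ⊞ χ 1 ⩽ χ 4 ⊞ χ 5) (≰⇒> ¬p ⊕ eq≤ total)))))
    where
    z∉ : z ∉ ⁅ y ⁆ ∪ P ∪ ∅
    z∉ p with ∪⁻ p
    ... | inj₁ q = y≢z (⁅⁆⁻ q)
    ... | inj₂ q = [ (λ r → ∖₂ (P⊆ r) (∈⁅⁆ refl)) , ∉∅ ]′ (∪⁻ q)

  sum-disjoint : ∀ {k} (X : Fin k → VSet N) Z → (∀ i → X i ⊆ Z) → (∀ i j → i ≢ j → Disjoint (X i) (X j)) →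
                 sum (λ i → count (X i)) ≤ count Z
  sum-disjoint {zero}  X Z sub dis = ≤-trans (≤-reflexive (sum-zero _)) z≤n
  sum-disjoint {suc k} X Z sub dis = ≤-trans (≤-reflexive (sum-suc _))
    (linear (count (X zero) ∷ sum (λ i → count (X (suc i))) ∷ count Z ∷ count (Z ∩ X zero) ∷
      count (Z ∖ X zero) ∷ [])
      (χ 0 ⊞ χ 1 ⩽ χ 2) (χ 1 ⊞ (χ 3 ⊞ χ 4) ⊞ χ 0 ⩽ χ 4 ⊞ χ 2 ⊞ χ 3) (sum-disjoint (λ i → X (suc i)) (Z ∖ X zero)
            (λ i p → ∖⁺ (sub (suc i) p) (λ q → dis zero (suc i) (λ ()) q p))
            (λ i j ne → dis (suc i) (suc j) (λ e → ne (suc-injective e))) ⊕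
          eq≥ (count-split Z (X zero)) ⊕ count-mono {A = X zero} {Z ∩ X zero} (λ p → ∩⁺ (sub zero p) p)))

  skeleton : Skeleton G (suc q′) n w
  skeleton = record { V = Y ; disj = λ i j ne p q → disj i j ne (Y⊆V i p) (Y⊆V j q)
                    ; lower = λ i → ≤-trans (cY i) (+-monoʳ-≤ (count (Y i)) E′≤w)
                    ; redsum = redsum ; near = λ i v∈ → ≤-trans (Y-near i v∈) u≤w }
    where
    redsum : ∀ z → sum (λ j → count (Y j ∖ b z)) ≤ n + w
    redsum z with sum (λ j → count (Y j ∖ b z)) ≤? n + w
    ... | yes p = p
    -- Two red neighbours in one class are asked for because `z` may count as its own red neighbour.
    ... | no ¬p with sum-pigeon (λ _ → 1) (λ j → count (Y j ∖ b z)) (linear (sum (λ z₁ → 1) ∷ sum (λ j →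
        count (Y j ∖ b z)) ∷ size f₀ ∷ w ∷ q′ ∷ [])
      (# 1 ⊞ χ 0 ⩽ χ 1) ((# 1 ⊞ # 1 ⊞ χ 2 ⊞ χ 3) ⊞ χ 0 ⊞ # 1 ⊞ χ 4 ⩽ χ 1 ⊞ (# 1 ⊞ χ 4) ⊠ # 1 ⊞ # 1 ⊞ χ 2)
      (≰⇒> ¬p ⊕ eq≤ (sum-const (suc q′) 1) ⊕ q≤n))
    ...   | i , 2≤ with inhabited {A = Y i ∖ b z ∖ ⁅ z ⁆} (linear (count (Y i ∖ b z ∖ ⁅ z ⁆) ∷
        count (Y i ∖ b z) ∷ [])
      (# 1 ⩽ χ 0) (# 2 ⊞ χ 1 ⩽ χ 1 ⊞ # 1 ⊞ χ 0) (2≤ ⊕ count-delete {A = Y i ∖ b z} z))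
    ...     | y , y∈ = ≤-trans (sum-disjoint (λ j → Y j ∖ b z) (full ∖ b z) (λ j p → ∖⁺ ∈full (∖₂ p))
                         (λ j j′ ne p p′ → disj j j′ ne (Y⊆V j (∖₁ p)) (Y⊆V j′ (∖₁ p′))))
                       (linear (count (full ∖ b z) ∷ size f₀ ∷ w ∷ K ∷ g′ ∷ []) (χ 0 ⩽ # 1 ⊞ χ 1 ⊞ χ 2)
                         (χ 0 ⊞ χ 3 ⊠ χ 4 ⩽ ((# 1 ⊞ χ 1) ⊞ χ 3 ⊠ χ 4) ⊞ χ 2)
                         (red-degree i z y (∖₁ (∖₁ y∈)) (∖₂ (∖₁ y∈)) (λ e → ∖₂ y∈ (∈⁅⁆ (sym e))) ⊕ hw))

two-terms : ∀ {k} (f : Fin k → ℕ) i j → i ≢ j → f i + f j ≤ sum f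
two-terms {suc k} f zero    zero    ne = ⊥-elim (ne refl)
two-terms {suc k} f zero    (suc j) ne = linear (f zero ∷ f (suc j) ∷ sum f ∷ sum (λ i → f (suc i)) ∷ [])
  (χ 0 ⊞ χ 1 ⩽ χ 2) ((χ 0 ⊞ χ 3) ⊞ χ 1 ⩽ χ 2 ⊞ χ 3) (eq≥ (sum-suc f) ⊕ term≤sum (λ i → f (suc i)) j)
two-terms {suc k} f (suc i) zero    ne = linear (f (suc i) ∷ f zero ∷ sum f ∷ sum (λ i → f (suc i)) ∷ [])
  (χ 0 ⊞ χ 1 ⩽ χ 2) ((χ 1 ⊞ χ 3) ⊞ χ 0 ⩽ χ 2 ⊞ χ 3) (eq≥ (sum-suc f) ⊕ term≤sum (λ i → f (suc i)) i)
two-terms {suc k} f (suc i) (suc j) ne = linear (f (suc i) ∷ f (suc j) ∷ sum f ∷ f zero ∷ sum (λ i →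
    f (suc i)) ∷ [])
  (χ 0 ⊞ χ 1 ⩽ χ 2) ((χ 3 ⊞ χ 4) ⊞ χ 0 ⊞ χ 1 ⩽ χ 2 ⊞ χ 4) (eq≥ (sum-suc f) ⊕ two-terms (λ i →
    f (suc i)) i j (λ e → ne (cong suc e)))

count-⋃-sum : ∀ {N k} (A : Fin k → VSet N) → count (⋃ A) ≤ sum (λ i → count (A i))
count-⋃-sum {k = zero}  A = ≤-trans (≤-reflexive count-∅) z≤n
count-⋃-sum {k = suc k} A = ≤-trans (count-∪ (A zero) (⋃ (λ i → A (suc i))))
  (≤-trans (+-monoʳ-≤ (count (A zero)) (count-⋃-sum (λ i → A (suc i)))) (≤-reflexive (sym (sum-suc (λ i →
    count (A i))))))

opaque
  -- The number of vertices from which `kst` retains `eSize R j s`, when each has more than `n / R`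
  -- blue neighbours in a set of at most `2 * n` vertices. One half of the factor `4` pays for each
  -- of the two terms in the hypothesis of `kst`.
  eSize : ℕ → ℕ → ℕ → ℕ
  eSize R zero    s = s
  eSize R (suc j) s = 4 * eSize R j s * R

  eSize-zero : ∀ R s → eSize R zero s ≡ s
  eSize-zero R s = refl

  eSize-suc : ∀ R j s → eSize R (suc j) s ≡ 4 * eSize R j s * R
  eSize-suc R j s = refl

eSize-mono : ∀ R j s → 1 ≤ R → eSize R j s ≤ eSize R (suc j) s
eSize-mono R j s h = linear (eSize R j s ∷ eSize R (suc j) s ∷ R ∷ []) (χ 0 ⩽ χ 1)
  (# 4 ⊠ χ 0 ⊠ # 1 ⊞ # 4 ⊠ χ 0 ⊠ χ 2 ⩽ # 4 ⊠ χ 0 ⊠ χ 2 ⊞ χ 1) (4 * eSize R j s ⊛ h ⊕ eq≥ (eSize-suc R j s))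

1≤eSize : ∀ R j s → 1 ≤ R → 1 ≤ s → 1 ≤ eSize R j s
1≤eSize R zero    s h h′ = ≤-trans h′ (≤-reflexive (sym (eSize-zero R s)))
1≤eSize R (suc j) s h h′ = ≤-trans (1≤eSize R j s h h′) (eSize-mono R j s h)

-- Distribution of the exceptional vertices

module Assignment {N} (G : BlueGraph N) (m₁ m₂ : ℕ) (ms : List ℕ) (q″ K : ℕ) (len : length ms ≡ suc q″)
  (ms≤K : All (_≤ K) (m₁ ∷ m₂ ∷ ms)) (tot : m₂ + total ms ≤ K)
  (noMulti : ¬ Multipartite.Multi G (m₁ ∷ m₂ ∷ ms) full) (1≤K : 1 ≤ K)
  (n w : ℕ) (Sk : Skeleton G (2 + q″) n w) (12w<n : 12 * suc w ≤ n) where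

  open Embedding G using (b; b-sym; bsym)
  open Counting G
  open Multipartite G
  open Skeleton Sk

  q : ℕ
  q = 2 + q″

  -- `z` has at most `n + w` red neighbours in all classes, and `V i` alone has at least `n - w`
  -- vertices; so red neighbours in `V j` must be offset by blue ones in `V i`. Being close to one
  -- class thus means being blue to nearly all of every other.
  red-other : ∀ z i j → i ≢ j → count (V j ∖ b z) ≤ 2 * w + count (V i ∩ b z)
  red-other z i j ne = linear (count (V j ∖ b z) ∷ w ∷ count (V i ∩ b z) ∷ count (V i ∖ b z) ∷ sum (λ j →
      count (V j ∖ b z)) ∷ n ∷ count (V i) ∷ [])
    (χ 0 ⩽ # 2 ⊠ χ 1 ⊞ χ 2) ((χ 3 ⊞ χ 0) ⊞ χ 4 ⊞ χ 5 ⊞ χ 6 ⩽ χ 4 ⊞ (χ 5 ⊞ χ 1) ⊞ (χ 6 ⊞ χ 1) ⊞ χ 2 ⊞ χ 3)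
    (two-terms (λ j → count (V j ∖ b z)) i j ne ⊕ redsum z ⊕ lower i ⊕ eq≤ (count-split (V i) (b z)))

  V-low : ∀ i j → i ≢ j → LowRed (3 * w) (V i) (V j)
  V-low i j ne x x∈ = linear (count (V j ∖ b x) ∷ w ∷ count (V i ∩ b x) ∷ []) (χ 0 ⩽ # 3 ⊠ χ 1)
    (χ 0 ⊞ χ 2 ⩽ (# 2 ⊠ χ 1 ⊞ χ 2) ⊞ χ 1) (red-other x i j ne ⊕ near i x∈)

  V-upper : ∀ i → count (V i) ≤ n + 2 * w
  V-upper i with inhabited {A = V i} (linear (count (V i) ∷ n ∷ w ∷ []) (# 1 ⩽ χ 0)
    (χ 1 ⊞ # 12 ⊠ (# 1 ⊞ χ 2) ⩽ (χ 0 ⊞ χ 2) ⊞ χ 1) (lower i ⊕ 12w<n))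
  ... | v , v∈ = linear (count (V i) ∷ n ∷ w ∷ count (V i ∩ b v) ∷ count (V i ∖ b v) ∷ sum (λ j →
      count (V j ∖ b v)) ∷ [])
    (χ 0 ⩽ χ 1 ⊞ # 2 ⊠ χ 2) (χ 0 ⊞ χ 3 ⊞ χ 4 ⊞ χ 5 ⩽ (χ 3 ⊞ χ 4) ⊞ χ 2 ⊞ χ 5 ⊞ χ 1 ⊞ χ 2)
    (eq≤ (count-split (V i) (b v)) ⊕ near i v∈ ⊕ term≤sum (λ j → count (V j ∖ b v)) i ⊕ redsum v)

  -- `D` serves as the first part and the sets `X i`, nearly blue to one another, host the other `q`
  -- parts.
  spread : ∀ D (X : Fin q → VSet N) p → K ≤ count D → (∀ i → X i ⊆ V i) → (∀ i → p ≤ count (X i)) →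
           (∀ i {d x} → d ∈ D → x ∈ X i → x ∈ b d) → K * (3 * w) + K ≤ p → ⊥
  spread D X p cD X⊆ cX bl hp = noMulti (step D (⋃ X) (λ _ → ∈full) (≤-trans (All.head ms≤K) cD) (λ _ → ∈full)
    (λ d∈ x∈ → let i , x∈Xᵢ = ⋃⁻ X x∈ in bl i d∈ x∈Xᵢ)
    (select K (3 * w) (m₂ ∷ ms) (tabulate X) (⋃ X)
      (≤-reflexive (trans (cong suc len) (sym (length-tabulate X)))) (All.tail ms≤K)
      (AllPairsₚ.tabulate⁺ λ {i} {j} ne x x∈ → ≤-trans (count-mono (∖-mono (X⊆ j))) (V-low i j ne x (X⊆ i x∈)))
      (Allₚ.tabulate⁺ λ i → ≤-trans (+-monoˡ-≤ K (*-monoˡ-≤ (3 * w) tot)) (≤-trans hp (≤-trans (cX i)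
        (count-mono λ p → ∩⁺ (⋃⁺ X i p) p))))))

  record Nested {j} (s p : ℕ) (D : VSet N) (U : Fin j → VSet N) : Set where
    constructor mkNested
    field
      D′   : VSet N
      X    : Fin j → VSet N
      D′⊆  : D′ ⊆ D
      cD′  : s ≤ count D′
      X⊆   : ∀ i → X i ⊆ U i
      cX   : ∀ i → p ≤ count (X i)
      blue : ∀ i {d x} → d ∈ D′ → x ∈ X i → x ∈ b d

  -- `kst` is applied to one set after the other, each time to the vertices of `D` that the previous
  -- application retained.
  nested : ∀ R j (U : Fin j → VSet N) s p D → 1 ≤ R → 1 ≤ s → 1 ≤ p → (∀ i → count (U i) ≤ 2 * n) →
           (∀ i {d} → d ∈ D → n < R * count (U i ∩ b d)) → eSize R j s ≤ count D →
           (∀ k → k ≤ j → 2 * R * (p * 2 ^ eSize R k s) ≤ n) →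
           Nested s p D U
  nested R zero U s p D h₁ hs hp cU dense cD small =
    mkNested D (λ ()) (λ p → p) (≤-trans (≤-reflexive (sym (eSize-zero R s))) cD) (λ ()) (λ ()) λ ()
  nested R (suc j) U s p D h₁ hs hp cU dense cD small with subset-of-size D (eSize R (suc j) s) cD
  ... | D₀ , D₀⊆ , cD₀ with kst D₀ (U zero) (eSize R (suc j) s) (eSize R j s) p hp (≤-reflexive cD₀)
      (*-cancelˡ-< R _ _ edges)
    where
    aux : ∀ c P e → 1 ≤ e → c ≤ 2 * n → 2 * R * P ≤ n → suc (R * (e * c + 4 * e * R * P)) ≤ 4 * e * R * suc n
    aux c P e 1≤e hc hP = linear (R ∷ e ∷ c ∷ P ∷ n ∷ [])
      (# 1 ⊞ χ 0 ⊠ (χ 1 ⊠ χ 2 ⊞ # 4 ⊠ χ 1 ⊠ χ 0 ⊠ χ 3) ⩽ # 4 ⊠ χ 1 ⊠ χ 0 ⊠ (# 1 ⊞ χ 4))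
      (χ 0 ⊠ χ 1 ⊠ χ 2 ⊞ # 2 ⊠ χ 1 ⊠ χ 0 ⊠ (# 2 ⊠ χ 0 ⊠ χ 3) ⊞ # 1 ⊠ # 1 ⩽ χ 0 ⊠ χ 1 ⊠ (# 2 ⊠ χ 4) ⊞
        # 2 ⊠ χ 1 ⊠ χ 0 ⊠ χ 4 ⊞ χ 0 ⊠ χ 1)
      (R * e ⊛ hc ⊕ 2 * e * R ⊛ hP ⊕ *-mono-≤ h₁ 1≤e)
    edges : suc (R * (eSize R j s * count (U zero) + eSize R (suc j) s * (p * 2 ^ eSize R (suc j) s))) ≤
            R * ∑∈ D₀ (λ d → count (U zero ∩ b d))
    edges = ≤-trans (subst (λ e → suc (R * (eSize R j s * count (U zero) +
        e * (p * 2 ^ eSize R (suc j) s))) ≤ e * suc n) (sym (eSize-suc R j s))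
              (aux (count (U zero)) (p * 2 ^ eSize R (suc j) s) (eSize R j s) (1≤eSize R j s h₁ hs) (cU zero)
                (small (suc j) ≤-refl)))
            (≤-trans (≤-reflexive (cong (_* suc n) (sym cD₀)))
            (≤-trans (∑∈-≥ D₀ (λ d → R * count (U zero ∩ b d)) (suc n) (λ d∈ → dense zero (D₀⊆ d∈)))
              (≤-reflexive (∑∈-scale D₀ R (λ d → count (U zero ∩ b d))))))
  ...   | biclique D₁ X₀ D₁⊆ cD₁ X₀⊆ cX₀ bl₀
    with nested R j (λ i → U (suc i)) s p D₁ h₁ hs hp (λ i → cU (suc i)) (λ i d∈ → dense (suc i) (D₀⊆ (D₁⊆ d∈)))
           (≤-reflexive (sym cD₁)) (λ k k≤ → small k (≤-trans k≤ (n≤1+n j)))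
  ...     | mkNested D′ X D′⊆ cD′ X⊆ cX bl = mkNested D′ (X₀ ◂ X) (λ p → D₀⊆ (D₁⊆ (D′⊆ p))) cD′
    (λ { zero → X₀⊆ ; (suc i) → X⊆ i }) (λ { zero → cX₀ ; (suc i) → cX i })
    (λ { zero d∈ x∈ → bl₀ (D′⊆ d∈) x∈ ; (suc i) → bl i })

  -- This bounds both the exceptional set and the layers between two thresholds.
  few-dense : ∀ R p D → 1 ≤ R → (∀ i {d} → d ∈ D → n < R * count (V i ∩ b d)) → K * (3 * w) + K ≤ p →
              (∀ k → k ≤ q → 2 * R * (p * 2 ^ eSize R k K) ≤ n) → count D ≤ eSize R q K
  few-dense R p D 1≤R dense hp small = ≮⇒≥ λ h → contra
      (nested R q V K p D 1≤R 1≤K (≤-trans 1≤K (≤-trans (m≤n+m K _) hp)) V≤2n dense (<⇒≤ h) small)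
    where
    V≤2n : ∀ i → count (V i) ≤ 2 * n
    V≤2n i = linear (count (V i) ∷ n ∷ w ∷ []) (χ 0 ⩽ # 2 ⊠ χ 1)
      (χ 0 ⊞ # 12 ⊠ (# 1 ⊞ χ 2) ⩽ (χ 1 ⊞ # 2 ⊠ χ 2) ⊞ χ 1) (V-upper i ⊕ 12w<n)
    contra : ¬ Nested K p D V
    contra (mkNested D′ X D′⊆ cD′ X⊆ cX bl) = spread D′ X p cD′ X⊆ cX bl hp

  opaque
    Near : ℕ → Fin q → VSet N
    Near R i = ⟪ (λ z → R * count (V i ∩ b z)) ≼ (λ _ → n) ⟫

    near⁺ : ∀ {R i z} → R * count (V i ∩ b z) ≤ n → z ∈ Near R i
    near⁺ h = ≼⁺ h

    near⁻ : ∀ {R i z} → z ∈ Near R i → R * count (V i ∩ b z) ≤ n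
    near⁻ h = ≼⁻ h

  Near-anti : ∀ {R R′ i} → R ≤ R′ → Near R′ i ⊆ Near R i
  Near-anti {i = i} h {z} p = near⁺ (≤-trans (*-monoˡ-≤ (count (V i ∩ b z)) h) (near⁻ p))

  -- Otherwise K vertices of L would have many common blue neighbours in V i and, being red to almost
  -- nothing outside V i, also in every other V j.
  mass-bound : ∀ i L e p → L ⊆ Near (4 * K) i → count L ≤ e → K * (3 * w) + K ≤ p → 4 * p ≤ n →
      e * (p * 2 ^ e) ≤ n →
               24 * K * w ≤ n →
               ∑∈ L (λ z → count (V i ∩ b z)) ≤ (2 * K + 1) * n
  mass-bound i L e p L⊆ cL hp 4p≤n hpe hw with ∑∈ L (λ z → count (V i ∩ b z)) ≤? (2 * K + 1) * n
  ... | yes h = h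
  ... | no ¬h with kst L (V i) e K p (≤-trans 1≤K (≤-trans (m≤n+m K _) hp)) cL
                    (linear (K ∷ count (V i) ∷ e ∷ p ∷ 2 ^ e ∷ ∑∈ L (λ d → count (V i ∩ b d)) ∷ n ∷ w ∷ [])
                      (# 1 ⊞ χ 0 ⊠ χ 1 ⊞ χ 2 ⊠ (χ 3 ⊠ χ 4) ⩽ χ 5)
                      ((# 1 ⊞ (# 2 ⊠ χ 0 ⊞ # 1) ⊠ χ 6) ⊞ χ 0 ⊠ χ 1 ⊞ χ 2 ⊠ (χ 3 ⊠ χ 4) ⊞ χ 0 ⊠ (# 12 ⊠ (# 1 ⊞
                        χ 7)) ⩽ χ 5 ⊞ χ 0 ⊠ (χ 6 ⊞ # 2 ⊠ χ 7) ⊞ χ 6 ⊞ χ 0 ⊠ χ 6)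
                      (≰⇒> ¬h ⊕ K ⊛ V-upper i ⊕ hpe ⊕ K ⊛ 12w<n))
  ...   | biclique D X D⊆ cD X⊆ cX bl = ⊥-elim (spread D X′ p (≤-reflexive (sym cD)) X′⊆ cX′ bl′ hp)
    where
    X′ : Fin q → VSet N
    X′ j with j ≟ i
    ... | yes _ = X
    ... | no _  = V j ∩ common D
    X′⊆ : ∀ j → X′ j ⊆ V j
    X′⊆ j with j ≟ i
    ... | yes refl = X⊆
    ... | no _     = ∩₁
    other : ∀ j → j ≢ i → p ≤ count (V j ∩ common D)
    other j ne = *-cancelˡ-≤ 4 (linear (p ∷ count (V j ∩ common D) ∷ count (V j) ∷ n ∷ ∑∈ D (λ d →
        count (V j ∖ b d)) ∷ K ∷ w ∷ [])
      (# 4 ⊠ χ 0 ⩽ # 4 ⊠ χ 1)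
      (# 4 ⊠ χ 2 ⊞ # 4 ⊠ χ 3 ⊞ # 4 ⊠ χ 0 ⊞ # 4 ⊠ χ 4 ⊞ # 24 ⊠ χ 5 ⊠ χ 6 ⊞ # 12 ⊠ (# 1 ⊞ χ 6) ⩽ # 4 ⊠ (χ 1 ⊞
        χ 4) ⊞ # 4 ⊠ (χ 2 ⊞ χ 6) ⊞ χ 3 ⊞ (# 8 ⊠ χ 5 ⊠ χ 6 ⊞ χ 3) ⊞ χ 3 ⊞ χ 3)
      (4 ⊛ common-loss-∑ D (V j) ⊕ 4 ⊛ lower j ⊕ 4p≤n ⊕ total-red ⊕ hw ⊕ 12w<n))
      where
      red : ∀ {d} → d ∈ D → 4 * K * count (V j ∖ b d) ≤ 8 * K * w + n
      red {d} d∈ = linear (K ∷ count (V j ∖ b d) ∷ w ∷ n ∷ count (V i ∩ b d) ∷ [])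
        (# 4 ⊠ χ 0 ⊠ χ 1 ⩽ # 8 ⊠ χ 0 ⊠ χ 2 ⊞ χ 3)
        (# 4 ⊠ χ 0 ⊠ χ 1 ⊞ # 4 ⊠ χ 0 ⊠ χ 4 ⩽ # 4 ⊠ χ 0 ⊠ (# 2 ⊠ χ 2 ⊞ χ 4) ⊞ χ 3)
        (4 * K ⊛ red-other d i j (λ e → ne (sym e)) ⊕ near⁻ (L⊆ (D⊆ d∈)))
      total-red : 4 * ∑∈ D (λ d → count (V j ∖ b d)) ≤ 8 * K * w + n
      total-red = *-cancelˡ-≤ K {{>-nonZero 1≤K}} (linear (K ∷ ∑∈ D (λ d → count (V j ∖ b d)) ∷ w ∷ n ∷
          ∑∈ D (λ d → 4 * K * count (V j ∖ b d)) ∷ count D ∷ [])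
        (χ 0 ⊠ (# 4 ⊠ χ 1) ⩽ χ 0 ⊠ (# 8 ⊠ χ 0 ⊠ χ 2 ⊞ χ 3))
        (# 4 ⊠ χ 0 ⊠ χ 1 ⊞ χ 4 ⊞ (# 8 ⊠ χ 0 ⊠ χ 2 ⊞ χ 3) ⊠ χ 5 ⩽ χ 4 ⊞ χ 5 ⊠ (# 8 ⊠ χ 0 ⊠ χ 2 ⊞ χ 3) ⊞
          (# 8 ⊠ χ 0 ⊠ χ 2 ⊞ χ 3) ⊠ χ 0)
        (eq≥ (∑∈-scale D (4 * K) (λ d → count (V j ∖ b d))) ⊕
        ∑∈-≤ D (λ d → 4 * K * count (V j ∖ b d)) (8 * K * w + n) red ⊕ (8 * K * w + n) ⊛ eq≤ cD))
    cX′ : ∀ j → p ≤ count (X′ j)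
    cX′ j with j ≟ i
    ... | yes _ = cX
    ... | no ne = other j ne
    bl′ : ∀ j {d x} → d ∈ D → x ∈ X′ j → x ∈ b d
    bl′ j with j ≟ i
    ... | yes refl = bl
    ... | no _     = λ d∈ x∈ → common⁻ d∈ (∩₂ x∈)

  dense-other : ∀ R i j z → i ≢ j → 4 ≤ R → z ∈ Near (4 * K) i → n < R * count (V j ∩ b z)
  dense-other R i j z ne 4≤R z∈ = ≤-trans big (*-monoˡ-≤ (count (V j ∩ b z)) 4≤R)
    where
    4blue≤n : 4 * count (V i ∩ b z) ≤ n
    4blue≤n = linear (count (V i ∩ b z) ∷ n ∷ K ∷ []) (# 4 ⊠ χ 0 ⩽ χ 1)
      (# 4 ⊠ χ 0 ⊠ # 1 ⊞ # 4 ⊠ χ 2 ⊠ χ 0 ⩽ # 4 ⊠ χ 0 ⊠ χ 2 ⊞ χ 1) ((4 * count (V i ∩ b z)) ⊛ 1≤K ⊕ near⁻ z∈)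
    big : suc n ≤ 4 * count (V j ∩ b z)
    big = linear (n ∷ count (V j ∩ b z) ∷ count (V j ∖ b z) ∷ count (V j) ∷ count (V i ∩ b z) ∷ w ∷ [])
      (# 1 ⊞ χ 0 ⩽ # 4 ⊠ χ 1)
      (# 4 ⊠ χ 2 ⊞ # 4 ⊠ χ 0 ⊞ # 4 ⊠ χ 3 ⊞ # 4 ⊠ χ 4 ⊞ # 12 ⊠ (# 1 ⊞ χ 5) ⊞ # 12 ⊠ (# 1 ⊞ χ 5) ⩽
        # 4 ⊠ (# 2 ⊠ χ 5 ⊞ χ 4) ⊞ # 4 ⊠ (χ 3 ⊞ χ 5) ⊞ # 4 ⊠ (χ 1 ⊞ χ 2) ⊞ χ 0 ⊞ χ 0 ⊞ χ 0)
      (4 ⊛ red-other z i j ne ⊕ 4 ⊛ lower j ⊕ 4 ⊛ eq≤ (count-split (V j) (b z)) ⊕ 4blue≤n ⊕ 12w<n ⊕ 12w<n)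

  Layer : ℕ → ℕ → Fin q → VSet N
  Layer R R′ i = Near R i ∖ Near R′ i

  mass : ℕ → ℕ → Fin q → ℕ
  mass R R′ i = ∑∈ (Layer R R′ i) (λ z → count (V i ∩ b z))

  -- A vertex of the layer has many blue neighbours in `V i` because it misses the threshold `R′`,
  -- and in every other class by `dense-other`.
  layer-size : ∀ R R′ p i → 4 * K ≤ R → 4 ≤ R′ → K * (3 * w) + K ≤ p →
               (∀ k → k ≤ q → 2 * R′ * (p * 2 ^ eSize R′ k K) ≤ n) → count (Layer R R′ i) ≤ eSize R′ q K
  layer-size R R′ p i hR hR′ hp small = few-dense R′ p (Layer R R′ i) (≤-trans (s≤s z≤n) hR′) dense hp small
    where
    dense : ∀ j {d} → d ∈ Layer R R′ i → n < R′ * count (V j ∩ b d)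
    dense j {d} d∈ with i ≟ j
    ... | yes refl = ≰⇒> λ h → ∖₂ d∈ (near⁺ h)
    ... | no ne    = dense-other R′ i j d ne hR′ (Near-anti hR (∖₁ d∈))

  module Select (R : ℕ → ℕ) (R₀ : R zero ≡ 4 * K) (R≤ : ∀ t → R t ≤ R (suc t)) where

    R₀≤ : ∀ t → 4 * K ≤ R t
    R₀≤ zero    = ≤-reflexive (sym R₀)
    R₀≤ (suc t) = ≤-trans (R₀≤ t) (R≤ t)

    opaque
      μ ν : ℕ → ℕ
      μ t = sum (λ i → mass (R zero) (R t) i)
      ν t = sum (λ i → mass (R t) (R (suc t)) i)

      μ-step : ∀ t → μ t + ν t ≤ μ (suc t)
      μ-step t = ≤-trans (≤-reflexive (sym (∑-distrib-+ (mass (R zero) (R t)) (mass (R t) (R (suc t))))))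
          (sum-mono step′)
        where
        step′ : ∀ i → mass (R zero) (R t) i + mass (R t) (R (suc t)) i ≤ mass (R zero) (R (suc t)) i
        step′ i = ≤-trans (≤-reflexive (+-comm (mass (R zero) (R t) i) (mass (R t) (R (suc t)) i)))
            (≤-trans (+-mono-≤
            (∑∈-⊆ (Layer (R t) (R (suc t)) i) (Layer (R zero) (R (suc t)) i ∩ Near (R t) i) (λ z →
              count (V i ∩ b z))
              (λ p → ∩⁺ (∖⁺ (Near-anti (≤-trans (≤-reflexive R₀) (R₀≤ t)) (∖₁ p)) (∖₂ p)) (∖₁ p)))
            (∑∈-⊆ (Layer (R zero) (R t) i) (Layer (R zero) (R (suc t)) i ∖ Near (R t) i) (λ z →
              count (V i ∩ b z))
              (λ p → ∖⁺ (∖⁺ (∖₁ p) (λ r → ∖₂ p (Near-anti (R≤ t) r))) (∖₂ p))))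
          (≤-reflexive (sym (∑∈-split (Layer (R zero) (R (suc t)) i) (Near (R t) i) (λ z →
            count (V i ∩ b z))))))

      μ-bound : ∀ t e p → (∀ i → count (Layer (R zero) (R t) i) ≤ e) → K * (3 * w) + K ≤ p → 4 * p ≤ n →
                e * (p * 2 ^ e) ≤ n → 24 * K * w ≤ n → μ t ≤ q * ((2 * K + 1) * n)
      μ-bound t e p cL hp 4p≤n hpe hw = ≤-trans
        (sum-mono {g = λ _ → (2 * K + 1) * n} λ i → mass-bound i (Layer (R zero) (R t) i) e p (λ p →
            subst (λ r → _ ∈ Near r i) R₀ (∖₁ p)) (cL i) hp 4p≤n hpe hw)
        (≤-reflexive (sum-const q _))

      ν-def : ∀ t → ν t ≡ sum (λ i → mass (R t) (R (suc t)) i)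
      ν-def t = refl

    -- The masses `ν t` of consecutive layers add up to at most `μ τ`. As `μ` has a bound that does
    -- not depend on `τ`, the second alternative is impossible for large `τ`.
    light : ∀ h τ → (∃ λ t → t < τ × h * ν t ≤ n) ⊎ τ * n ≤ h * μ τ
    light h zero = inj₂ z≤n
    light h (suc τ) with light h τ
    ... | inj₁ (t , t< , le) = inj₁ (t , ≤-trans t< (n≤1+n τ) , le)
    ... | inj₂ le with h * ν τ ≤? n
    ...   | yes p = inj₁ (τ , ≤-refl , p)
    ...   | no ¬p = inj₂ (linear (n ∷ τ ∷ h ∷ μ (suc τ) ∷ μ τ ∷ ν τ ∷ []) (χ 0 ⊞ χ 1 ⊠ χ 0 ⩽ χ 2 ⊠ χ 3)
      (χ 1 ⊠ χ 0 ⊞ χ 0 ⊞ χ 2 ⊠ (χ 4 ⊞ χ 5) ⩽ χ 2 ⊠ χ 4 ⊞ χ 2 ⊠ χ 5 ⊞ χ 2 ⊠ χ 3)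
      (le ⊕ ≰⇒≥ ¬p ⊕ h ⊛ μ-step τ))

    light-level : ∀ h τ e p → suc (h * (q * (2 * K + 1))) ≤ τ → (∀ i → count (Layer (R zero) (R τ) i) ≤ e) →
                  K * (3 * w) + K ≤ p → 4 * p ≤ n → e * (p * 2 ^ e) ≤ n → 24 * K * w ≤ n →
                  ∃ λ t → t < τ × h * ν t ≤ n
    light-level h τ e p hτ cL hp 4p≤n hpe hw with light h τ
    ... | inj₁ r  = r
    ... | inj₂ le = ⊥-elim (1≰0 (linear (τ ∷ n ∷ h ∷ μ τ ∷ K ∷ q″ ∷ w ∷ []) (# 1 ⩽ # 0)
      (χ 0 ⊠ χ 1 ⊞ χ 2 ⊠ χ 3 ⊞ χ 1 ⊠ (# 1 ⊞ χ 2 ⊠ ((# 2 ⊠ χ 4 ⊞ # 1) ⊞ (# 2 ⊠ χ 4 ⊞ # 1) ⊞ χ 5 ⊠ (# 2 ⊠ χ 4 ⊞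
        # 1))) ⊞ # 12 ⊠ (# 1 ⊞ χ 6) ⩽ χ 2 ⊠ χ 3 ⊞ χ 2 ⊠ ((# 2 ⊞ χ 5) ⊠ ((# 2 ⊠ χ 4 ⊞ # 1) ⊠ χ 1)) ⊞
        χ 1 ⊠ χ 0 ⊞ χ 1)
      (le ⊕ h ⊛ μ-bound τ e p cL hp 4p≤n hpe hw ⊕ n ⊛ hτ ⊕ 12w<n)))

  ∑∈-⋃ : ∀ {k} (A : Fin k → VSet N) (f : Fin N → ℕ) → ∑∈ (⋃ A) f ≤ sum (λ i → ∑∈ (A i) f)
  ∑∈-⋃ {zero} A f = ≤-trans (∑∈-≤ (⋃ A) f 0 (λ p → ⊥-elim (∉∅ p)))
      (≤-trans (≤-reflexive (*-zeroʳ (count (⋃ A)))) z≤n)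
  ∑∈-⋃ {suc k} A f = ≤-trans (≤-reflexive (∑∈-split (⋃ A) (A zero) f)) (≤-trans (+-mono-≤
      (∑∈-⊆ (⋃ A ∩ A zero) (A zero) f ∩₂)
      (≤-trans (∑∈-⊆ (⋃ A ∖ A zero) (⋃ (λ i → A (suc i))) f (λ p → [ (λ r → ⊥-elim (∖₂ p r)) , (λ r →
        r) ]′ (∪⁻ (∖₁ p))))
               (∑∈-⋃ (λ i → A (suc i)) f)))
    (≤-reflexive (sym (sum-suc (λ i → ∑∈ (A i) f)))))

  sum-punchIn : ∀ {k} (f : Fin (suc k) → ℕ) j → sum (λ i → f (punchIn j i)) ≤ sum f
  sum-punchIn f zero = ≤-trans (m≤n+m _ (f zero)) (≤-reflexive (sym (sum-suc f)))
  sum-punchIn {suc k} f (suc j) = ≤-trans (≤-reflexive (sum-suc (λ i → f (punchIn (suc j) i))))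
    (≤-trans (+-monoʳ-≤ (f zero) (sum-punchIn (λ i → f (suc i)) j)) (≤-reflexive (sym (sum-suc f))))

  -- A vertex of E that is red to at most one of the x j counts for some F i, so the F i together are at
  -- least as large as E whenever the x j have at most |E| red neighbours in E altogether.
  module _ (E : VSet N) (x : Fin q → Fin N) where

    private
      Miss : Fin q → VSet N
      Miss j = E ∖ b (x j)

    F : Fin q → VSet N
    F i = E ∖ ⋃ (λ k → Miss (punchIn i k))

    F⁺ : ∀ i {z} → z ∈ E → (∀ j → i ≢ j → z ∈ b (x j)) → z ∈ F i
    F⁺ i z∈ h = ∖⁺ z∈ λ p → let k , r = ⋃⁻ (λ k → Miss (punchIn i k)) p in ∖₂ r (h _ (λ e → punchInᵢ≢i i k (sym e)))

    F⁻ : ∀ i k {z} → z ∈ F i → z ∈ b (x (punchIn i k))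
    F⁻ i k {z} z∈ with z ∈? b (x (punchIn i k))
    ... | inj₁ p = p
    ... | inj₂ p = ⊥-elim (∖₂ z∈ (⋃⁺ (λ k → Miss (punchIn i k)) k (∖⁺ (∖₁ z∈) p)))

    private
      𝟙-∈ : ∀ {A : VSet N} {z} → z ∈ A → 1 ≤ 𝟙 (A z)
      𝟙-∈ (mem p) rewrite p = ≤-refl

      search : ∀ {k} (A : Fin k → VSet N) z → (∃ λ j → z ∉ A j) ⊎ (∀ j → z ∈ A j)
      search {zero} A z = inj₂ λ ()
      search {suc k} A z with z ∈? A zero | search (λ j → A (suc j)) z
      ... | inj₂ p | _ = inj₁ (zero , p)
      ... | inj₁ p | inj₁ (j , r) = inj₁ (suc j , r)
      ... | inj₁ p | inj₂ r = inj₂ λ { zero → p ; (suc j) → r j }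

    two : ∀ {z} → z ∈ E → 2 ≤ sum (λ i → 𝟙 (F i z)) + sum (λ j → 𝟙 (Miss j z))
    two {z} z∈ with search (λ j → b (x j)) z
    -- A vertex that is blue to every `x j` lies in every `F i`, and `q ≥ 2` provides two of them.
    ... | inj₂ all = ≤-trans (+-mono-≤ (𝟙-∈ (F⁺ zero z∈ (λ j _ → all j))) (𝟙-∈ (F⁺ (suc zero) z∈ (λ j _ →
        all j))))
                       (≤-trans (two-terms (λ i → 𝟙 (F i z)) zero (suc zero) (λ ())) (m≤m+n _ _))
    ... | inj₁ (j , z∉) with search (λ k → b (x (punchIn j k))) z
    ...   | inj₁ (k , z∉′) = ≤-trans (+-mono-≤ (𝟙-∈ (∖⁺ {B = b (x j)} z∈ z∉))
        (𝟙-∈ (∖⁺ {B = b (x (punchIn j k))} z∈ z∉′)))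
                       (≤-trans (two-terms (λ i → 𝟙 (Miss i z)) j (punchIn j k) (λ e →
                         punchInᵢ≢i j k (sym e))) (m≤n+m _ _))
    ...   | inj₂ all = +-mono-≤ (≤-trans (𝟙-∈ (F⁺ j z∈ others)) (term≤sum (λ i → 𝟙 (F i z)) j))
                                (≤-trans (𝟙-∈ (∖⁺ {B = b (x j)} z∈ z∉)) (term≤sum (λ i → 𝟙 (Miss i z)) j))
      where
      others : ∀ i → j ≢ i → z ∈ b (x i)
      others i ne = subst (λ i → z ∈ b (x i)) (punchIn-punchOut ne) (all (punchOut ne))

    F-total : sum (λ j → count (E ∖ b (x j))) ≤ count E → count E ≤ sum (λ i → count (F i))
    F-total h = linear (count E ∷ sum (λ i → count (F i)) ∷ ∑∈ E (λ x₁ → sum (λ i → 𝟙 (F i x₁)) + sum (λ j →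
        𝟙 (Miss j x₁))) ∷ ∑∈ E (λ z → sum (λ i → 𝟙 (F i z))) ∷ ∑∈ E (λ z → sum (λ i → 𝟙 (Miss i z))) ∷
        sum (λ i → count (Miss i)) ∷ [])
      (χ 0 ⩽ χ 1) (χ 0 ⊠ # 2 ⊞ χ 2 ⊞ χ 3 ⊞ χ 4 ⊞ χ 5 ⩽ χ 2 ⊞ (χ 3 ⊞ χ 4) ⊞ χ 1 ⊞ χ 5 ⊞ χ 0)
      (∑∈-≥ E (λ z → sum (λ i → 𝟙 (F i z)) + sum (λ j → 𝟙 (Miss j z))) 2 two ⊕
        eq≤ (∑∈-+ E (λ z → sum (λ i → 𝟙 (F i z))) (λ z → sum (λ j → 𝟙 (Miss j z)))) ⊕
        part F (λ _ → ∩₂) ⊕ part Miss (λ _ → ∩₂) ⊕ h′)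
      where
      h′ : sum (λ i → count (Miss i)) ≤ count E
      h′ = h
      part : (A : Fin q → VSet N) → (∀ i → E ∩ A i ⊆ A i) → ∑∈ E (λ z → sum (λ i → 𝟙 (A i z))) ≤ sum (λ i →
          count (A i))
      part A sub = ≤-trans (≤-reflexive (sym (∑∈-∑ E (λ i z → 𝟙 (A i z)))))
        (sum-mono λ i → ≤-trans (≤-reflexive (∑∈-count E (A i))) (count-mono (sub i)))

  opaque
    Rest : ℕ → VSet N
    Rest R = full ∖ ⋃ (Near R)

    rest⁻ : ∀ {R z} i → z ∈ Rest R → z ∉ Near R i
    rest⁻ {R} i z∈ p = ∖₂ z∈ (⋃⁺ (Near R) i p)

    cover : ∀ R → N ≤ sum (λ i → count (Near R i)) + count (Rest R)
    cover R = ≤-trans (≤-reflexive (sym count-full)) (≤-trans (count-∖ full (⋃ (Near R)))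
      (≤-trans (+-monoʳ-≤ _ (count-⋃-sum (Near R))) (≤-reflexive (+-comm (count (full ∖ ⋃ (Near R))) _))))

  rest-size : ∀ R p → 1 ≤ R → K * (3 * w) + K ≤ p →
              (∀ k → k ≤ q → 2 * R * (p * 2 ^ eSize R k K) ≤ n) → count (Rest R) ≤ eSize R q K
  rest-size R p 1≤R hp small = few-dense R p (Rest R) 1≤R (λ i d∈ → ≰⇒> λ h → rest⁻ i d∈ (near⁺ h)) hp small

  constant-blue : ∀ {E X x z} → Constant E X → x ∈ X → z ∈ E → z ∈ b x → X ⊆ b z
  constant-blue const x∈ z∈ bl with const z∈
  ... | inj₁ X⊆  = X⊆
  ... | inj₂ dis = ⊥-elim (dis x∈ (bsym bl))

  -- Restriction to typical vertices will cost each class at most `2 n / h` vertices. If the minima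
  -- over typical vertices sum to `|E| + δ` with `δ ≥ 1`, they exceed the unrestricted minima by
  -- less than `δ + K` in total, and averaging gives `δ n ≤ (2 n / h) (δ + K)` up to small errors.
  -- For `h = 2 K + 4` this fails with room for the errors.
  h : ℕ
  h = 2 * K + 4

  module Level (R R′ e e′ p ρ : ℕ) (4K≤R : 4 * K ≤ R)
    (hν : h * sum (λ i → mass R R′ i) ≤ n) (layer≤ : ∀ i → count (Layer R R′ i) ≤ e′)
    (cE : count (Rest R) ≤ e) (hp : 2 * (K * (7 * w) + K) ≤ p) (hP : 4 * (p * 2 ^ e) ≤ n)
    (he′ : h * (suc q″ * (e′ * (2 * w))) ≤ n)
    (hfin : h * e * w + q * (2 * h * e * (p * 2 ^ e) + h * e * w) ≤ n)
    (hR′ : ∀ c → R′ * c ≤ n → 8 * K * c ≤ p) (N≥ : suc (q * ρ) ≤ N)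
    (bip : ∀ U → suc ρ ≤ count U → ∃₂ λ A₁ A₂ → A₁ ⊆ U × A₂ ⊆ U × count A₁ ≡ m₁ × count A₂ ≡ m₂ ×
             (∀ {x y} → x ∈ A₁ → y ∈ A₂ → y ∈ b x)) where

    E : VSet N
    E = Rest R

    opaque
      -- The vertices between the two thresholds for some other class; the typical vertices of `V j`
      -- are those that are blue to all of them.
      Λ : Fin q → VSet N
      Λ j = ⋃ (λ k → Layer R R′ (punchIn j k))

      Λ⁺ : ∀ i j {y} → j ≢ i → y ∈ Layer R R′ i → y ∈ Λ j
      Λ⁺ i j ne y∈ = ⋃⁺ (λ k → Layer R R′ (punchIn j k)) (punchOut ne) (subst (λ i → _ ∈ Layer R R′ i)
          (sym (punchIn-punchOut ne)) y∈)

      Λ-red : ∀ j → ∑∈ (Λ j) (λ z → count (V j ∖ b z)) ≤ suc q″ * (e′ * (2 * w)) + sum (λ i → mass R R′ i)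
      Λ-red j = ≤-trans (∑∈-⋃ (λ k → Layer R R′ (punchIn j k)) (λ z → count (V j ∖ b z)))
        (≤-trans (sum-mono each) (≤-trans (≤-reflexive (∑-distrib-+ (λ _ → e′ * (2 * w)) (λ k →
          mass R R′ (punchIn j k))))
          (+-mono-≤ (≤-reflexive (sum-const (suc q″) (e′ * (2 * w)))) (sum-punchIn (mass R R′) j))))
        where
        each : ∀ k → ∑∈ (Layer R R′ (punchIn j k)) (λ z → count (V j ∖ b z)) ≤ e′ * (2 * w) +
            mass R R′ (punchIn j k)
        each k = ≤-trans (∑∈-mono (Layer R R′ (punchIn j k)) (λ z → count (V j ∖ b z)) (λ z → 2 * w +
            count (V (punchIn j k) ∩ b z))
            (λ {z} _ → red-other z (punchIn j k) j (punchInᵢ≢i j k)))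
          (≤-trans (≤-reflexive (∑∈-+ (Layer R R′ (punchIn j k)) (λ _ → 2 * w) (λ z →
            count (V (punchIn j k) ∩ b z))))
            (+-monoˡ-≤ _ (≤-trans (≤-reflexive (∑∈-const (Layer R R′ (punchIn j k)) (2 * w)))
              (*-monoˡ-≤ (2 * w) (layer≤ (punchIn j k))))))

    Typ : Fin q → VSet N
    Typ j = V j ∩ common (Λ j)

    lost≤ : ∀ j → h * count (V j ∖ common (Λ j)) ≤ 2 * n
    lost≤ j = linear (K ∷ count (V j ∖ common (Λ j)) ∷ n ∷ count (V j ∩ common (Λ j)) ∷ count (V j) ∷
        ∑∈ (Λ j) (λ z → count (V j ∖ b z)) ∷ q″ ∷ e′ ∷ w ∷ sum (mass R R′) ∷ [])
      ((# 2 ⊠ χ 0 ⊞ # 4) ⊠ χ 1 ⩽ # 2 ⊠ χ 2)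
      ((# 2 ⊠ χ 0 ⊞ # 4) ⊠ (χ 3 ⊞ χ 1) ⊞ (# 2 ⊠ χ 0 ⊞ # 4) ⊠ χ 4 ⊞ (# 2 ⊠ χ 0 ⊞ # 4) ⊠ χ 5 ⊞ (# 2 ⊠ χ 0 ⊞
        # 4) ⊠ ((# 1 ⊞ χ 6) ⊠ (χ 7 ⊠ (# 2 ⊠ χ 8))) ⊞ (# 2 ⊠ χ 0 ⊞ # 4) ⊠ χ 9 ⩽ (# 2 ⊠ χ 0 ⊞ # 4) ⊠ χ 4 ⊞
        (# 2 ⊠ χ 0 ⊞ # 4) ⊠ (χ 3 ⊞ χ 5) ⊞ (# 2 ⊠ χ 0 ⊞ # 4) ⊠ ((# 1 ⊞ χ 6) ⊠ (χ 7 ⊠ (# 2 ⊠ χ 8)) ⊞ χ 9) ⊞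
        χ 2 ⊞ χ 2)
      (h ⊛ eq≥ (count-split (V j) (common (Λ j))) ⊕ h ⊛ common-loss-∑ (Λ j) (V j) ⊕ h ⊛ Λ-red j ⊕ he′ ⊕ hν)

    V-big : ∀ j → p * 2 ^ e < count (V j)
    V-big j = *-cancelˡ-< 4 (p * 2 ^ e) (count (V j)) (linear (p ∷ 2 ^ e ∷ count (V j) ∷ n ∷ w ∷ [])
      (# 1 ⊞ # 4 ⊠ (χ 0 ⊠ χ 1) ⩽ # 4 ⊠ χ 2)
      (# 4 ⊠ χ 3 ⊞ # 4 ⊠ (χ 0 ⊠ χ 1) ⊞ # 12 ⊠ (# 1 ⊞ χ 4) ⩽ # 4 ⊠ (χ 2 ⊞ χ 4) ⊞ χ 3 ⊞ χ 3)
      (4 ⊛ lower j ⊕ hP ⊕ 12w<n))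

    Typ-big : ∀ j → p * 2 ^ e < count (Typ j)
    Typ-big j = *-cancelˡ-< 6 (p * 2 ^ e) (count (V j ∩ common (Λ j))) (linear (p ∷ 2 ^ e ∷
        count (V j ∩ common (Λ j)) ∷ n ∷ count (V j) ∷ K ∷ count (V j ∖ common (Λ j)) ∷ w ∷ [])
      (# 1 ⊞ # 6 ⊠ (χ 0 ⊠ χ 1) ⩽ # 6 ⊠ χ 2)
      (# 6 ⊠ χ 3 ⊞ # 6 ⊠ χ 4 ⊞ (# 2 ⊠ χ 5 ⊞ # 4) ⊠ χ 6 ⊞ # 2 ⊠ χ 6 ⊠ # 1 ⊞ # 4 ⊠ (χ 0 ⊠ χ 1) ⊞
        # 4 ⊠ (χ 0 ⊠ χ 1) ⊞ # 12 ⊠ (# 1 ⊞ χ 7) ⩽ # 6 ⊠ (χ 4 ⊞ χ 7) ⊞ # 6 ⊠ (χ 2 ⊞ χ 6) ⊞ # 2 ⊠ χ 3 ⊞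
        # 2 ⊠ χ 6 ⊠ χ 5 ⊞ χ 3 ⊞ χ 3 ⊞ χ 3)
      (6 ⊛ lower j ⊕ 6 ⊛ eq≤ (count-split (V j) (common (Λ j))) ⊕ lost≤ j ⊕
                  (2 * count (V j ∖ common (Λ j))) ⊛ 1≤K ⊕ hP ⊕ hP ⊕ 12w<n))

    opaque
      m⁰ : ∀ j → EssMin p e (V j) E
      m⁰ j = essmin p e (V j) E cE (V-big j)

      m : ∀ j → EssMin p e (Typ j) E
      m j = essmin p e (Typ j) E cE (Typ-big j)

    open EssMin

    lv≥ : ∀ j → lv (m⁰ j) ≤ lv (m j)
    lv≥ j = ≮⇒≥ λ lt → <⇒≱ (above (m j)) (≤-trans
      (count-mono λ y∈ → ∩⁺ (∩₁ (∩₁ y∈)) (≼⁺ (≤-trans (s≤s (≼⁻ (∩₂ y∈))) lt))) (below (m⁰ j)))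

    -- Each `x (m⁰ j)` is red to at most `lv (m⁰ j)` vertices of `E`. If `K` vertices of `E` avoided
    -- all these red edges, they would be blue to the sets `X (m⁰ j)` in every class.
    all-min : count E < sum (λ j → lv (m⁰ j)) + K
    all-min = ≰⇒> λ le → spread (E ∖ ⋃ (λ j → E ∖ b (x (m⁰ j)))) (λ j → X (m⁰ j)) p (many le) (λ j →
        X⊆ (m⁰ j)) (λ j → cX (m⁰ j))
        (λ j d∈ → constant-blue (const (m⁰ j)) (x∈ (m⁰ j)) (∖₁ d∈) (hit j d∈)) (linear (K ∷ w ∷ p ∷ [])
          (χ 0 ⊠ (# 3 ⊠ χ 1) ⊞ χ 0 ⩽ χ 2) (# 2 ⊠ (χ 0 ⊠ (# 7 ⊠ χ 1) ⊞ χ 0) ⩽ χ 2)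
          hp)
      where
      many : sum (λ j → lv (m⁰ j)) + K ≤ count E → K ≤ count (E ∖ ⋃ (λ j → E ∖ b (x (m⁰ j))))
      many le = linear (K ∷ count (E ∖ ⋃ (λ j → E ∖ b (x (m⁰ j)))) ∷ sum (λ j → lv (m⁰ j)) ∷ count E ∷
          count (⋃ (λ j → E ∖ b (x (m⁰ j)))) ∷ sum (λ j → count (E ∖ b (x (m⁰ j)))) ∷ [])
        (χ 0 ⩽ χ 1) ((χ 2 ⊞ χ 0) ⊞ χ 3 ⊞ χ 4 ⊞ χ 5 ⩽ χ 3 ⊞ (χ 1 ⊞ χ 4) ⊞ χ 5 ⊞ χ 2)
        (le ⊕ count-∖ E (⋃ (λ j → E ∖ b (x (m⁰ j)))) ⊕ count-⋃-sum (λ j → E ∖ b (x (m⁰ j))) ⊕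
                     sum-mono {f = λ j → count (E ∖ b (x (m⁰ j)))} {λ j → lv (m⁰ j)} (λ j → x≤lv (m⁰ j)))
      hit : ∀ j {d} → d ∈ E ∖ ⋃ (λ j → E ∖ b (x (m⁰ j))) → d ∈ b (x (m⁰ j))
      hit j {d} d∈ with d ∈? b (x (m⁰ j))
      ... | inj₁ r = r
      ... | inj₂ r = ⊥-elim (∖₂ d∈ (⋃⁺ (λ j → E ∖ b (x (m⁰ j))) j (∖⁺ (∖₁ d∈) r)))

    redsum-E : sum (λ j → ∑∈ (V j) (λ y → count (E ∖ b y))) ≤ count E * (n + w)
    redsum-E = ≤-trans (≤-reflexive (trans (sum-cong-≗ λ j → ∑∈-swap-∖ (V j) E b b-sym) (∑∈-∑ E (λ j z →
        count (V j ∖ b z)))))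
                 (∑∈-≤ E (λ z → sum (λ j → count (V j ∖ b z))) (n + w) (λ _ → redsum _))

    -- Typical vertices are averaged with their own minimum `lv (m j)`, the lost ones only with
    -- `lv (m⁰ j)`. As at most `2 * n / h` vertices are lost, the difference of the minima carries
    -- the factor `2 * n`.
    weighted : ∀ j → h * n * lv (m j) ≤ h * ∑∈ (V j) (λ y → count (E ∖ b y)) +
                 (2 * n * (lv (m j) ∸ lv (m⁰ j)) + (2 * h * e * (p * 2 ^ e) + h * e * w))
    weighted j = linear (h ∷ n ∷ lv (m j) ∷ ∑∈ (V j) (λ y → count (E ∖ b y)) ∷ lv (m j) ∸ lv (m⁰ j) ∷ e ∷ p ∷
        2 ^ e ∷ w ∷ count (V j ∩ common (Λ j)) ∷ count (V j ∖ common (Λ j)) ∷ lv (m⁰ j) ∷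
        ∑∈ (V j ∩ common (Λ j)) (λ y → count (E ∖ b y)) ∷ ∑∈ (V j ∖ common (Λ j)) (λ y → count (E ∖ b y)) ∷
        count (V j) ∷ [])
      (χ 0 ⊠ χ 1 ⊠ χ 2 ⩽ χ 0 ⊠ χ 3 ⊞ # 2 ⊠ χ 1 ⊠ χ 4 ⊞ # 2 ⊠ χ 0 ⊠ χ 5 ⊠ (χ 6 ⊠ χ 7) ⊞ χ 0 ⊠ χ 5 ⊠ χ 8)
      (χ 0 ⊠ (χ 9 ⊠ χ 2) ⊞ χ 0 ⊠ (χ 10 ⊠ χ 11) ⊞ χ 0 ⊠ (χ 12 ⊞ χ 13) ⊞ χ 0 ⊠ χ 2 ⊠ χ 1 ⊞ χ 0 ⊠ χ 8 ⊠ χ 2 ⊞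
        χ 0 ⊠ χ 2 ⊠ χ 14 ⊞ χ 4 ⊠ (χ 0 ⊠ χ 10) ⊞ χ 0 ⊠ χ 10 ⊠ χ 2 ⩽ χ 0 ⊠ (χ 12 ⊞ χ 6 ⊠ χ 7 ⊠ χ 5) ⊞
        χ 0 ⊠ (χ 13 ⊞ χ 6 ⊠ χ 7 ⊠ χ 5) ⊞ χ 0 ⊠ χ 3 ⊞ χ 0 ⊠ χ 2 ⊠ (χ 14 ⊞ χ 8) ⊞ χ 0 ⊠ χ 8 ⊠ χ 5 ⊞
        χ 0 ⊠ χ 2 ⊠ (χ 9 ⊞ χ 10) ⊞ χ 4 ⊠ (# 2 ⊠ χ 1) ⊞ χ 0 ⊠ χ 10 ⊠ (χ 11 ⊞ χ 4))
      (h ⊛ essmin-average (m j) (V j ∩ common (Λ j)) (λ p → p) ⊕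
        h ⊛ essmin-average (m⁰ j) (V j ∖ common (Λ j)) ∖₁ ⊕
        h ⊛ eq≥ (∑∈-split (V j) (common (Λ j)) (λ y → count (E ∖ b y))) ⊕
        h * lv (m j) ⊛ lower j ⊕ h * w ⊛ lv≤e (m j) ⊕ h * lv (m j) ⊛ eq≤ (count-split (V j) (common (Λ j))) ⊕
        (lv (m j) ∸ lv (m⁰ j)) ⊛ lost≤ j ⊕
        h * count (V j ∖ common (Λ j)) ⊛ eq≥ (m+[n∸m]≡n (lv≥ j)))

    few-misses : sum (λ j → lv (m j)) ≤ count E
    few-misses = ≮⇒≥ λ lt → 1≰0 (linear (sum (λ j → h * n * lv (m j)) ∷ K ∷ n ∷ sum (λ j → lv (m j)) ∷
        sum (λ i → h * ∑∈ (V i) (λ y → count (E ∖ b y)) + (2 * n * (lv (m i) ∸ lv (m⁰ i)) +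
        (2 * h * e * (p * 2 ^ e) + h * e * w))) ∷ sum (λ i → h * ∑∈ (V i) (λ y → count (E ∖ b y))) ∷
        sum (λ j → ∑∈ (V j) (λ y → count (E ∖ b y))) ∷ sum (λ i → 2 * n * (lv (m i) ∸ lv (m⁰ i)) +
        (2 * h * e * (p * 2 ^ e) + h * e * w)) ∷ sum (λ i → 2 * n * (lv (m i) ∸ lv (m⁰ i))) ∷ sum (λ z →
        2 * h * e * (p * 2 ^ e) + h * e * w) ∷ sum (λ j → lv (m⁰ j)) ∷ sum (λ j → lv (m j) ∸ lv (m⁰ j)) ∷
        count E ∷ e ∷ w ∷ q″ ∷ p ∷ 2 ^ e ∷ [])
      (# 1 ⩽ # 0)
      (χ 0 ⊞ (# 2 ⊠ χ 1 ⊞ # 4) ⊠ χ 2 ⊠ χ 3 ⊞ χ 4 ⊞ χ 5 ⊞ (# 2 ⊠ χ 1 ⊞ # 4) ⊠ χ 6 ⊞ χ 7 ⊞ χ 8 ⊞ χ 9 ⊞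
        # 2 ⊠ χ 2 ⊠ (χ 10 ⊞ χ 11) ⊞ # 2 ⊠ χ 2 ⊠ (# 1 ⊞ χ 12) ⊞ (# 2 ⊠ χ 1 ⊞ # 2) ⊠ χ 2 ⊠ (# 1 ⊞ χ 12) ⊞
        ((# 2 ⊠ χ 1 ⊞ # 4) ⊠ χ 13 ⊠ χ 14 ⊞ (# 2 ⊞ χ 15) ⊠ (# 2 ⊠ (# 2 ⊠ χ 1 ⊞ # 4) ⊠ χ 13 ⊠ (χ 16 ⊠ χ 17) ⊞
        (# 2 ⊠ χ 1 ⊞ # 4) ⊠ χ 13 ⊠ χ 14)) ⊞ (# 2 ⊠ χ 1 ⊞ # 4) ⊠ χ 14 ⊠ χ 12 ⊞ # 12 ⊠ (# 1 ⊞ χ 14) ⩽ χ 4 ⊞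
        χ 0 ⊞ (χ 5 ⊞ χ 7) ⊞ (# 2 ⊠ χ 1 ⊞ # 4) ⊠ χ 6 ⊞ (# 2 ⊠ χ 1 ⊞ # 4) ⊠ (χ 12 ⊠ (χ 2 ⊞ χ 14)) ⊞ (χ 8 ⊞
        χ 9) ⊞ # 2 ⊠ χ 2 ⊠ χ 11 ⊞ (# 2 ⊞ χ 15) ⊠ (# 2 ⊠ (# 2 ⊠ χ 1 ⊞ # 4) ⊠ χ 13 ⊠ (χ 16 ⊠ χ 17) ⊞
        (# 2 ⊠ χ 1 ⊞ # 4) ⊠ χ 13 ⊠ χ 14) ⊞ # 2 ⊠ χ 2 ⊠ χ 3 ⊞ # 2 ⊠ χ 2 ⊠ (χ 10 ⊞ χ 1) ⊞ (# 2 ⊠ χ 1 ⊞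
        # 2) ⊠ χ 2 ⊠ χ 3 ⊞ χ 2 ⊞ (# 2 ⊠ χ 1 ⊞ # 4) ⊠ χ 14 ⊠ χ 13 ⊞ χ 2)
      (
        sum-mono {f = λ j → h * n * lv (m j)} weighted ⊕
        eq≥ (sum-scale (h * n) (λ j → lv (m j))) ⊕
        eq≤ (∑-distrib-+ (λ j → h * ∑∈ (V j) (λ y → count (E ∖ b y))) (λ j → 2 * n * (lv (m j) ∸ lv (m⁰ j)) +
          (2 * h * e * (p * 2 ^ e) + h * e * w))) ⊕
        eq≤ (sum-scale h (λ j → ∑∈ (V j) (λ y → count (E ∖ b y)))) ⊕ h ⊛ redsum-E ⊕
        eq≤ (∑-distrib-+ (λ j → 2 * n * (lv (m j) ∸ lv (m⁰ j))) (λ _ → 2 * h * e * (p * 2 ^ e) + h * e * w)) ⊕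
        eq≤ (sum-scale (2 * n) (λ j → lv (m j) ∸ lv (m⁰ j))) ⊕
        eq≤ (sum-const q (2 * h * e * (p * 2 ^ e) + h * e * w)) ⊕
        2 * n ⊛ Σlv ⊕ 2 * n ⊛ all-min ⊕ (2 * K + 2) * n ⊛ lt ⊕ hfin ⊕ h * w ⊛ cE′ ⊕ 12w<n))
      where
      cE′ : count E ≤ e
      cE′ = cE
      Σlv : sum (λ j → lv (m⁰ j)) + sum (λ j → lv (m j) ∸ lv (m⁰ j)) ≤ sum (λ j → lv (m j))
      Σlv = ≤-reflexive (trans (sym (∑-distrib-+ (λ j → lv (m⁰ j)) (λ j → lv (m j) ∸ lv (m⁰ j))))
          (sum-cong-≗ λ j → m+[n∸m]≡n (lv≥ j)))

    Fᴱ : Fin q → VSet N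
    Fᴱ = F E (λ j → x (m j))

    crowded : ∃ λ i → ρ < count (Near R i) + count (Fᴱ i)
    crowded = sum-pigeon (λ _ → ρ) (λ i → count (Near R i) + count (Fᴱ i))
      (linear (sum (λ z → ρ) ∷ sum (λ i → count (Near R i) + count (Fᴱ i)) ∷ q″ ∷ ρ ∷ N ∷ count E ∷ sum (λ i →
        count (Near R i)) ∷ sum (λ i → count (Fᴱ i)) ∷ [])
        (# 1 ⊞ χ 0 ⩽ χ 1)
        ((# 1 ⊞ (# 2 ⊞ χ 2) ⊠ χ 3) ⊞ χ 4 ⊞ χ 5 ⊞ χ 0 ⊞ χ 6 ⊞ χ 7 ⩽ χ 4 ⊞ (χ 6 ⊞ χ 5) ⊞ χ 7 ⊞ (# 2 ⊞
          χ 2) ⊠ χ 3 ⊞ χ 1)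
        (N≥ ⊕ covered ⊕ F≥ ⊕ eq≤ (sum-const q ρ) ⊕ eq≥ (∑-distrib-+ (λ i → count (Near R i)) (λ i →
          count (Fᴱ i)))))
      where
      covered : N ≤ sum (λ i → count (Near R i)) + count E
      covered = cover R
      F≥ : count E ≤ sum (λ i → count (Fᴱ i))
      F≥ = F-total E (λ j → x (m j)) (≤-trans (sum-mono λ j → x≤lv (m j)) few-misses)

    absurd : ⊥
    absurd with crowded
    ... | i , lt with bip (Near R i ∪ Fᴱ i) (≤-trans lt (count-⊎ (Near R i) (Fᴱ i) (λ r s → rest⁻ i (∖₁ s) r)))
    ...   | A₁ , A₂ , A₁⊆ , A₂⊆ , cA₁ , cA₂ , bl = noMulti
      (step A₁ (A₂ ∪ common (A₁ ∪ A₂)) (λ _ → ∈full) (≤-reflexive (sym cA₁)) (λ _ → ∈full)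
        (λ a∈ y∈ → [ bl a∈ , common⁻ (∪ˡ a∈) ]′ (∪⁻ y∈))
      (step A₂ (common (A₁ ∪ A₂)) ∪ˡ (≤-reflexive (sym cA₂)) ∪ʳ (λ a∈ y∈ → common⁻ (∪ʳ a∈) y∈)
      (select K (3 * w) ms (tabulate (λ k → X (m (punchIn i k)))) (common (A₁ ∪ A₂))
        (≤-reflexive (trans len (sym (length-tabulate (λ k → X (m (punchIn i k))))))) (All.tail (All.tail ms≤K))
        (AllPairsₚ.tabulate⁺ λ {k} {k′} ne y y∈ → ≤-trans (count-mono (∖-mono (λ r → ∩₁ (X⊆ (m _) r))))
          (V-low (punchIn i k) (punchIn i k′) (λ eq → ne (punchIn-injective i k k′ eq)) y (∩₁ (X⊆ (m _) y∈))))
        (Allₚ.tabulate⁺ room))))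
      where
      -- A vertex of `Fᴱ i` is blue to `x (m j)` and therefore to all of `X (m j)`; one between the
      -- thresholds is blue to all typical vertices; one within the finer threshold has few blue
      -- neighbours in `V i`, so `red-other` applies.
      sparse-red : ∀ k {y} → y ∈ A₁ ∪ A₂ → 8 * K * count (X (m (punchIn i k)) ∖ b y) ≤ 16 * K * w + p
      sparse-red k {y} y∈ with ∪⁻ ([ A₁⊆ , A₂⊆ ]′ (∪⁻ y∈))
      ... | inj₂ y∈F = ≤-trans (≤-reflexive (trans (cong (8 * K *_) (count-empty λ r → ∖₂ r
              (constant-blue (const (m (punchIn i k))) (x∈ (m _)) (∖₁ y∈F) (F⁻ E (λ j → x (m j)) i k y∈F)
                (∖₁ r)))) (*-zeroʳ (8 * K)))) z≤n
      ... | inj₁ y∈N with y ∈? Near R′ i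
      ...   | inj₂ y∉ = ≤-trans (≤-reflexive (trans (cong (8 * K *_) (count-empty λ r → ∖₂ r
              (common⁻ (Λ⁺ i (punchIn i k) (punchInᵢ≢i i k) (∖⁺ y∈N y∉)) (∩₂ (X⊆ (m (punchIn i k))
                (∖₁ r)))))) (*-zeroʳ (8 * K)))) z≤n
      ...   | inj₁ y∈′ = linear (K ∷ count (X (m (punchIn i k)) ∖ b y) ∷ w ∷ p ∷
          count (V (punchIn i k) ∖ b y) ∷ count (V i ∩ b y) ∷ [])
        (# 8 ⊠ χ 0 ⊠ χ 1 ⩽ # 16 ⊠ χ 0 ⊠ χ 2 ⊞ χ 3)
        (# 8 ⊠ χ 0 ⊠ χ 1 ⊞ # 8 ⊠ χ 0 ⊠ χ 4 ⊞ # 8 ⊠ χ 0 ⊠ χ 5 ⩽ # 8 ⊠ χ 0 ⊠ χ 4 ⊞ # 8 ⊠ χ 0 ⊠ (# 2 ⊠ χ 2 ⊞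
          χ 5) ⊞ χ 3)
        (8 * K ⊛ count-mono {A = X (m (punchIn i k)) ∖ b y} {V (punchIn i k) ∖ b y} (∖-mono (λ r →
            ∩₁ (X⊆ (m _) r))) ⊕
              8 * K ⊛ red-other y i (punchIn i k) (λ eq → punchInᵢ≢i i k (sym eq)) ⊕ hR′ (count (V i ∩ b y))
                (near⁻ y∈′))
      cA : count (A₁ ∪ A₂) ≤ 2 * K
      cA = linear (count (A₁ ∪ A₂) ∷ K ∷ count A₁ ∷ count A₂ ∷ m₁ ∷ m₂ ∷ []) (χ 0 ⩽ # 2 ⊠ χ 1)
        (χ 0 ⊞ χ 2 ⊞ χ 3 ⊞ χ 4 ⊞ χ 5 ⩽ (χ 2 ⊞ χ 3) ⊞ χ 4 ⊞ χ 5 ⊞ χ 1 ⊞ χ 1)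
        (count-∪ A₁ A₂ ⊕ eq≤ cA₁ ⊕ eq≤ cA₂ ⊕ All.head ms≤K ⊕ All.head (All.tail ms≤K))
      room : ∀ k → total ms * (3 * w) + K ≤ count (common (A₁ ∪ A₂) ∩ X (m (punchIn i k)))
      -- At most `2 * K` vertices each spoil at most `(16 * K * w + p) / (8 * K)` of the `p` or more
      -- vertices, altogether at most `4 * K * w + p / 4`.
      room k = *-cancelˡ-≤ 4 (linear (total ms ∷ w ∷ K ∷ count (common (A₁ ∪ A₂) ∩ X (m (punchIn i k))) ∷ p ∷
          count (X (m (punchIn i k))) ∷ ∑∈ (A₁ ∪ A₂) (λ y → count (X (m (punchIn i k)) ∖ b y)) ∷ m₂ ∷
          count (X (m (punchIn i k)) ∩ common (A₁ ∪ A₂)) ∷ [])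
        (# 4 ⊠ (χ 0 ⊠ (# 3 ⊠ χ 1) ⊞ χ 2) ⩽ # 4 ⊠ χ 3)
        (# 2 ⊠ (χ 2 ⊠ (# 7 ⊠ χ 1) ⊞ χ 2) ⊞ # 2 ⊠ (χ 2 ⊠ (# 7 ⊠ χ 1) ⊞ χ 2) ⊞ χ 4 ⊞ χ 4 ⊞ χ 4 ⊞ χ 4 ⊞
          # 4 ⊠ χ 5 ⊞ # 4 ⊠ χ 6 ⊞ # 12 ⊠ χ 1 ⊠ (χ 7 ⊞ χ 0) ⊞ # 4 ⊠ χ 8 ⩽ χ 4 ⊞ χ 4 ⊞ χ 5 ⊞ χ 5 ⊞ χ 5 ⊞ χ 5 ⊞
          # 4 ⊠ (χ 8 ⊞ χ 6) ⊞ (# 16 ⊠ χ 2 ⊠ χ 1 ⊞ χ 4) ⊞ # 12 ⊠ χ 1 ⊠ χ 2 ⊞ # 4 ⊠ χ 3)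
        (hp ⊕ hp ⊕ cX (m (punchIn i k)) ⊕ cX (m (punchIn i k)) ⊕ cX (m (punchIn i k)) ⊕ cX (m (punchIn i k)) ⊕
          4 ⊛ common-loss-∑ (A₁ ∪ A₂) (X (m (punchIn i k))) ⊕ total-red ⊕
          12 * w ⊛ tot ⊕ 4 ⊛ count-mono {A = X (m (punchIn i k)) ∩ common (A₁ ∪ A₂)} {common (A₁ ∪ A₂) ∩ X (m (punchIn i k))} (λ r → ∩⁺ (∩₂ r) (∩₁ r))))
        where
        total-red : 4 * ∑∈ (A₁ ∪ A₂) (λ y → count (X (m (punchIn i k)) ∖ b y)) ≤ 16 * K * w + p
        total-red = *-cancelˡ-≤ K {{>-nonZero 1≤K}} (*-cancelˡ-≤ 2 (linear (K ∷ ∑∈ (A₁ ∪ A₂) (λ y →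
            count (X (m (punchIn i k)) ∖ b y)) ∷ w ∷ p ∷ ∑∈ (A₁ ∪ A₂) (λ y →
            8 * K * count (X (m (punchIn i k)) ∖ b y)) ∷ count (A₁ ∪ A₂) ∷ [])
          (# 2 ⊠ (χ 0 ⊠ (# 4 ⊠ χ 1)) ⩽ # 2 ⊠ (χ 0 ⊠ (# 16 ⊠ χ 0 ⊠ χ 2 ⊞ χ 3)))
          (# 8 ⊠ χ 0 ⊠ χ 1 ⊞ χ 4 ⊞ (# 16 ⊠ χ 0 ⊠ χ 2 ⊞ χ 3) ⊠ χ 5 ⩽ χ 4 ⊞ χ 5 ⊠ (# 16 ⊠ χ 0 ⊠ χ 2 ⊞ χ 3) ⊞
            (# 16 ⊠ χ 0 ⊠ χ 2 ⊞ χ 3) ⊠ (# 2 ⊠ χ 0))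
          (
          eq≥ (∑∈-scale (A₁ ∪ A₂) (8 * K) (λ y → count (X (m (punchIn i k)) ∖ b y))) ⊕
          ∑∈-≤ (A₁ ∪ A₂) (λ y → 8 * K * count (X (m (punchIn i k)) ∖ b y)) (16 * K * w + p) (sparse-red k) ⊕
          (16 * K * w + p) ⊛ cA)))

quotient : ∀ n d → 1 ≤ d → ∃ λ p → p * d ≤ n × n < suc p * d
quotient n (suc d) _ = n / suc d , m/n*n≤m n (suc d)
  , ≤-trans (s≤s (≤-reflexive (m≡m%n+[m/n]*n n (suc d)))) (+-monoˡ-≤ (n / suc d * suc d) (m%n<n n (suc d)))

-- The sequence of thresholds

module Thresholds (q″ K : ℕ) (1≤K : 1 ≤ K) where

  private
    q h : ℕ
    q = 2 + q″
    h = 2 * K + 4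

  ex : ℕ → ℕ
  ex r = eSize r q K

  opaque
    -- The host size `p` will be `n / den r`; the factors of `den` are the bounded quantities by
    -- which the hypotheses of the earlier lemmas multiply `p`.
    den : ℕ → ℕ
    den r = 4 * h * q * (1 + ex r) * (1 + r) * (1 + 2 ^ ex r)

    den-def : ∀ r → den r ≡ 4 * h * q * (1 + ex r) * (1 + r) * (1 + 2 ^ ex r)
    den-def r = refl

    -- Each threshold is chosen after the host size `p` of its predecessor, so that `n / R (suc t)`
    -- blue neighbours are at most `p / (8 * K)`; see `next`.
    R : ℕ → ℕ
    R zero    = 4 * K
    R (suc t) = 8 * K * den (R t)

    R-zero : R zero ≡ 4 * K
    R-zero = refl

    R-suc : ∀ t → R (suc t) ≡ 8 * K * den (R t)
    R-suc t = refl

  ex≥ : ∀ r k → 1 ≤ r → k ≤ q → eSize r k K ≤ ex r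
  ex≥ r k 1≤r k≤ = mono (≤⇒≤′ k≤)
    where
    mono : ∀ {j} → k ≤′ j → eSize r k K ≤ eSize r j K
    mono ≤′-refl     = ≤-refl
    mono (≤′-step p) = ≤-trans (mono p) (eSize-mono r _ K 1≤r)

  1≤den : ∀ r → 1 ≤ den r
  1≤den r = linear (den r ∷ K ∷ q″ ∷ ex r ∷ r ∷ 2 ^ ex r ∷ []) (# 1 ⩽ χ 0)
    (# 4 ⊠ ((χ 1 ⊞ # 1 ⊠ χ 1) ⊞ # 4) ⊠ (# 1 ⊞ # 1 ⊞ χ 2) ⊠ (# 1 ⊞ χ 3) ⊠ (# 1 ⊞ χ 4) ⊠ (# 1 ⊞ χ 5) ⩽ χ 0)
    (eq≥ (den-def r))

  R≤ : ∀ t → R t ≤ R (suc t)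
  R≤ t = linear (R t ∷ R (suc t) ∷ K ∷ den (R t) ∷ q″ ∷ ex (R t) ∷ 2 ^ ex (R t) ∷ []) (χ 0 ⩽ χ 1)
    (# 8 ⊠ χ 2 ⊠ χ 3 ⊞ # 8 ⊠ χ 2 ⊠ (# 4 ⊠ ((χ 2 ⊞ # 1 ⊠ χ 2) ⊞ # 4) ⊠ (# 1 ⊞ # 1 ⊞ χ 4) ⊠ (# 1 ⊞ χ 5) ⊠ (# 1 ⊞
      χ 0) ⊠ (# 1 ⊞ χ 6)) ⊞ χ 0 ⊠ # 1 ⩽ χ 1 ⊞ # 8 ⊠ χ 2 ⊠ χ 3 ⊞ χ 0 ⊠ χ 2)
    (eq≥ (R-suc t) ⊕ (8 * K) ⊛ eq≥ (den-def (R t)) ⊕ R t ⊛ 1≤K)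

  4K≤R : ∀ t → 4 * K ≤ R t
  4K≤R zero    = ≤-reflexive (sym R-zero)
  4K≤R (suc t) = ≤-trans (4K≤R t) (R≤ t)

  4≤R : ∀ t → 4 ≤ R t
  4≤R t = linear (R t ∷ K ∷ []) (# 4 ⩽ χ 0) (# 4 ⊠ # 1 ⊞ # 4 ⊠ χ 1 ⩽ # 4 ⊠ χ 1 ⊞ χ 0)
    (4 ⊛ 1≤K ⊕ 4K≤R t)

  need : ℕ → ℕ
  need t = 16 * K * den (R t) + 2 * (1 + q) * h * ex (R t) + h * (suc q″ * (ex (R (suc t)) * 2)) + 24 * K + 24

  needs : ℕ → ℕ
  needs zero    = need zero
  needs (suc t) = need (suc t) + needs t

  need≤ : ∀ {t τ} → t ≤′ τ → need t ≤ needs τ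
  need≤ {zero}  ≤′-refl     = ≤-refl
  need≤ {suc t} ≤′-refl     = m≤m+n (need (suc t)) (needs t)
  need≤ {t} (≤′-step {τ} p) = ≤-trans (need≤ p) (m≤n+m (needs τ) (need (suc τ)))

  -- All layers together have mass at most `q * (2 * K + 1) * n`, so among this many layers one has
  -- mass at most `n / h`.
  depth : ℕ
  depth = suc (h * (q * (2 * K + 1)))

  module Quotients (n w : ℕ) (1≤w : 1 ≤ w) (large : needs depth * w ≤ n) where

    p : ℕ → ℕ
    p t = proj₁ (quotient n (den (R t)) (1≤den (R t)))

    p≤ : ∀ t → p t * den (R t) ≤ n
    p≤ t = proj₁ (proj₂ (quotient n (den (R t)) (1≤den (R t))))

    p> : ∀ t → n < suc (p t) * den (R t)
    p> t = proj₂ (proj₂ (quotient n (den (R t)) (1≤den (R t))))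

    module _ {t} (t≤ : t ≤ depth) where

      wide : need t * w ≤ n
      wide = ≤-trans (*-monoˡ-≤ w (need≤ (≤⇒≤′ t≤))) large

      16Kw≤p : 16 * K * w ≤ p t
      16Kw≤p = ≤-pred (*-cancelʳ-< (den (R t)) (16 * K * w) (suc (p t)) (≤-trans (s≤s {n = n} (linear (K ∷ w ∷
          den (R t) ∷ n ∷ q″ ∷ ex (R t) ∷ ex (R (suc t)) ∷ [])
        ((χ 0 ⊞ # 15 ⊠ χ 0) ⊠ χ 1 ⊠ χ 2 ⩽ χ 3)
        ((((((χ 0 ⊞ # 15 ⊠ χ 0) ⊠ χ 2 ⊞ # 2 ⊠ (# 1 ⊞ # 1 ⊞ # 1 ⊞ χ 4) ⊠ ((χ 0 ⊞ # 1 ⊠ χ 0) ⊞ # 4) ⊠ χ 5) ⊞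
          ((χ 0 ⊞ # 1 ⊠ χ 0) ⊞ # 4) ⊠ ((# 1 ⊞ χ 4) ⊠ (χ 6 ⊠ # 2))) ⊞ # 24 ⊠ χ 0) ⊞ # 24) ⊠ χ 1 ⩽ χ 3)
        wide)) (p> t)))

      host : 2 * (K * (7 * w) + K) ≤ p t
      host = linear (K ∷ w ∷ p t ∷ []) (# 2 ⊠ (χ 0 ⊠ (# 7 ⊠ χ 1) ⊞ χ 0) ⩽ χ 2)
        (# 16 ⊠ χ 0 ⊠ χ 1 ⊞ # 2 ⊠ χ 0 ⊠ # 1 ⩽ χ 2 ⊞ # 2 ⊠ χ 0 ⊠ χ 1) (16Kw≤p ⊕ (2 * K) ⊛ 1≤w)

      host′ : K * (3 * w) + K ≤ p t
      host′ = linear (K ∷ w ∷ p t ∷ []) (χ 0 ⊠ (# 3 ⊠ χ 1) ⊞ χ 0 ⩽ χ 2)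
        (# 16 ⊠ χ 0 ⊠ χ 1 ⊞ χ 0 ⊠ # 1 ⩽ χ 2 ⊞ χ 0 ⊠ χ 1) (16Kw≤p ⊕ K ⊛ 1≤w)

      small : ∀ k → k ≤ q → 2 * R t * (p t * 2 ^ eSize (R t) k K) ≤ n
      small k k≤ = ≤-trans {j = 2 * R t * (p t * 2 ^ ex (R t))} (*-monoʳ-≤ (2 * R t) (*-monoʳ-≤ (p t)
          (^-monoʳ-≤ 2 (ex≥ (R t) k (≤-trans (s≤s z≤n) (4≤R t)) k≤))))
        (linear (R t ∷ p t ∷ 2 ^ ex (R t) ∷ n ∷ den (R t) ∷ K ∷ q″ ∷ ex (R t) ∷ [])
          (# 2 ⊠ χ 0 ⊠ (χ 1 ⊠ χ 2) ⩽ χ 3)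
          (χ 1 ⊠ χ 4 ⊞ χ 1 ⊠ (# 4 ⊠ ((χ 5 ⊞ # 1 ⊠ χ 5) ⊞ # 4) ⊠ (# 1 ⊞ # 1 ⊞ χ 6) ⊠ (# 1 ⊞ χ 7) ⊠ (# 1 ⊞
            χ 0) ⊠ (# 1 ⊞ χ 2)) ⩽ χ 3 ⊞ χ 1 ⊠ χ 4)
          (p≤ t ⊕ (p t) ⊛ eq≥ (den-def (R t))))

      4p≤n : 4 * p t ≤ n
      4p≤n = linear (p t ∷ n ∷ den (R t) ∷ K ∷ q″ ∷ ex (R t) ∷ R t ∷ 2 ^ ex (R t) ∷ []) (# 4 ⊠ χ 0 ⩽ χ 1)
        (χ 0 ⊠ χ 2 ⊞ χ 0 ⊠ (# 4 ⊠ ((χ 3 ⊞ # 1 ⊠ χ 3) ⊞ # 4) ⊠ (# 1 ⊞ # 1 ⊞ χ 4) ⊠ (# 1 ⊞ χ 5) ⊠ (# 1 ⊞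
          χ 6) ⊠ (# 1 ⊞ χ 7)) ⩽ χ 1 ⊞ χ 0 ⊠ χ 2)
        (p≤ t ⊕ (p t) ⊛ eq≥ (den-def (R t)))

      ep≤n : ex (R t) * (p t * 2 ^ ex (R t)) ≤ n
      ep≤n = linear (ex (R t) ∷ p t ∷ 2 ^ ex (R t) ∷ n ∷ den (R t) ∷ K ∷ q″ ∷ R t ∷ [])
        (χ 0 ⊠ (χ 1 ⊠ χ 2) ⩽ χ 3)
        (χ 1 ⊠ χ 4 ⊞ χ 1 ⊠ (# 4 ⊠ ((χ 5 ⊞ # 1 ⊠ χ 5) ⊞ # 4) ⊠ (# 1 ⊞ # 1 ⊞ χ 6) ⊠ (# 1 ⊞ χ 0) ⊠ (# 1 ⊞
          χ 7) ⊠ (# 1 ⊞ χ 2)) ⩽ χ 3 ⊞ χ 1 ⊠ χ 4)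
        (p≤ t ⊕ (p t) ⊛ eq≥ (den-def (R t)))

      4P≤n : 4 * (p t * 2 ^ ex (R t)) ≤ n
      4P≤n = linear (p t ∷ 2 ^ ex (R t) ∷ n ∷ den (R t) ∷ K ∷ q″ ∷ ex (R t) ∷ R t ∷ [])
        (# 4 ⊠ (χ 0 ⊠ χ 1) ⩽ χ 2)
        (χ 0 ⊠ χ 3 ⊞ χ 0 ⊠ (# 4 ⊠ ((χ 4 ⊞ # 1 ⊠ χ 4) ⊞ # 4) ⊠ (# 1 ⊞ # 1 ⊞ χ 5) ⊠ (# 1 ⊞ χ 6) ⊠ (# 1 ⊞
          χ 7) ⊠ (# 1 ⊞ χ 1)) ⩽ χ 2 ⊞ χ 0 ⊠ χ 3)
        (p≤ t ⊕ (p t) ⊛ eq≥ (den-def (R t)))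

      loss≤n : h * (suc q″ * (ex (R (suc t)) * (2 * w))) ≤ n
      loss≤n = linear (K ∷ q″ ∷ ex (R (suc t)) ∷ w ∷ n ∷ den (R t) ∷ ex (R t) ∷ [])
        (((χ 0 ⊞ # 1 ⊠ χ 0) ⊞ # 4) ⊠ ((# 1 ⊞ χ 1) ⊠ (χ 2 ⊠ (# 2 ⊠ χ 3))) ⩽ χ 4)
        ((((((χ 0 ⊞ # 15 ⊠ χ 0) ⊠ χ 5 ⊞ # 2 ⊠ (# 1 ⊞ # 1 ⊞ # 1 ⊞ χ 1) ⊠ ((χ 0 ⊞ # 1 ⊠ χ 0) ⊞ # 4) ⊠ χ 6) ⊞
          ((χ 0 ⊞ # 1 ⊠ χ 0) ⊞ # 4) ⊠ ((# 1 ⊞ χ 1) ⊠ (χ 2 ⊠ # 2))) ⊞ # 24 ⊠ χ 0) ⊞ # 24) ⊠ χ 3 ⩽ χ 4)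
        wide

      final≤n : h * ex (R t) * w + q * (2 * h * ex (R t) * (p t * 2 ^ ex (R t)) + h * ex (R t) * w) ≤ n
      final≤n = *-cancelˡ-≤ 2 (linear (K ∷ ex (R t) ∷ w ∷ q″ ∷ p t ∷ 2 ^ ex (R t) ∷ n ∷ den (R t) ∷ R t ∷
          ex (R (suc t)) ∷ [])
        (# 2 ⊠ (((χ 0 ⊞ # 1 ⊠ χ 0) ⊞ # 4) ⊠ χ 1 ⊠ χ 2 ⊞ (# 1 ⊞ # 1 ⊞ χ 3) ⊠ (# 2 ⊠ ((χ 0 ⊞ # 1 ⊠ χ 0) ⊞
          # 4) ⊠ χ 1 ⊠ (χ 4 ⊠ χ 5) ⊞ ((χ 0 ⊞ # 1 ⊠ χ 0) ⊞ # 4) ⊠ χ 1 ⊠ χ 2)) ⩽ # 2 ⊠ χ 6)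
        (χ 4 ⊠ χ 7 ⊞ χ 4 ⊠ (# 4 ⊠ ((χ 0 ⊞ # 1 ⊠ χ 0) ⊞ # 4) ⊠ (# 1 ⊞ # 1 ⊞ χ 3) ⊠ (# 1 ⊞ χ 1) ⊠ (# 1 ⊞
          χ 8) ⊠ (# 1 ⊞ χ 5)) ⊞ (((((χ 0 ⊞ # 15 ⊠ χ 0) ⊠ χ 7 ⊞ # 2 ⊠ (# 1 ⊞ # 1 ⊞ # 1 ⊞ χ 3) ⊠ ((χ 0 ⊞
          # 1 ⊠ χ 0) ⊞ # 4) ⊠ χ 1) ⊞ ((χ 0 ⊞ # 1 ⊠ χ 0) ⊞ # 4) ⊠ ((# 1 ⊞ χ 3) ⊠ (χ 9 ⊠ # 2))) ⊞ # 24 ⊠ χ 0) ⊞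
          # 24) ⊠ χ 2 ⩽ χ 6 ⊞ χ 4 ⊠ χ 7 ⊞ χ 6)
        (p≤ t ⊕ (p t) ⊛ eq≥ (den-def (R t)) ⊕ wide))

      next : ∀ c → R (suc t) * c ≤ n → 8 * K * c ≤ p t
      next c hc = ≤-pred (*-cancelʳ-< (den (R t)) (8 * K * c) (suc (p t))
        (≤-trans (s≤s {n = n} (linear (K ∷ c ∷ den (R t) ∷ n ∷ R (suc t) ∷ [])
          ((χ 0 ⊞ # 7 ⊠ χ 0) ⊠ χ 1 ⊠ χ 2 ⩽ χ 3) (χ 4 ⊠ χ 1 ⊞ χ 1 ⊠ (# 8 ⊠ χ 0 ⊠ χ 2) ⩽ χ 3 ⊞ χ 1 ⊠ χ 4)
          (hc ⊕ c ⊛ eq≥ (R-suc t)))) (p> t)))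

    12w<n : 12 * suc w ≤ n
    12w<n = linear (w ∷ n ∷ K ∷ den (R zero) ∷ q″ ∷ ex (R zero) ∷ ex (R 1) ∷ [])
      (# 12 ⊠ (# 1 ⊞ χ 0) ⩽ χ 1)
      ((((((χ 2 ⊞ # 15 ⊠ χ 2) ⊠ χ 3 ⊞ # 2 ⊠ (# 1 ⊞ # 1 ⊞ # 1 ⊞ χ 4) ⊠ ((χ 2 ⊞ # 1 ⊠ χ 2) ⊞ # 4) ⊠ χ 5) ⊞
        ((χ 2 ⊞ # 1 ⊠ χ 2) ⊞ # 4) ⊠ ((# 1 ⊞ χ 4) ⊠ (χ 6 ⊠ # 2))) ⊞ # 24 ⊠ χ 2) ⊞ # 24) ⊠ χ 0 ⊞ # 12 ⊠ # 1 ⩽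
        χ 1 ⊞ # 12 ⊠ χ 0)
      (wide z≤n ⊕ 12 ⊛ 1≤w)

    24Kw≤n : 24 * K * w ≤ n
    24Kw≤n = linear (K ∷ w ∷ n ∷ den (R zero) ∷ q″ ∷ ex (R zero) ∷ ex (R 1) ∷ [])
      (# 24 ⊠ χ 0 ⊠ χ 1 ⩽ χ 2)
      ((((((χ 0 ⊞ # 15 ⊠ χ 0) ⊠ χ 3 ⊞ # 2 ⊠ (# 1 ⊞ # 1 ⊞ # 1 ⊞ χ 4) ⊠ ((χ 0 ⊞ # 1 ⊠ χ 0) ⊞ # 4) ⊠ χ 5) ⊞
        ((χ 0 ⊞ # 1 ⊠ χ 0) ⊞ # 4) ⊠ ((# 1 ⊞ χ 4) ⊠ (χ 6 ⊠ # 2))) ⊞ # 24 ⊠ χ 0) ⊞ # 24) ⊠ χ 1 ⩽ χ 2)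
      (wide z≤n)

no-skeleton : ∀ {N} (G : BlueGraph N) m₁ m₂ ms q″ K (len : length ms ≡ suc q″) (ms≤K : All (_≤ K) (m₁ ∷ m₂ ∷
    ms))
  (tot : m₂ + total ms ≤ K) (noMulti : ¬ Multipartite.Multi G (m₁ ∷ m₂ ∷ ms) full) (1≤K : 1 ≤ K) n w →
  Skeleton G (2 + q″) n w → 1 ≤ w → Thresholds.needs q″ K 1≤K (Thresholds.depth q″ K 1≤K) * w ≤ n →
  ∀ ρ → suc ((2 + q″) * ρ) ≤ N →
  (∀ U → suc ρ ≤ count U → ∃₂ λ A₁ A₂ → A₁ ⊆ U × A₂ ⊆ U × count A₁ ≡ m₁ × count A₂ ≡ m₂ ×
    (∀ {x y} → x ∈ A₁ → y ∈ A₂ → y ∈ BlueGraph.b G x)) → ⊥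
no-skeleton G m₁ m₂ ms q″ K len ms≤K tot noMulti 1≤K n w Sk 1≤w large ρ N≥ bip = at-level
    (light-level h depth (ex (R depth)) (p depth) ≤-refl
      (λ i → layer-size (R zero) (R depth) (p depth) i (4K≤R zero) (4≤R depth) (host′ ≤-refl) (small ≤-refl))
      (host′ ≤-refl) (4p≤n ≤-refl) (ep≤n ≤-refl) 24Kw≤n)
  where
  open Thresholds q″ K 1≤K
  open Quotients n w 1≤w large
  open Assignment G m₁ m₂ ms q″ K len ms≤K tot noMulti 1≤K n w Sk 12w<n
  open Select R R-zero R≤
  at-level : (∃ λ t → t < depth × h * ν t ≤ n) → ⊥
  at-level (t , t< , light) = Level.absurd (R t) (R (suc t)) (ex (R t)) (ex (R (suc t))) (p t) ρ (4K≤R t)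
    (≤-trans (≤-reflexive (cong (h *_) (sym (ν-def t)))) light)
    (λ i → layer-size (R t) (R (suc t)) (p (suc t)) i (4K≤R t) (4≤R (suc t)) (host′ t<) (small t<))
    (rest-size (R t) (p t) (≤-trans (s≤s z≤n) (4≤R t)) (host′ (<⇒≤ t<)) (small (<⇒≤ t<)))
    (host (<⇒≤ t<)) (4P≤n (<⇒≤ t<)) (loss≤n (<⇒≤ t<)) (final≤n (<⇒≤ t<)) (next (<⇒≤ t<)) N≥ bip

-- Choice of the constants

module Core (m₁ m₂ m₃ : ℕ) (ms′ : List ℕ) (q″ : ℕ) (len : length ms′ ≡ q″) (1≤m₁ : 1 ≤ m₁) where

  ms : List ℕ
  ms = m₃ ∷ ms′

  q : ℕ
  q = 2 + q″

  opaque
    -- The order of the forbidden blue graph, which is contained in any blue clique of this size.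
    K : ℕ
    K = total (m₁ ∷ m₂ ∷ ms)

    K-def : K ≡ total (m₁ ∷ m₂ ∷ ms)
    K-def = refl

  1≤K : 1 ≤ K
  1≤K = ≤-trans (≤-trans 1≤m₁ (m≤m+n m₁ (total (m₂ ∷ ms)))) (≤-reflexive (sym K-def))

  parts≤ : ∀ xs → All (_≤ total xs) xs
  parts≤ []       = []
  parts≤ (x ∷ xs) = m≤m+n x (total xs) ∷ All.map (λ h → ≤-trans h (m≤n+m (total xs) x)) (parts≤ xs)

  ms≤K : All (_≤ K) (m₁ ∷ m₂ ∷ ms)
  ms≤K = subst (λ k → All (_≤ k) (m₁ ∷ m₂ ∷ ms)) (sym K-def) (parts≤ (m₁ ∷ m₂ ∷ ms))

  tot : m₂ + total ms ≤ K
  tot = ≤-trans (m≤n+m (total (m₂ ∷ ms)) m₁) (≤-reflexive (sym K-def))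

  opaque
    -- Errors are measured in the unit `u = S * x`, about `n / Λ`: the hub sets miss `a₁ * u`
    -- vertices, `a₂ * u` is the bound `Δ`, the trimmed classes miss `a₃ * u`, their branches are
    -- balanced at `a₄ * u`, and `a₅ * u` is the final `w`. None of these factors depends on `Λ`,
    -- which is then large enough for `Λ₀ * w ≤ n`.
    Λ₀ a₁ a₂ a₃ a₄ a₅ Λ : ℕ
    Λ₀ = Thresholds.needs q″ K 1≤K (Thresholds.depth q″ K 1≤K)
    a₁ = q * suc K + 2
    a₂ = a₁ + 1 + K * (a₁ + K)
    a₃ = a₁ + suc q″ * K * a₂ + 1
    a₄ = a₃ + 3
    a₅ = K * a₄ + a₃ + 1
    Λ = Λ₀ * a₅ + 2 * a₄ + 2 * (a₁ + K) + 1

    Λ₀-def : Λ₀ ≡ Thresholds.needs q″ K 1≤K (Thresholds.depth q″ K 1≤K)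
    Λ₀-def = refl

    a₁-def : a₁ ≡ q * suc K + 2
    a₁-def = refl

    a₂-def : a₂ ≡ a₁ + 1 + K * (a₁ + K)
    a₂-def = refl

    a₃-def : a₃ ≡ a₁ + suc q″ * K * a₂ + 1
    a₃-def = refl

    a₄-def : a₄ ≡ a₃ + 3
    a₄-def = refl

    a₅-def : a₅ ≡ K * a₄ + a₃ + 1
    a₅-def = refl

    Λ-def : Λ ≡ Λ₀ * a₅ + 2 * a₄ + 2 * (a₁ + K) + 1
    Λ-def = refl

  opaque
    -- `S` exceeds `Λ`, since `n ≤ (Λ + 1) * u`, and is at least `K`, the size of a core. `B` turns
    -- the linear bound on `N` into `N ≤ B * x`, and `c` exceeds `K * B`, so that `c * u` beats the
    -- main term in the use of `kst`.
    S B c : ℕ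
    S = suc Λ + K
    B = q * (K * (suc Λ * S))
    c = suc (K * B)

    S-def : S ≡ suc Λ + K
    S-def = refl

    B-def : B ≡ q * (K * (suc Λ * S))
    B-def = refl

    c-def : c ≡ suc (K * B)
    c-def = refl

  L : ℕ → ℕ
  L zero    = K
  L (suc m) = suc (L m * B) + 2 ^ (S + K)

  1≤L : ∀ m → 1 ≤ L m
  1≤L zero    = 1≤K
  1≤L (suc m) = s≤s z≤n

  opaque
    -- `x` has to dominate all constants that do not grow with `n`.
    X₀ : ℕ
    X₀ = Λ + crowds L q 0 + q + suc (c * (K * 2 ^ c)) + c

    X₀-def : X₀ ≡ Λ + crowds L q 0 + q + suc (c * (K * 2 ^ c)) + c
    X₀-def = refl

  1≤ΛS : 1 ≤ Λ * S
  1≤ΛS = *-mono-≤ {1} {Λ} {1} {S} (linear (Λ ∷ Λ₀ ∷ a₅ ∷ a₄ ∷ a₁ ∷ K ∷ []) (# 1 ⩽ χ 0)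
    (((χ 1 ⊠ χ 2 ⊞ # 2 ⊠ χ 3) ⊞ # 2 ⊠ (χ 4 ⊞ χ 5)) ⊞ # 1 ⩽ χ 0) (eq≥ Λ-def)) (linear (S ∷ Λ ∷ K ∷ [])
      (# 1 ⩽ χ 0) ((# 1 ⊞ χ 1) ⊞ χ 2 ⩽ χ 0) (eq≥ S-def))

  threshold : ℕ
  threshold = X₀ * (Λ * S)

  module _ {N} (G : BlueGraph N) (f₀ : Forest) (n≥ : threshold ≤ suc (size f₀)) (ρ : ℕ) (n≤r : size f₀ ≤ ρ)
    (N≤ : N ≤ q * (K * suc (size f₀))) (N≥ : suc (q * ρ) ≤ N) (noTree : ¬ Embedding.Rooted G f₀)
    (noMulti : ¬ Multipartite.Multi G (m₁ ∷ m₂ ∷ ms) full)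
    (bip : ∀ U → suc ρ ≤ count U → ∃₂ λ A₁ A₂ → A₁ ⊆ U × A₂ ⊆ U × count A₁ ≡ m₁ × count A₂ ≡ m₂ ×
      (∀ {x y} → x ∈ A₁ → y ∈ A₂ → y ∈ BlueGraph.b G x)) where

    private
      n : ℕ
      n = suc (size f₀)

    noClique : ¬ Embedding.Clique G K full
    noClique cl = noMulti (Multipartite.clique⇒multi G (m₁ ∷ m₂ ∷ ms) full (subst (λ k →
        Embedding.Clique G k full) K-def cl))

    impossible : ∀ x → x * (Λ * S) ≤ n → n < suc x * (Λ * S) → ⊥
    impossible x x≤ x> = no-skeleton G m₁ m₂ ms q″ K (cong suc len) ms≤K tot noMulti 1≤K n (a₅ * (S * x)) skeleton
        (*-mono-≤ {1} {a₅} {1} {S * x} (linear (a₅ ∷ K ∷ a₄ ∷ a₃ ∷ []) (# 1 ⩽ χ 0)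
          ((χ 1 ⊠ χ 2 ⊞ χ 3) ⊞ # 1 ⩽ χ 0) (eq≥ a₅-def)) 1≤u) (subst (λ k →
            k * (a₅ * (S * x)) ≤ n) Λ₀-def (linear (Λ₀ ∷ a₅ ∷ S ∷ x ∷ size f₀ ∷ Λ ∷ a₄ ∷ a₁ ∷ K ∷ [])
            (χ 0 ⊠ (χ 1 ⊠ (χ 2 ⊠ χ 3)) ⩽ # 1 ⊞ χ 4)
            (χ 5 ⊠ (χ 2 ⊠ χ 3) ⊞ χ 2 ⊠ χ 3 ⊠ (((χ 0 ⊠ χ 1 ⊞ # 2 ⊠ χ 6) ⊞ # 2 ⊠ (χ 7 ⊞ χ 8)) ⊞ # 1) ⩽ (# 1 ⊞
              χ 4) ⊞ χ 2 ⊠ χ 3 ⊠ χ 5)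
            (Λu≤n ⊕ (S * x) ⊛ eq≥ Λ-def))) ρ N≥ bip
      where
      X₀≤x : X₀ ≤ x
      X₀≤x = ≤-pred (*-cancelʳ-< (Λ * S) X₀ (suc x) (≤-trans (s≤s n≥) x>))
      Λ≤x : Λ ≤ x
      Λ≤x = linear (Λ ∷ x ∷ X₀ ∷ B ∷ L q″ ∷ 2 ^ (S + K) ∷ 2 ^ (B + (L q″ * B + 2 ^ (S + K)) * B + 2 ^ (S +
          K)) ∷ crowds L q″ 2 ∷ q″ ∷ c ∷ K ∷ 2 ^ c ∷ [])
        (χ 0 ⩽ χ 1)
        (χ 2 ⊞ (((χ 0 ⊞ # 1 ⊞ ((χ 3 ⊞ (χ 4 ⊠ χ 3 ⊞ χ 5) ⊠ χ 3) ⊞ χ 5) ⊠ # 1 ⊞ ((χ 6 ⊞ # 1 ⊠ χ 6) ⊠ # 1 ⊞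
          (χ 4 ⊠ χ 3 ⊞ χ 5) ⊠ ((χ 6 ⊞ # 1 ⊠ χ 6) ⊠ # 1)) ⊞ χ 7) ⊞ # 1 ⊞ # 1 ⊞ χ 8) ⊞ # 1 ⊞
          χ 9 ⊠ (χ 10 ⊠ χ 11)) ⊞ χ 9 ⩽ χ 1 ⊞ χ 2)
        (X₀≤x ⊕ eq≥ X₀-def)
      1≤S : 1 ≤ S
      1≤S = linear (S ∷ Λ ∷ K ∷ []) (# 1 ⩽ χ 0) ((# 1 ⊞ χ 1) ⊞ χ 2 ⩽ χ 0)
        (eq≥ S-def)
      1≤x : 1 ≤ x
      1≤x = linear (x ∷ X₀ ∷ Λ ∷ B ∷ L q″ ∷ 2 ^ (S + K) ∷ 2 ^ (B + (L q″ * B + 2 ^ (S + K)) * B + 2 ^ (S +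
          K)) ∷ crowds L q″ 2 ∷ q″ ∷ c ∷ K ∷ 2 ^ c ∷ [])
        (# 1 ⩽ χ 0)
        (χ 1 ⊞ (((χ 2 ⊞ # 1 ⊞ ((χ 3 ⊞ (χ 4 ⊠ χ 3 ⊞ χ 5) ⊠ χ 3) ⊞ χ 5) ⊠ # 1 ⊞ ((χ 6 ⊞ # 1 ⊠ χ 6) ⊠ # 1 ⊞
          (χ 4 ⊠ χ 3 ⊞ χ 5) ⊠ ((χ 6 ⊞ # 1 ⊠ χ 6) ⊠ # 1)) ⊞ χ 7) ⊞ # 1 ⊞ # 1 ⊞ χ 8) ⊞ # 1 ⊞
          χ 9 ⊠ (χ 10 ⊠ χ 11)) ⊞ χ 9 ⩽ χ 0 ⊞ χ 1)
        (X₀≤x ⊕ eq≥ X₀-def)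
      x≤u : x ≤ S * x
      x≤u = linear (x ∷ S ∷ []) (χ 0 ⩽ χ 1 ⊠ χ 0) (χ 0 ⊠ # 1 ⩽ χ 0 ⊠ χ 1)
        (x ⊛ 1≤S)
      1≤u : 1 ≤ S * x
      1≤u = ≤-trans 1≤x x≤u
      Λu≤n : Λ * (S * x) ≤ n
      Λu≤n = linear (Λ ∷ S ∷ x ∷ size f₀ ∷ []) (χ 0 ⊠ (χ 1 ⊠ χ 2) ⩽ # 1 ⊞ χ 3)
        (χ 2 ⊠ (χ 0 ⊠ χ 1) ⩽ # 1 ⊞ χ 3) x≤
      n≤Λu : n ≤ suc Λ * (S * x)
      n≤Λu = linear (size f₀ ∷ Λ ∷ S ∷ x ∷ []) (# 1 ⊞ χ 0 ⩽ (# 1 ⊞ χ 1) ⊠ (χ 2 ⊠ χ 3))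
        ((# 1 ⊞ # 1 ⊞ χ 0) ⊞ χ 2 ⊠ χ 1 ⩽ (# 1 ⊞ χ 3) ⊠ (χ 1 ⊠ χ 2) ⊞ χ 2 ⊠ χ 3)
        (x> ⊕ S ⊛ Λ≤x)
      n≤Su : n ≤ S * (S * x)
      n≤Su = linear (size f₀ ∷ S ∷ x ∷ Λ ∷ K ∷ []) (# 1 ⊞ χ 0 ⩽ χ 1 ⊠ (χ 1 ⊠ χ 2))
        ((# 1 ⊞ χ 0) ⊞ χ 1 ⊠ χ 2 ⊠ ((# 1 ⊞ χ 3) ⊞ χ 4) ⩽ (# 1 ⊞ χ 3) ⊠ (χ 1 ⊠ χ 2) ⊞ χ 1 ⊠ χ 2 ⊠ χ 1)
        (n≤Λu ⊕ (S * x) ⊛ eq≥ S-def)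
      N≤Bx : N ≤ B * x
      N≤Bx = linear (N ∷ B ∷ x ∷ q″ ∷ K ∷ size f₀ ∷ Λ ∷ S ∷ []) (χ 0 ⩽ χ 1 ⊠ χ 2)
        (χ 0 ⊞ (# 1 ⊞ # 1 ⊞ χ 3) ⊠ χ 4 ⊠ (# 1 ⊞ χ 5) ⊞ χ 2 ⊠ ((# 1 ⊞ # 1 ⊞ χ 3) ⊠ (χ 4 ⊠ ((# 1 ⊞
          χ 6) ⊠ χ 7))) ⩽ (# 1 ⊞ # 1 ⊞ χ 3) ⊠ (χ 4 ⊠ (# 1 ⊞ χ 5)) ⊞ (# 1 ⊞ # 1 ⊞ χ 3) ⊠ χ 4 ⊠ ((# 1 ⊞
          χ 6) ⊠ (χ 7 ⊠ χ 2)) ⊞ χ 2 ⊠ χ 1)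
        (N≤ ⊕ (q * K) ⊛ n≤Λu ⊕ x ⊛ eq≥ B-def)
      S≤u : S ≤ S * x
      S≤u = linear (S ∷ x ∷ []) (χ 0 ⩽ χ 0 ⊠ χ 1) (χ 0 ⊠ # 1 ⩽ χ 0 ⊠ χ 1)
        (S ⊛ 1≤x)
      c≤u : c ≤ S * x
      c≤u = linear (c ∷ S ∷ x ∷ X₀ ∷ Λ ∷ B ∷ L q″ ∷ 2 ^ (S + K) ∷ 2 ^ (B + (L q″ * B + 2 ^ (S + K)) * B +
          2 ^ (S + K)) ∷ crowds L q″ 2 ∷ q″ ∷ K ∷ 2 ^ c ∷ [])
        (χ 0 ⩽ χ 1 ⊠ χ 2)
        (χ 3 ⊞ ((((χ 4 ⊞ # 1 ⊞ ((χ 5 ⊞ (χ 6 ⊠ χ 5 ⊞ χ 7) ⊠ χ 5) ⊞ χ 7) ⊠ # 1 ⊞ ((χ 8 ⊞ # 1 ⊠ χ 8) ⊠ # 1 ⊞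
          (χ 6 ⊠ χ 5 ⊞ χ 7) ⊠ ((χ 8 ⊞ # 1 ⊠ χ 8) ⊠ # 1)) ⊞ χ 9) ⊞ # 1 ⊞ # 1 ⊞ χ 10) ⊞ # 1 ⊞
          χ 0 ⊠ (χ 11 ⊠ χ 12)) ⊞ χ 0) ⊞ χ 2 ⩽ χ 2 ⊞ χ 3 ⊞ χ 1 ⊠ χ 2)
        (X₀≤x ⊕ eq≥ X₀-def ⊕ x≤u)
      2a₁K≤n : 2 * ((a₁ + K) * (S * x)) ≤ n
      2a₁K≤n = linear (a₁ ∷ K ∷ S ∷ x ∷ size f₀ ∷ Λ ∷ Λ₀ ∷ a₅ ∷ a₄ ∷ [])
        (# 2 ⊠ ((χ 0 ⊞ χ 1) ⊠ (χ 2 ⊠ χ 3)) ⩽ # 1 ⊞ χ 4)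
        (χ 5 ⊠ (χ 2 ⊠ χ 3) ⊞ χ 2 ⊠ χ 3 ⊠ (((χ 6 ⊠ χ 7 ⊞ # 2 ⊠ χ 8) ⊞ # 2 ⊠ (χ 0 ⊞ χ 1)) ⊞ # 1) ⩽ (# 1 ⊞ χ 4) ⊞
          χ 2 ⊠ χ 3 ⊠ χ 5)
        (Λu≤n ⊕ (S * x) ⊛ eq≥ Λ-def)
      hubs : Extraction.HubSystem G m₁ m₂ ms (suc q″) K (cong suc len) ms≤K noClique noMulti f₀ noTree S (a₁ * (S * x))
      hubs = Extraction.Build.build G m₁ m₂ ms (suc q″) K (cong suc len) ms≤K noClique noMulti f₀ noTree S B x (S * x) (a₁ * (S * x)) L
        1≤x ≤-refl n≤Su 1≤S N≤Bx (linear (q″ ∷ size f₀ ∷ N ∷ ρ ∷ [])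
          (# 1 ⊞ (# 1 ⊞ # 1 ⊞ χ 0) ⊠ χ 1 ⩽ χ 2)
          ((# 1 ⊞ (# 1 ⊞ # 1 ⊞ χ 0) ⊠ χ 3) ⊞ (# 1 ⊞ # 1 ⊞ χ 0) ⊠ χ 1 ⩽ χ 2 ⊞ (# 1 ⊞ # 1 ⊞ χ 0) ⊠ χ 3)
          (N≥ ⊕ q ⊛ n≤r)) refl 1≤L (λ m → ≤-refl)
        (linear (q″ ∷ K ∷ S ∷ x ∷ a₁ ∷ [])
          ((# 1 ⊞ # 1 ⊞ χ 0) ⊠ ((# 1 ⊞ χ 1) ⊠ (χ 2 ⊠ χ 3)) ⊞ # 2 ⊠ (χ 2 ⊠ χ 3) ⩽ χ 4 ⊠ (χ 2 ⊠ χ 3))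
          (χ 2 ⊠ χ 3 ⊠ ((# 1 ⊞ # 1 ⊞ χ 0) ⊠ (# 1 ⊞ χ 1) ⊞ # 2) ⩽ χ 2 ⊠ χ 3 ⊠ χ 4)
          ((S * x) ⊛ eq≥ a₁-def)) (linear (a₁ ∷ S ∷ x ∷ size f₀ ∷ K ∷ [])
            (# 1 ⊞ χ 0 ⊠ (χ 1 ⊠ χ 2) ⩽ # 1 ⊞ χ 3)
            (# 2 ⊠ ((χ 0 ⊞ χ 4) ⊠ (χ 1 ⊠ χ 2)) ⊞ χ 1 ⊠ χ 2 ⊠ # 1 ⊞ # 1 ⩽ (# 1 ⊞ χ 3) ⊞ χ 1 ⊠ χ 2 ⊠ χ 4 ⊞
              χ 1 ⊠ χ 2)
            (2a₁K≤n ⊕ (S * x) ⊛ 1≤K ⊕ 1≤u))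
        q 0 (+-identityʳ q) (λ ()) (λ ()) (λ ()) (linear (B ∷ L q″ ∷ 2 ^ (S + K) ∷ 2 ^ (B + (L q″ * B +
          2 ^ (S + K)) * B + 2 ^ (S + K)) ∷ crowds L q″ 2 ∷ q″ ∷ S ∷ x ∷ X₀ ∷ Λ ∷ c ∷ K ∷ 2 ^ c ∷ [])
          ((# 1 ⊞ ((χ 0 ⊞ (χ 1 ⊠ χ 0 ⊞ χ 2) ⊠ χ 0) ⊞ χ 2) ⊠ # 1 ⊞ ((χ 3 ⊞ # 1 ⊠ χ 3) ⊠ # 1 ⊞ (χ 1 ⊠ χ 0 ⊞
            χ 2) ⊠ ((χ 3 ⊞ # 1 ⊠ χ 3) ⊠ # 1)) ⊞ χ 4) ⊞ # 1 ⊞ # 1 ⊞ χ 5 ⩽ χ 6 ⊠ χ 7)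
          (χ 8 ⊞ ((((χ 9 ⊞ # 1 ⊞ ((χ 0 ⊞ (χ 1 ⊠ χ 0 ⊞ χ 2) ⊠ χ 0) ⊞ χ 2) ⊠ # 1 ⊞ ((χ 3 ⊞ # 1 ⊠ χ 3) ⊠ # 1 ⊞
            (χ 1 ⊠ χ 0 ⊞ χ 2) ⊠ ((χ 3 ⊞ # 1 ⊠ χ 3) ⊠ # 1)) ⊞ χ 4) ⊞ # 1 ⊞ # 1 ⊞ χ 5) ⊞ # 1 ⊞
            χ 10 ⊠ (χ 11 ⊠ χ 12)) ⊞ χ 10) ⊞ χ 7 ⩽ χ 7 ⊞ χ 8 ⊞ χ 6 ⊠ χ 7)
          (X₀≤x ⊕ eq≥ X₀-def ⊕ x≤u))
      skeleton : Skeleton G q n (a₅ * (S * x))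
      skeleton = Trimming.skeleton G m₁ m₂ ms (suc q″) K (cong suc len) ms≤K noClique noMulti f₀ noTree S (a₁ * (S * x)) (S * x)
        ((a₁ + K) * (S * x)) (a₂ * (S * x)) c (a₃ * (S * x)) (a₄ * (S * x)) (a₅ * (S * x)) B x hubs 1≤K
        (linear (K ∷ S ∷ Λ ∷ []) (χ 0 ⩽ χ 1) ((# 1 ⊞ χ 2) ⊞ χ 0 ⩽ χ 1) (eq≥ S-def)) n≤Su (*-mono-≤ {1} {a₁ +
          K} {1} {S * x} (linear (a₁ ∷ K ∷ [])
          (# 1 ⩽ χ 0 ⊞ χ 1) (# 1 ⩽ χ 1) 1≤K) 1≤u) 2a₁K≤n (linear (a₁ ∷ S ∷ x ∷ K ∷ [])
            (χ 0 ⊠ (χ 1 ⊠ χ 2) ⊞ χ 3 ⊠ (χ 1 ⊠ χ 2) ⩽ (χ 0 ⊞ χ 3) ⊠ (χ 1 ⊠ χ 2)) (# 0 ⩽ # 0)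
            (z≤n {0}))
        (linear (a₁ ∷ S ∷ x ∷ K ∷ a₂ ∷ [])
          ((χ 0 ⊠ (χ 1 ⊠ χ 2) ⊞ χ 1) ⊞ χ 3 ⊠ ((χ 0 ⊞ χ 3) ⊠ (χ 1 ⊠ χ 2)) ⩽ χ 4 ⊠ (χ 1 ⊠ χ 2))
          (χ 1 ⊞ χ 1 ⊠ χ 2 ⊠ ((χ 0 ⊞ # 1) ⊞ χ 3 ⊠ (χ 0 ⊞ χ 3)) ⩽ χ 1 ⊠ χ 2 ⊞ χ 1 ⊠ χ 2 ⊠ χ 4)
          (S≤u ⊕ (S * x) ⊛ eq≥ a₂-def)) N≤Bx
        (linear (K ∷ B ∷ x ∷ c ∷ 2 ^ c ∷ S ∷ X₀ ∷ Λ ∷ L q″ ∷ 2 ^ (S + K) ∷ 2 ^ (B + (L q″ * B + 2 ^ (S +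
          K)) * B + 2 ^ (S + K)) ∷ crowds L q″ 2 ∷ q″ ∷ [])
          (# 1 ⊞ χ 0 ⊠ (χ 1 ⊠ χ 2) ⊞ χ 3 ⊠ (χ 0 ⊠ χ 4) ⩽ χ 3 ⊠ (χ 5 ⊠ χ 2))
          (χ 6 ⊞ ((((χ 7 ⊞ # 1 ⊞ ((χ 1 ⊞ (χ 8 ⊠ χ 1 ⊞ χ 9) ⊠ χ 1) ⊞ χ 9) ⊠ # 1 ⊞ ((χ 10 ⊞ # 1 ⊠ χ 10) ⊠ # 1 ⊞
            (χ 8 ⊠ χ 1 ⊞ χ 9) ⊠ ((χ 10 ⊞ # 1 ⊠ χ 10) ⊠ # 1)) ⊞ χ 11) ⊞ # 1 ⊞ # 1 ⊞ χ 12) ⊞ # 1 ⊞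
            χ 3 ⊠ (χ 0 ⊠ χ 4)) ⊞ χ 3) ⊞ χ 2 ⊞ χ 5 ⊠ χ 2 ⊠ (# 1 ⊞ χ 0 ⊠ χ 1) ⊞ χ 0 ⊠ χ 1 ⊠ χ 2 ⩽ χ 2 ⊞ χ 6 ⊞
            χ 5 ⊠ χ 2 ⊞ χ 5 ⊠ χ 2 ⊠ χ 3 ⊞ χ 0 ⊠ χ 1 ⊠ (χ 5 ⊠ χ 2))
          (X₀≤x ⊕ eq≥ X₀-def ⊕ x≤u ⊕ (S * x) ⊛ eq≥ c-def ⊕ (K * B) ⊛ x≤u))
        (linear (a₁ ∷ S ∷ x ∷ q″ ∷ K ∷ a₂ ∷ c ∷ a₃ ∷ [])
          ((χ 0 ⊠ (χ 1 ⊠ χ 2) ⊞ (# 1 ⊞ χ 3) ⊠ χ 4 ⊠ (χ 5 ⊠ (χ 1 ⊠ χ 2))) ⊞ χ 6 ⩽ χ 7 ⊠ (χ 1 ⊠ χ 2))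
          (χ 6 ⊞ χ 1 ⊠ χ 2 ⊠ ((χ 0 ⊞ (# 1 ⊞ χ 3) ⊠ χ 4 ⊠ χ 5) ⊞ # 1) ⩽ χ 1 ⊠ χ 2 ⊞ χ 1 ⊠ χ 2 ⊠ χ 7)
          (c≤u ⊕ (S * x) ⊛ eq≥ a₃-def)) (linear (a₃ ∷ S ∷ x ∷ a₄ ∷ [])
            ((# 2 ⊞ χ 0 ⊠ (χ 1 ⊠ χ 2)) ⊞ χ 1 ⊠ χ 2 ⩽ χ 3 ⊠ (χ 1 ⊠ χ 2))
            (# 2 ⊠ # 1 ⊞ χ 1 ⊠ χ 2 ⊠ (χ 0 ⊞ # 3) ⩽ # 2 ⊠ (χ 1 ⊠ χ 2) ⊞ χ 1 ⊠ χ 2 ⊠ χ 3)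
            (2 ⊛ 1≤u ⊕ (S * x) ⊛ eq≥ a₄-def))
        (linear (a₄ ∷ S ∷ x ∷ size f₀ ∷ Λ ∷ Λ₀ ∷ a₅ ∷ a₁ ∷ K ∷ [])
          (# 2 ⊠ (χ 0 ⊠ (χ 1 ⊠ χ 2)) ⩽ # 1 ⊞ χ 3)
          (χ 4 ⊠ (χ 1 ⊠ χ 2) ⊞ χ 1 ⊠ χ 2 ⊠ (((χ 5 ⊠ χ 6 ⊞ # 2 ⊠ χ 0) ⊞ # 2 ⊠ (χ 7 ⊞ χ 8)) ⊞ # 1) ⩽ (# 1 ⊞
            χ 3) ⊞ χ 1 ⊠ χ 2 ⊠ χ 4)
          (Λu≤n ⊕ (S * x) ⊛ eq≥ Λ-def)) (linear (K ∷ a₄ ∷ S ∷ x ∷ a₅ ∷ a₃ ∷ [])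
            (χ 0 ⊠ (χ 1 ⊠ (χ 2 ⊠ χ 3)) ⩽ χ 4 ⊠ (χ 2 ⊠ χ 3))
            (χ 2 ⊠ χ 3 ⊠ ((χ 0 ⊠ χ 1 ⊞ χ 5) ⊞ # 1) ⩽ χ 2 ⊠ χ 3 ⊠ χ 4) ((S * x) ⊛ eq≥ a₅-def)) (linear (S ∷ x ∷
              a₅ ∷ K ∷ a₄ ∷ a₃ ∷ [])
              (χ 0 ⊠ χ 1 ⩽ χ 2 ⊠ (χ 0 ⊠ χ 1)) (χ 0 ⊠ χ 1 ⊠ ((χ 3 ⊠ χ 4 ⊞ χ 5) ⊞ # 1) ⩽ χ 0 ⊠ χ 1 ⊠ χ 2)
              ((S * x) ⊛ eq≥ a₅-def)) (linear (a₃ ∷ S ∷ x ∷ a₅ ∷ K ∷ a₄ ∷ [])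
                (χ 0 ⊠ (χ 1 ⊠ χ 2) ⩽ χ 3 ⊠ (χ 1 ⊠ χ 2))
                (χ 1 ⊠ χ 2 ⊠ ((χ 4 ⊠ χ 5 ⊞ χ 0) ⊞ # 1) ⩽ χ 1 ⊠ χ 2 ⊠ χ 3)
                ((S * x) ⊛ eq≥ a₅-def))
        (linear (q″ ∷ size f₀ ∷ X₀ ∷ Λ ∷ B ∷ L q″ ∷ 2 ^ (S + K) ∷ 2 ^ (B + (L q″ * B + 2 ^ (S + K)) * B +
          2 ^ (S + K)) ∷ crowds L q″ 2 ∷ c ∷ K ∷ 2 ^ c ∷ x ∷ S ∷ Λ₀ ∷ a₅ ∷ a₄ ∷ a₁ ∷ [])
          (# 1 ⊞ # 1 ⊞ χ 0 ⩽ # 1 ⊞ χ 1)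
          (χ 2 ⊞ ((((χ 3 ⊞ # 1 ⊞ ((χ 4 ⊞ (χ 5 ⊠ χ 4 ⊞ χ 6) ⊠ χ 4) ⊞ χ 6) ⊠ # 1 ⊞ ((χ 7 ⊞ # 1 ⊠ χ 7) ⊠ # 1 ⊞
            (χ 5 ⊠ χ 4 ⊞ χ 6) ⊠ ((χ 7 ⊞ # 1 ⊠ χ 7) ⊠ # 1)) ⊞ χ 8) ⊞ # 1 ⊞ # 1 ⊞ χ 0) ⊞ # 1 ⊞
            χ 9 ⊠ (χ 10 ⊠ χ 11)) ⊞ χ 9) ⊞ χ 12 ⊞ χ 3 ⊠ (χ 13 ⊠ χ 12) ⊞ χ 13 ⊠ χ 12 ⊠ (((χ 14 ⊠ χ 15 ⊞
            # 2 ⊠ χ 16) ⊞ # 2 ⊠ (χ 17 ⊞ χ 10)) ⊞ # 1) ⩽ χ 12 ⊞ χ 2 ⊞ χ 13 ⊠ χ 12 ⊞ (# 1 ⊞ χ 1) ⊞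
            χ 13 ⊠ χ 12 ⊠ χ 3)
          (X₀≤x ⊕ eq≥ X₀-def ⊕ x≤u ⊕ Λu≤n ⊕ (S * x) ⊛ eq≥ Λ-def))

    core : ⊥
    core with quotient n (Λ * S) 1≤ΛS
    ... | x , x≤ , x> = impossible x x≤ x>

-- Rooted forests with vertices labelled by Fin n

data LForest (n : ℕ) : Set where
  nil  : LForest n
  cons : (l : Fin n) (c s : LForest n) → LForest n

erase : ∀ {n} → LForest n → Forest
erase nil          = nil
erase (cons l c s) = cons (erase c) (erase s)

infix 4 _∈ᴸ_

data _∈ᴸ_ {n} (x : Fin n) : LForest n → Set where
  here  : ∀ {c s} → x ∈ᴸ cons x c s
  below : ∀ {l c s} → x ∈ᴸ c → x ∈ᴸ cons l c s
  later : ∀ {l c s} → x ∈ᴸ s → x ∈ᴸ cons l c s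

data Uniqueᴸ {n} : LForest n → Set where
  nil  : Uniqueᴸ nil
  cons : ∀ {l c s} → ¬ l ∈ᴸ c → ¬ l ∈ᴸ s → (∀ {x} → x ∈ᴸ c → x ∈ᴸ s → ⊥) → Uniqueᴸ c → Uniqueᴸ s →
         Uniqueᴸ (cons l c s)

-- `Parent r F x y`: x is the parent of y in the tree with root r and forest F below it.
data Parent {n} : Fin n → LForest n → Fin n → Fin n → Set where
  root  : ∀ {r l c s} → Parent r (cons l c s) r l
  below : ∀ {r l c s x y} → Parent l c x y → Parent r (cons l c s) x y
  later : ∀ {r l c s x y} → Parent r s x y → Parent r (cons l c s) x y

graft : ∀ {n} {u : Fin n} {F} → u ∈ᴸ F → Fin n → LForest n
graft {F = cons l c s} here      w = cons l (cons w nil c) s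
graft {F = cons l c s} (below p) w = cons l (graft p w) s
graft {F = cons l c s} (later p) w = cons l c (graft p w)

module _ {n} {u w : Fin n} where

  graft-size : ∀ {F} (p : u ∈ᴸ F) → size (erase (graft p w)) ≡ suc (size (erase F))
  graft-size here      = refl
  graft-size {cons l c s} (below p) = cong (λ k → suc (k + size (erase s))) (graft-size p)
  graft-size {cons l c s} (later p) = cong suc (trans (cong (size (erase c) +_) (graft-size p)) (+-suc _ _))

  graft-new : ∀ {F} (p : u ∈ᴸ F) → w ∈ᴸ graft p w
  graft-new here      = below here
  graft-new (below p) = below (graft-new p)
  graft-new (later p) = later (graft-new p)

  graft-old : ∀ {F x} (p : u ∈ᴸ F) → x ∈ᴸ F → x ∈ᴸ graft p w
  graft-old here      here      = here
  graft-old here      (below q) = below (later q)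
  graft-old here      (later q) = later q
  graft-old (below p) here      = here
  graft-old (below p) (below q) = below (graft-old p q)
  graft-old (below p) (later q) = later q
  graft-old (later p) here      = here
  graft-old (later p) (below q) = below q
  graft-old (later p) (later q) = later (graft-old p q)

  graft⁻ : ∀ {F x} (p : u ∈ᴸ F) → x ∈ᴸ graft p w → x ≡ w ⊎ x ∈ᴸ F
  graft⁻ here      here              = inj₂ here
  graft⁻ here      (below here)      = inj₁ refl
  graft⁻ here      (below (later q)) = inj₂ (below q)
  graft⁻ here      (later q)         = inj₂ (later q)
  graft⁻ (below p) here              = inj₂ here
  graft⁻ (below p) (below q) with graft⁻ p q
  ... | inj₁ e = inj₁ e
  ... | inj₂ r = inj₂ (below r)
  graft⁻ (below p) (later q)         = inj₂ (later q)
  graft⁻ (later p) here              = inj₂ here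
  graft⁻ (later p) (below q)         = inj₂ (below q)
  graft⁻ (later p) (later q) with graft⁻ p q
  ... | inj₁ e = inj₁ e
  ... | inj₂ r = inj₂ (later r)

  graft-unique : ∀ {F} (p : u ∈ᴸ F) → ¬ w ∈ᴸ F → Uniqueᴸ F → Uniqueᴸ (graft p w)
  graft-unique here w∉ (cons l∉c l∉s dis uc us) =
    cons (λ { here → w∉ here ; (later q) → l∉c q }) l∉s
      (λ { here q → w∉ (later q) ; (later p) q → dis p q })
      (cons (λ ()) (λ q → w∉ (below q)) (λ ()) nil uc) us
  graft-unique (below p) w∉ (cons l∉c l∉s dis uc us) =
    cons (λ q → [ (λ { refl → w∉ here }) , l∉c ]′ (graft⁻ p q)) l∉s
      (λ q r → [ (λ { refl → w∉ (later r) }) , (λ t → dis t r) ]′ (graft⁻ p q))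
      (graft-unique p (λ q → w∉ (below q)) uc) us
  graft-unique (later p) w∉ (cons l∉c l∉s dis uc us) =
    cons l∉c (λ q → [ (λ { refl → w∉ here }) , l∉s ]′ (graft⁻ p q))
      (λ q r → [ (λ { refl → w∉ (below q) }) , dis q ]′ (graft⁻ p r))
      uc (graft-unique p (λ q → w∉ (later q)) us)

  graft-parent : ∀ {F r x y} (p : u ∈ᴸ F) → Parent r F x y → Parent r (graft p w) x y
  graft-parent here      root      = root
  graft-parent here      (below q) = below (later q)
  graft-parent here      (later q) = later q
  graft-parent (below p) root      = root
  graft-parent (below p) (below q) = below (graft-parent p q)
  graft-parent (below p) (later q) = later q
  graft-parent (later p) root      = root
  graft-parent (later p) (below q) = below q
  graft-parent (later p) (later q) = later (graft-parent p q)

  graft-edge : ∀ {F r} (p : u ∈ᴸ F) → Parent r (graft p w) u w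
  graft-edge here      = below root
  graft-edge (below p) = below (graft-edge p)
  graft-edge (later p) = later (graft-edge p)

update : ∀ {n} {X : Set} → (Fin n → X) → Fin n → X → Fin n → X
update d l w x with x ≟ l
... | yes _ = w
... | no _  = d x

update-same : ∀ {n} {X : Set} (d : Fin n → X) l w → update d l w l ≡ w
update-same d l w with l ≟ l
... | yes _ = refl
... | no ne = ⊥-elim (ne refl)

update-other : ∀ {n} {X : Set} (d : Fin n → X) {l w x} → x ≢ l → update d l w x ≡ d x
update-other d {l} {w} {x} ne with x ≟ l
... | yes e = ⊥-elim (ne e)
... | no _  = refl

parent-∈ : ∀ {n r F} {x y : Fin n} → Parent r F x y → (x ≡ r ⊎ x ∈ᴸ F) × y ∈ᴸ F
parent-∈ root      = inj₁ refl , here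
parent-∈ (below p) with parent-∈ p
... | inj₁ refl , q = inj₂ here , below q
... | inj₂ x∈   , q = inj₂ (below x∈) , below q
parent-∈ (later p) with parent-∈ p
... | inj₁ e  , q = inj₁ e , later q
... | inj₂ x∈ , q = inj₂ (later x∈) , later q

module Placement {N} (G : BlueGraph N) where
  open Embedding G

  -- `d` holds the images of the labels outside `F`, in particular that of the parent of its roots.
  place : ∀ {n P v} (F : LForest n) → Emb P v (erase F) → (Fin n → Fin N) → Fin n → Fin N
  place nil          nil                                  d = d
  place (cons l c s) (cons w _ _ _ _ _ _ _ _ _ ec es) d = place c ec (place s es (update d l w))

  place-out : ∀ {n P v} F (e : Emb P v (erase F)) d {x : Fin n} → ¬ x ∈ᴸ F → place F e d x ≡ d x
  place-out nil nil d x∉ = refl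
  place-out (cons l c s) (cons w _ _ _ _ _ _ _ _ _ ec es) d x∉ =
    trans (place-out c ec _ (λ p → x∉ (below p))) (trans (place-out s es _ (λ p → x∉ (later p)))
      (update-other d λ { refl → x∉ here }))

  place-in : ∀ {n P v} F (e : Emb P v (erase F)) d {x : Fin n} → Uniqueᴸ F → x ∈ᴸ F → place F e d x ∈ P
  place-in {P = P} (cons l c s) (cons w A B w∈ r A⊆ B⊆ w∉A w∉B dis ec es) d (cons l∉c l∉s un uc us) here =
    subst (_∈ P) (sym (trans (place-out c ec _ l∉c) (trans (place-out s es _ l∉s) (update-same d l w)))) w∈
  place-in (cons l c s) (cons w A B w∈ r A⊆ B⊆ w∉A w∉B dis ec es) d (cons l∉c l∉s un uc us) (below p) =
    A⊆ (place-in c ec _ uc p)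
  place-in {P = P} (cons l c s) (cons w A B w∈ r A⊆ B⊆ w∉A w∉B dis ec es) d (cons l∉c l∉s un uc us) (later p) =
    subst (_∈ P) (sym (place-out c ec _ (λ q → un q p))) (B⊆ (place-in s es _ us p))

  place-injective : ∀ {n P v} F (e : Emb P v (erase F)) d {x y : Fin n} → Uniqueᴸ F → x ∈ᴸ F → y ∈ᴸ F →
                    place F e d x ≡ place F e d y → x ≡ y
  place-injective (cons l c s)
      (cons w A B w∈ r A⊆ B⊆ w∉A w∉B dis ec es) d (cons l∉c l∉s un uc us) x∈ y∈ eq = go x∈ y∈ eq
    where
    f = place c ec (place s es (update d l w))
    at-l : f l ≡ w
    at-l = trans (place-out c ec _ l∉c) (trans (place-out s es _ l∉s) (update-same d l w))
    at-s : ∀ {x} → x ∈ᴸ s → f x ≡ place s es (update d l w) x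
    at-s p = place-out c ec _ (λ q → un q p)
    in-A : ∀ {x} → x ∈ᴸ c → f x ∈ A
    in-A p = place-in c ec _ uc p
    in-B : ∀ {x} → x ∈ᴸ s → f x ∈ B
    in-B p = subst (_∈ B) (sym (at-s p)) (place-in s es _ us p)
    go : ∀ {x y} → x ∈ᴸ cons l c s → y ∈ᴸ cons l c s → f x ≡ f y → x ≡ y
    go here here _ = refl
    go here (below q) eq = ⊥-elim (w∉A (subst (_∈ A) (trans (sym eq) at-l) (in-A q)))
    go here (later q) eq = ⊥-elim (w∉B (subst (_∈ B) (trans (sym eq) at-l) (in-B q)))
    go (below p) here eq = ⊥-elim (w∉A (subst (_∈ A) (trans eq at-l) (in-A p)))
    go (later p) here eq = ⊥-elim (w∉B (subst (_∈ B) (trans eq at-l) (in-B p)))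
    go (below p) (later q) eq = ⊥-elim (dis (in-A p) (subst (_∈ B) (sym eq) (in-B q)))
    go (later p) (below q) eq = ⊥-elim (dis (subst (_∈ A) (sym eq) (in-A q)) (in-B p))
    go (below p) (below q) eq = place-injective c ec _ uc p q eq
    go (later p) (later q) eq = place-injective s es _ us p q (trans (sym (at-s p)) (trans eq (at-s q)))

  place-red : ∀ {n P v r} F (e : Emb P v (erase F)) d {x y : Fin n} → Uniqueᴸ F → ¬ r ∈ᴸ F → d r ≡ v →
              Parent r F x y → place F e d y ∉ b (place F e d x)
  place-red {v = v} {r} (cons l c s)
      (cons w A B w∈ red A⊆ B⊆ w∉A w∉B dis ec es) d (cons l∉c l∉s un uc us) r∉ dr = go
    where
    f = place c ec (place s es (update d l w))
    at-l′ : place s es (update d l w) l ≡ w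
    at-l′ = trans (place-out s es _ l∉s) (update-same d l w)
    at-r″ : update d l w r ≡ v
    at-r″ = trans (update-other d λ { refl → r∉ here }) dr
    at-r : f r ≡ v
    at-r = trans (place-out c ec _ (λ q → r∉ (below q))) (trans (place-out s es _ (λ q → r∉ (later q))) at-r″)
    at-s : ∀ {x} → x ∈ᴸ s → f x ≡ place s es (update d l w) x
    at-s p = place-out c ec _ (λ q → un q p)
    go : ∀ {x y} → Parent r (cons l c s) x y → f y ∉ b (f x)
    go root q = red (subst₂ (λ y x → y ∈ b x) (trans (place-out c ec _ l∉c) at-l′) at-r q)
    go (below t) q = place-red c ec _ uc l∉c at-l′ t q
    go (later t) q with parent-∈ t
    ... | inj₁ refl , py = place-red s es _ us (λ z → r∉ (later z)) at-r″ t
            (subst₂ (λ y x → y ∈ b x) (at-s py) (place-out c ec _ (λ z → r∉ (below z))) q)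
    ... | inj₂ px , py = place-red s es _ us (λ z → r∉ (later z)) at-r″ t (subst₂ (λ y x → y ∈ b x) (at-s py)
        (at-s px) q)

-- Every tree is a rooted forest

module Spanning {n} (T : Graph n) (tree : IsTree T) where
  open IsTree tree

  -- A vertex that is left is removed from the set, so paths are simple and can be closed to cycles
  -- with distinct vertices.
  data Path (S : VSet n) : Fin n → Fin n → Set where
    stop : ∀ {x} → x ∈ S → Path S x x
    go   : ∀ {x y z} → x ∈ S → Adj T x y → Path (S ∖ ⁅ x ⁆) y z → Path S x z

  Path-mono : ∀ {S S′ x y} → S ⊆ S′ → Path S x y → Path S′ x y
  Path-mono h (stop x∈)   = stop (h x∈)
  Path-mono h (go x∈ a p) = go (h x∈) a (Path-mono (∖-mono h) p)

  snoc : ∀ {S x u w} → w ∉ S → Adj T u w → Path S x u → Path (S ∪ ⁅ w ⁆) x w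
  snoc {S} {x} {w = w} w∉ a (stop x∈) = go (∪ˡ x∈) a
    (stop (∖⁺ (∪ʳ (∈⁅⁆ refl)) λ p → w∉ (subst (_∈ S) (⁅⁆⁻ p) x∈)))
  snoc {S} {x} {w = w} w∉ a (go x∈ a′ p) = go (∪ˡ x∈) a′ (Path-mono sub (snoc (λ q → w∉ (∖₁ q)) a p))
    where
    sub : (S ∖ ⁅ x ⁆) ∪ ⁅ w ⁆ ⊆ (S ∪ ⁅ w ⁆) ∖ ⁅ x ⁆
    sub q with ∪⁻ q
    ... | inj₁ r = ∖⁺ (∪ˡ (∖₁ r)) (∖₂ r)
    ... | inj₂ r = ∖⁺ (∪ʳ r) λ t → w∉ (subst (_∈ S) (trans (⁅⁆⁻ t) (sym (⁅⁆⁻ r))) x∈)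

  record Walk (S : VSet n) (x y : Fin n) (ℓ : ℕ) : Set where
    field
      vertex      : Fin (suc ℓ) → Fin n
      distinct    : Injective _≡_ _≡_ vertex
      inside      : ∀ i → vertex i ∈ S
      consecutive : ∀ i → Adj T (vertex (inject₁ i)) (vertex (suc i))
      start       : vertex zero ≡ x
      end         : vertex (fromℕ ℓ) ≡ y

  step : ∀ {S x y z ℓ} → x ∈ S → Adj T x y → Walk (S ∖ ⁅ x ⁆) y z ℓ → Walk S x z (suc ℓ)
  step {S} {x} x∈ a W = record
    { vertex = x ◂ vertex ; distinct = inj ; inside = λ { zero → x∈ ; (suc i) → ∖₁ (inside i) }
    ; consecutive = λ { zero → subst (Adj T x) (sym start) a ; (suc i) →
        consecutive i } ; start = refl ; end = end }
    where
    open Walk W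
    x≢ : ∀ i → x ≢ vertex i
    x≢ i e = ∖₂ (inside i) (∈⁅⁆ e)
    inj : Injective _≡_ _≡_ (x ◂ vertex)
    inj {zero}  {zero}  _ = refl
    inj {zero}  {suc j} e = ⊥-elim (x≢ j e)
    inj {suc i} {zero}  e = ⊥-elim (x≢ i (sym e))
    inj {suc i} {suc j} e = cong suc (distinct e)

  walk : ∀ {S x y} → Path S x y → ∃ (Walk S x y)
  walk {x = x} (stop x∈) = 0 , record { vertex = λ _ → x ; distinct = λ { {zero} {zero} _ →
      refl } ; inside = λ _ → x∈
                                      ; consecutive = λ () ; start = refl ; end = refl }
  walk (go x∈ a p) with walk p
  ... | ℓ , W = suc ℓ , step x∈ a W

  -- The path closed up through `w` is a cycle; it has at least three vertices because `u ≢ y`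
  -- forces the path to have an edge.
  no-chord : ∀ {S u y w} → w ∉ S → Adj T w u → Adj T w y → u ≢ y → Path S u y → ⊥
  no-chord {S} {w = w} w∉ wu wy u≢y p with walk p
  ... | zero , W  = u≢y (trans (sym (Walk.start W)) (Walk.end W))
  ... | suc ℓ , W = acyclic record { ℓ = ℓ ; vertex = Walk.vertex W′ ; distinct = Walk.distinct W′
      ; consecutive = Walk.consecutive W′ ; closing = symm T (subst (Adj T w) (sym (Walk.end W′)) wy) }
    where
    W′ : Walk (S ∪ ⁅ w ⁆) w _ (2 + ℓ)
    W′ = step (∪ʳ (∈⁅⁆ refl)) wu (record { Walk W ; inside = λ i → ∖⁺ (∪ˡ (Walk.inside W i)) λ q →
        w∉ (subst (_∈ S) (sym (⁅⁆⁻ q)) (Walk.inside W i)) })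

  -- `paths` is carried along for `no-chord`, which shows that a new vertex has only one neighbour
  -- in `S`; this preserves `edges`.
  record Grown (S : VSet n) : Set where
    field
      r      : Fin n
      F      : LForest n
      r∉     : ¬ r ∈ᴸ F
      unique : Uniqueᴸ F
      r∈S    : r ∈ S
      F⊆S    : ∀ {x} → x ∈ᴸ F → x ∈ S
      S⊆     : ∀ {x} → x ∈ S → x ≡ r ⊎ x ∈ᴸ F
      sized  : suc (size (erase F)) ≡ count S
      paths  : ∀ {x y} → x ∈ S → y ∈ S → Path S x y
      edges  : ∀ {x y} → x ∈ S → y ∈ S → Adj T x y → Parent r F x y ⊎ Parent r F y x

  grow : ∀ {S} → Grown S → ∀ {u w} → u ∈ S → w ∉ S → Adj T u w → Grown (S ∪ ⁅ w ⁆)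
  grow {S} g {u} {w} u∈ w∉ uw = record
    { r = r ; F = proj₁ new ; r∉ = proj₁ (proj₂ (proj₂ new)) ; unique = proj₁ (proj₂ (proj₂ (proj₂ new)))
    ; r∈S = ∪ˡ r∈S
    ; F⊆S = λ p → [ (λ { refl → ∪ʳ (∈⁅⁆ refl) }) , (λ q → ∪ˡ (F⊆S q)) ]′ (new⁻ p)
    ; S⊆ = λ p → [ (λ q → [ inj₁ , (λ t → inj₂ (old t)) ]′ (S⊆ q)) , (λ q → inj₂ (subst (_∈ᴸ proj₁ new)
        (⁅⁆⁻ q) here′)) ]′ (∪⁻ p)
    ; sized = trans (cong suc (proj₁ (proj₂ new))) (trans (cong suc sized) (≤-antisym (count-insert {A = S} w∉)
        (≤-trans (count-∪ S ⁅ w ⁆) (≤-reflexive (trans (cong (count S +_) (count-⁅⁆ w))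
          (+-comm (count S) 1))))))
    ; paths = paths′ ; edges = edges′ }
    where
    open Grown g
    w≢r : w ≢ r
    w≢r refl = w∉ r∈S
    w∉F : ¬ w ∈ᴸ F
    w∉F p = w∉ (F⊆S p)
    NewForest : LForest n → Set
    NewForest F′ = size (erase F′) ≡ suc (size (erase F)) × ¬ r ∈ᴸ F′ × Uniqueᴸ F′ × w ∈ᴸ F′ ×
      (∀ {x} → x ∈ᴸ F → x ∈ᴸ F′) × (∀ {x} → x ∈ᴸ F′ → x ≡ w ⊎ x ∈ᴸ F) ×
      (∀ {x y} → Parent r F x y → Parent r F′ x y) × Parent r F′ u w
    new : ∃ NewForest
    new with S⊆ u∈
    ... | inj₁ refl = cons w nil F , refl , (λ { here → w≢r refl ; (later p) → r∉ p })
      , cons (λ ()) w∉F (λ ()) nil unique , here , later , (λ { here → inj₁ refl ; (later p) → inj₂ p }) ,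
        later , root
    ... | inj₂ p = graft p w , graft-size p , (λ q → [ (λ e → w≢r (sym e)) , r∉ ]′ (graft⁻ p q))
      , graft-unique p w∉F unique , graft-new p , graft-old p , graft⁻ p , graft-parent p , graft-edge p
    here′ : w ∈ᴸ proj₁ new
    here′ = proj₁ (proj₂ (proj₂ (proj₂ (proj₂ new))))
    old : ∀ {x} → x ∈ᴸ F → x ∈ᴸ proj₁ new
    old = proj₁ (proj₂ (proj₂ (proj₂ (proj₂ (proj₂ new)))))
    new⁻ : ∀ {x} → x ∈ᴸ proj₁ new → x ≡ w ⊎ x ∈ᴸ F
    new⁻ = proj₁ (proj₂ (proj₂ (proj₂ (proj₂ (proj₂ (proj₂ new))))))
    par : ∀ {x y} → Parent r F x y → Parent r (proj₁ new) x y
    par = proj₁ (proj₂ (proj₂ (proj₂ (proj₂ (proj₂ (proj₂ (proj₂ new)))))))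
    edge : Parent r (proj₁ new) u w
    edge = proj₂ (proj₂ (proj₂ (proj₂ (proj₂ (proj₂ (proj₂ (proj₂ new)))))))
    from-w : ∀ {y} → y ∈ S → Path (S ∪ ⁅ w ⁆) w y
    from-w y∈ = go (∪ʳ (∈⁅⁆ refl)) (symm T uw)
      (Path-mono (λ p → ∖⁺ (∪ˡ p) λ q → w∉ (subst (_∈ S) (sym (⁅⁆⁻ q)) p)) (paths u∈ y∈))
    paths′ : ∀ {x y} → x ∈ S ∪ ⁅ w ⁆ → y ∈ S ∪ ⁅ w ⁆ → Path (S ∪ ⁅ w ⁆) x y
    paths′ x∈ y∈ with ∪⁻ x∈ | ∪⁻ y∈
    ... | inj₁ p | inj₁ q = Path-mono ∪ˡ (paths p q)
    ... | inj₁ p | inj₂ q with ⁅⁆⁻ q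
    ...   | refl = snoc w∉ uw (paths p u∈)
    paths′ x∈ y∈ | inj₂ p | inj₁ q with ⁅⁆⁻ p
    ...   | refl = from-w q
    paths′ x∈ y∈ | inj₂ p | inj₂ q with ⁅⁆⁻ p | ⁅⁆⁻ q
    ...   | refl | refl = stop (∪ʳ (∈⁅⁆ refl))
    w-edge : ∀ {y} → y ∈ S → Adj T w y → y ≡ u
    w-edge {y} y∈ wy with u ≟ y
    ... | yes e = sym e
    ... | no ne = ⊥-elim (no-chord w∉ (symm T uw) wy ne (paths u∈ y∈))
    edges′ : ∀ {x y} → x ∈ S ∪ ⁅ w ⁆ → y ∈ S ∪ ⁅ w ⁆ → Adj T x y →
        Parent r (proj₁ new) x y ⊎ Parent r (proj₁ new) y x
    edges′ x∈ y∈ a with ∪⁻ x∈ | ∪⁻ y∈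
    ... | inj₁ p | inj₁ q = [ (λ t → inj₁ (par t)) , (λ t → inj₂ (par t)) ]′ (edges p q a)
    ... | inj₁ p | inj₂ q with ⁅⁆⁻ q
    ...   | refl with w-edge p (symm T a)
    ...     | refl = inj₁ edge
    edges′ x∈ y∈ a | inj₂ p | inj₁ q with ⁅⁆⁻ p
    ...   | refl with w-edge q a
    ...     | refl = inj₂ edge
    edges′ x∈ y∈ a | inj₂ p | inj₂ q with ⁅⁆⁻ p | ⁅⁆⁻ q
    ...   | refl | refl = ⊥-elim (irrefl T refl a)

  crossing : ∀ {S x y} → Star (Adj T) x y → x ∈ S → y ∉ S → ∃₂ λ u w → u ∈ S × w ∉ S × Adj T u w
  crossing ε x∈ y∉ = ⊥-elim (y∉ x∈)
  crossing {S} {x} (_◅_ {j = z} a as) x∈ y∉ with z ∈? S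
  ... | inj₁ z∈ = crossing as z∈ y∉
  ... | inj₂ z∉ = x , z , x∈ , z∉ , a

  saturate : ∀ k {S} → Grown S → n ≤ count S + k → ∃ λ S → Grown S × (∀ x → x ∈ S)
  saturate k {S} g h with 1 ≤? count (full ∖ S)
  ... | no ¬p = S , g , λ x → [ (λ p → p) , (λ p → ⊥-elim (¬p (count-pos (∖⁺ ∈full p)))) ]′ (x ∈? S)
  ... | yes p with inhabited p
  saturate zero {S} g h | yes p | y , y∈ = ⊥-elim (1≰0 (linear (n ∷ count ((full ∖ S) ∪ S) ∷
      count (full ∖ S) ∷ count S ∷ count full ∷ [])
    (# 1 ⩽ # 0) (# 1 ⊞ χ 0 ⊞ χ 1 ⊞ (χ 2 ⊞ χ 3) ⊞ χ 4 ⩽ χ 2 ⊞ (χ 3 ⊞ # 0) ⊞ χ 4 ⊞ χ 1 ⊞ χ 0)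
    (p ⊕ h ⊕ count-mono {A = (full ∖ S) ∪ S} {full} (λ _ → ∈full) ⊕
    count-⊎ (full ∖ S) S ∖₂ ⊕ eq≤ (count-full {n}))))
  saturate (suc k) {S} g h | yes p | y , y∈ with crossing (connected (Grown.r g) y) (Grown.r∈S g) (∖₂ y∈)
  ... | u , w , u∈ , w∉ , a = saturate k (grow g u∈ w∉ a) (linear (n ∷ count (S ∪ ⁅ w ⁆) ∷ k ∷ count S ∷ [])
    (χ 0 ⩽ χ 1 ⊞ χ 2) (χ 0 ⊞ # 1 ⊞ χ 3 ⩽ (χ 3 ⊞ # 1 ⊞ χ 2) ⊞ χ 1) (h ⊕ count-insert {A = S} w∉))

  seed : Fin n → ∃ Grown
  seed r = ⁅ r ⁆ , record
    { r = r ; F = nil ; r∉ = λ () ; unique = nil ; r∈S = ∈⁅⁆ refl ; F⊆S = λ () ; S⊆ = λ p → inj₁ (sym (⁅⁆⁻ p))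
    ; sized = sym (count-⁅⁆ r)
    ; paths = λ p q → subst₂ (Path _) (⁅⁆⁻ p) (⁅⁆⁻ q) (stop (∈⁅⁆ refl))
    ; edges = λ p q a → ⊥-elim (irrefl T (trans (sym (⁅⁆⁻ p)) (⁅⁆⁻ q)) a) }

  vertex₀ : ∀ {n} → 1 ≤ n → Fin n
  vertex₀ (s≤s _) = zero

  spanning : ∃ λ S → Grown S × (∀ x → x ∈ S)
  spanning = saturate n (proj₂ (seed (vertex₀ nonempty))) (m≤n+m n _)

  shape : Forest
  shape = erase (Grown.F (proj₁ (proj₂ spanning)))

  shape-size : suc (size shape) ≡ n
  shape-size = trans (Grown.sized g) (≤-antisym
      (≤-trans (count-mono {B = full} (λ _ → ∈full)) (≤-reflexive count-full))
      (≤-trans (≤-reflexive (sym count-full)) (count-mono {A = full} (λ {x} _ → proj₂ (proj₂ spanning) x))))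
    where
    g = proj₁ (proj₂ spanning)

  embeds : ∀ {N} (G : BlueGraph N) → Embedding.Rooted G shape →
           ∃ λ (f : Fin n → Fin N) → Injective _≡_ _≡_ f × (∀ x y → Adj T x y → f y ∉ BlueGraph.b G (f x))
  embeds G (v , P , v∉P , e) = f , inj , red
    where
    open Placement G
    open Embedding G using (bsym)
    g = proj₁ (proj₂ spanning)
    open Grown g
    all∈ : ∀ x → x ∈ _
    all∈ = proj₂ (proj₂ spanning)
    f : Fin n → Fin _
    -- Only the root `r` has no place in `F`, so the default value is its image.
    f = place F e (λ _ → v)
    f-r : f r ≡ v
    f-r = place-out F e (λ _ → v) r∉
    inj : Injective _≡_ _≡_ f
    inj {x} {y} eq with S⊆ (all∈ x) | S⊆ (all∈ y)
    ... | inj₁ refl | inj₁ refl = refl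
    ... | inj₁ refl | inj₂ q    = ⊥-elim (v∉P (subst (_∈ P) (trans (sym eq) f-r) (place-in F e _ unique q)))
    ... | inj₂ p    | inj₁ refl = ⊥-elim (v∉P (subst (_∈ P) (trans eq f-r) (place-in F e _ unique p)))
    ... | inj₂ p    | inj₂ q    = place-injective F e _ unique p q eq
    red : ∀ x y → Adj T x y → f y ∉ BlueGraph.b G (f x)
    red x y a with edges (all∈ x) (all∈ y) a
    ... | inj₁ p = place-red F e _ unique r∉ refl p
    ... | inj₂ p = λ q → place-red F e _ unique r∉ refl p (bsym q)

open import Defs
open import Data.Product.Base using (∃-syntax)

-- Edge colourings

fromGraph : ∀ {N} → Graph N → BlueGraph N
fromGraph G = record { b = λ x y → does (Adj? G x y) ; b-sym = b-sym ; b-irr = b-irr }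
  where
  b-sym : ∀ x y → does (Adj? G x y) ≡ does (Adj? G y x)
  b-sym x y with Adj? G x y | Adj? G y x
  ... | yes _ | yes _ = refl
  ... | no _  | no _  = refl
  ... | yes p | no ¬q = ⊥-elim (¬q (symm G p))
  ... | no ¬p | yes q = ⊥-elim (¬p (symm G q))
  b-irr : ∀ x → does (Adj? G x x) ≡ false
  b-irr x with Adj? G x x
  ... | yes p = ⊥-elim (irrefl G refl p)
  ... | no _  = refl

module _ {N} (G : Graph N) where
  open BlueGraph (fromGraph G)

  adj⁺ : ∀ {x y} → Adj G x y → y ∈ b x
  adj⁺ {x} {y} p with Adj? G x y in eq
  ... | yes _ = mem (cong does eq)
  ... | no ¬p = ⊥-elim (¬p p)

  adj⁻ : ∀ {x y} → y ∈ b x → Adj G x y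
  adj⁻ {x} {y} (mem p) with Adj? G x y
  ... | yes q = q

_⊑?_ : ∀ {m n} (J : Graph m) (G : Graph n) → Dec (J ⊑ G)
_⊑?_ {m} {n} J G = map′ (λ (k , p) → finToFun k , p) (λ (f , p) → funToFin f , respects (λ i →
    sym (finToFun-funToFin f i)) p)
    (any? λ k → copy? (finToFun k))
  where
  Copy : (Fin m → Fin n) → Set
  Copy f = Injective _≡_ _≡_ f × (∀ u v → Adj J u v → Adj G (f u) (f v))
  respects : ∀ {f g} → f ≗ g → Copy f → Copy g
  respects e (inj , hom) = (λ {u} {v} h → inj (trans (e u) (trans h (sym (e v))))) ,
    λ u v uv → subst₂ (Adj G) (e u) (e v) (hom u v uv)
  copy? : ∀ f → Dec (Copy f)
  copy? f = map′ (λ h {u} {v} → h u v) (λ h u v → h {u} {v}) (all? λ u → all? λ v → (f u ≟ f v) →-dec (u ≟ v))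
    ×-dec (all? λ u → all? λ v → Adj? J u v →-dec Adj? G (f u) (f v))

multi⇒copy : ∀ {N} (H : Graph N) ms {P} → Multipartite.Multi (fromGraph H) ms P →
  ∃ λ (f : Fin (sumᴸ ms) → Fin N) → Injective _≡_ _≡_ f × (∀ v → f v ∈ P) ×
    (∀ u v → part ms u ≢ part ms v → Adj H (f u) (f v))
multi⇒copy H [] Multipartite.[] = (λ ()) , (λ { {()} }) , (λ ()) , λ ()
multi⇒copy {N} H (m ∷ ms) {P} (Multipartite.step A P′ A⊆ cA P′⊆ bl M) with enumerate m A cA | multi⇒copy H ms M
... | g , g-inj , g∈ | h , h-inj , h∈ , h-adj = f , f-inj , f∈ , f-adj
  where
  g≢h : ∀ i j → g i ≢ h j
  g≢h i j e = Embedding.birr (fromGraph H) (subst (λ x → x ∈ BlueGraph.b (fromGraph H) (g i)) (sym e)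
      (bl (g∈ i) (h∈ j)))
  f : Fin (m + sumᴸ ms) → Fin N
  f v = [ g , h ]′ (splitAt m v)
  on : ∀ {u v} → [ g , h ]′ u ≡ [ g , h ]′ v → u ≡ v
  on {inj₁ i} {inj₁ j} e = cong inj₁ (g-inj e)
  on {inj₁ i} {inj₂ j} e = ⊥-elim (g≢h i j e)
  on {inj₂ i} {inj₁ j} e = ⊥-elim (g≢h j i (sym e))
  on {inj₂ i} {inj₂ j} e = cong inj₂ (h-inj e)
  f-inj : Injective _≡_ _≡_ f
  f-inj {u} {v} e = trans (sym (join-splitAt m _ u)) (trans (cong (joinFin m _)
      (on {splitAt m u} {splitAt m v} e)) (join-splitAt m _ v))
  f∈ : ∀ v → f v ∈ P
  f∈ v with splitAt m v
  ... | inj₁ i = A⊆ (g∈ i)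
  ... | inj₂ j = P′⊆ (h∈ j)
  f-adj : ∀ u v → part (m ∷ ms) u ≢ part (m ∷ ms) v → Adj H (f u) (f v)
  f-adj u v ne with splitAt m u | splitAt m v
  ... | inj₁ i | inj₁ j = ⊥-elim (ne refl)
  ... | inj₁ i | inj₂ j = adj⁻ H (bl (g∈ i) (h∈ j))
  ... | inj₂ i | inj₁ j = symm H (adj⁻ H (bl (g∈ j) (h∈ i)))
  ... | inj₂ i | inj₂ j = h-adj i j λ e → ne (cong suc e)

multi⇒⊑ : ∀ {N} (H : Graph N) ms {P} → Multipartite.Multi (fromGraph H) ms P → completeMultipartite ms ⊑ H
multi⇒⊑ H ms M with multi⇒copy H ms M
... | f , inj , _ , adj = f , inj , adj

module _ {n} (T : Graph n) (tree : IsTree T) where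
  open Spanning T tree

  rooted⇒⊑ : ∀ {N} (c : EdgeColouring N) → Embedding.Rooted (fromGraph (colourClass c blue)) shape →
      T ⊑ colourClass c red
  rooted⇒⊑ c t with embeds (fromGraph (colourClass c blue)) t
  ... | f , inj , notBlue = f , inj , λ u v uv → edge (λ e → irrefl T (inj e) uv) (notBlue u v uv)
    where
    edge : ∀ {x y} → x ≢ y → y ∉ BlueGraph.b (fromGraph (colourClass c blue)) x → Adj (colourClass c red) x y
    edge {x} {y} x≢y y∉ with colour c x y in eq
    ... | red  = x≢y , refl
    ... | blue = ⊥-elim (y∉ (adj⁺ (colourClass c blue) (x≢y , eq)))

  -- Chvátal's argument with the whole tree as the piece. The linear bound makes `N` at most a
  -- constant multiple of `n`, on which the choice of `B` rests.
  arrows-linear : ∀ ms → Arrows (total ms * n) T (completeMultipartite ms)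
  arrows-linear ms c with Embedding.tree-or-clique (fromGraph (colourClass c blue)) (total ms) n full shape
                            (≤-reflexive shape-size) (≤-reflexive (sym count-full))
  ... | inj₁ K = inj₂ (multi⇒⊑ (colourClass c blue) ms (Multipartite.clique⇒multi _ ms full K))
  ... | inj₂ (w , P , _ , _ , w∉ , _ , e) = inj₁ (rooted⇒⊑ c (w , P , w∉ , e))

module _ (m₁ m₂ : ℕ) where

  left : Fin m₁ → Fin (sumᴸ (m₁ ∷ m₂ ∷ []))
  left i = i ↑ˡ (m₂ + 0)

  right : Fin m₂ → Fin (sumᴸ (m₁ ∷ m₂ ∷ []))
  right j = m₁ ↑ʳ (j ↑ˡ 0)

  across : ∀ i j → part (m₁ ∷ m₂ ∷ []) (left i) ≢ part (m₁ ∷ m₂ ∷ []) (right j)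
  across i j e rewrite splitAt-↑ˡ m₁ i (m₂ + 0) | splitAt-↑ʳ m₁ (m₂ + 0) (j ↑ˡ 0) = 0≢1+n e

  left-injective : Injective _≡_ _≡_ left
  left-injective {i} {j} = ↑ˡ-injective (m₂ + 0) i j

  right-injective : Injective _≡_ _≡_ right
  right-injective {i} {j} e = ↑ˡ-injective 0 i j (↑ʳ-injective m₁ (i ↑ˡ 0) (j ↑ˡ 0) e)

  -- The colouring with all edges red has no blue `K_{m₁,m₂}`, as this graph has an edge; so the
  -- tree itself must fit.
  order≤ : ∀ {n r} (T : Graph n) → 1 ≤ m₁ → 1 ≤ m₂ → Arrows r T (completeMultipartite (m₁ ∷ m₂ ∷ [])) → n ≤ r
  order≤ T (s≤s _) (s≤s _) arr with arr (record { colour = λ _ _ → red ; colour-sym = λ _ _ → refl })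
  ... | inj₁ (f , inj , _) = injective⇒≤ inj
  ... | inj₂ (f , inj , hom) with hom (left zero) (right zero) (across zero zero)
  ...   | _ , ()

  bipartite : ∀ {n N r} (T : Graph n) (c : EdgeColouring N) → ¬ T ⊑ colourClass c red →
    Arrows r T (completeMultipartite (m₁ ∷ m₂ ∷ [])) → ∀ U → r ≤ count U →
    ∃₂ λ A₁ A₂ → A₁ ⊆ U × A₂ ⊆ U × count A₁ ≡ m₁ × count A₂ ≡ m₂ ×
      (∀ {x y} → x ∈ A₁ → y ∈ A₂ → y ∈ BlueGraph.b (fromGraph (colourClass c blue)) x)
  bipartite {r = r} T c noT arr U hU with enumerate r U hU
  ... | g , g-inj , g∈ with arr (record { colour = λ i j → colour c (g i) (g j) ; colour-sym = λ i j →
      colour-sym c (g i) (g j) })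
  ...   | inj₁ (f , inj , hom) = ⊥-elim (noT ((λ v → g (f v)) , (λ e → inj (g-inj e)) ,
          λ u v uv → let ne , eq = hom u v uv in (λ e → ne (g-inj e)) , eq))
  ...   | inj₂ (f , inj , hom)
    with subset-of-size (image (λ i → g (f (left i)))) m₁ (count-image _ (λ e → left-injective (inj (g-inj e))))
       | subset-of-size (image (λ j → g (f (right j)))) m₂ (count-image _ (λ e →
         right-injective (inj (g-inj e))))
  ...     | A₁ , A₁⊆ , cA₁ | A₂ , A₂⊆ , cA₂ = A₁ , A₂ , inside (λ i → f (left i)) A₁⊆ , inside (λ j →
      f (right j)) A₂⊆ , cA₁ , cA₂ , bl
    where
    inside : ∀ {m} (k : Fin m → Fin r) {A} → A ⊆ image (λ i → g (k i)) → A ⊆ U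
    inside k A⊆ p with image⁻ (λ i → g (k i)) (A⊆ p)
    ... | i , refl = g∈ (k i)
    bl : ∀ {x y} → x ∈ A₁ → y ∈ A₂ → y ∈ BlueGraph.b (fromGraph (colourClass c blue)) x
    bl x∈ y∈ with image⁻ (λ i → g (f (left i))) (A₁⊆ x∈) | image⁻ (λ j → g (f (right j))) (A₂⊆ y∈)
    ... | i , refl | j , refl with hom (left i) (right j) (across i j)
    ...   | ne , eq = adj⁺ (colourClass c blue) ((λ e → ne (g-inj e)) , eq)

module _ (m₁ m₂ m₃ : ℕ) (ms : List ℕ) (1≤m₁ : 1 ≤ m₁) (1≤m₂ : 1 ≤ m₂) where
  open Core m₁ m₂ m₃ ms (length ms) refl 1≤m₁ using (threshold; core; K; K-def)

  arrows-bound : ∀ {n} → threshold ≤ n → (T : Graph n) → IsTree T → ∀ ρ →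
    IsRamseyNumber T (completeMultipartite (m₁ ∷ m₂ ∷ [])) (suc ρ) →
    Arrows (suc ((2 + length ms) * ρ)) T (completeMultipartite (m₁ ∷ m₂ ∷ m₃ ∷ ms))
  arrows-bound {n} n≥ T tree ρ (arr , least) c with T ⊑? colourClass c red | completeMultipartite (m₁ ∷ m₂ ∷
      m₃ ∷ ms) ⊑? colourClass c blue
  ... | yes p | _     = inj₁ p
  ... | no _  | yes p = inj₂ p
  ... | no noT | no noK = ⊥-elim (core (fromGraph (colourClass c blue)) shape
      (≤-trans n≥ (≤-reflexive (sym shape-size))) ρ (≤-pred (≤-trans (≤-reflexive shape-size)
        (order≤ m₁ m₂ T 1≤m₁ 1≤m₂ arr)))
      (upper (length ms) (suc (size shape)) (least _ (arrows-linear T tree (m₁ ∷ m₂ ∷ []))) shape-size) ≤-refl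
      (λ t → noT (rooted⇒⊑ T tree c t)) (λ M → noK (multi⇒⊑ (colourClass c blue) (m₁ ∷ m₂ ∷ m₃ ∷ ms) M))
      (bipartite m₁ m₂ T c noT arr))
    where
    open Spanning T tree
    upper : ∀ q s → suc ρ ≤ (m₁ + (m₂ + 0)) * n → s ≡ n → suc ((2 + q) * ρ) ≤ (2 + q) * (K * s)
    upper q s h refl = linear (q ∷ ρ ∷ K ∷ s ∷ m₁ ∷ m₂ ∷ m₃ ∷ total ms ∷ [])
      (# 1 ⊞ (# 2 ⊞ χ 0) ⊠ χ 1 ⩽ (# 2 ⊞ χ 0) ⊠ (χ 2 ⊠ χ 3))
      ((# 2 ⊞ χ 0) ⊠ (# 1 ⊞ χ 1) ⊞ (# 2 ⊞ χ 0) ⊠ χ 3 ⊠ (χ 4 ⊞ χ 5 ⊞ χ 6 ⊞ χ 7) ⩽ (# 2 ⊞ χ 0) ⊠ ((χ 4 ⊞ χ 5 ⊞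
        # 0) ⊠ χ 3) ⊞ (# 2 ⊞ χ 0) ⊠ χ 3 ⊠ χ 2)
      ((2 + q) ⊛ h ⊕ (2 + q) * s ⊛ eq≥ K-def)

theorem1p1 : (m₁ m₂ : ℕ) (ms : List ℕ) →
  let m = m₁ ∷ m₂ ∷ ms
      k = length m
  in 1 ≤ m₁ → Linked _≤_ m →
     ∃[ n₀ ] (∀ n → n₀ ≤ n → (T : Graph n) → IsTree T →
       R T (completeMultipartite m)
         ≤ (k ∸ 1) * (R T (completeMultipartite (m₁ ∷ m₂ ∷ [])) ∸ 1) + m₁)
-- For `k = 2` both sides contain the same Ramsey number, so `1 ≤ m₁` is enough.
theorem1p1 m₁ m₂ [] 1≤m₁ _ = 0 , λ n _ T _ → bound (R T (completeMultipartite (m₁ ∷ m₂ ∷ [])))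
  where
  bound : ∀ r → r ≤ 1 * (r ∸ 1) + m₁
  bound r = linear (r ∷ r ∸ 1 ∷ m₁ ∷ []) (χ 0 ⩽ # 1 ⊠ χ 1 ⊞ χ 2) (χ 0 ⊞ # 1 ⩽ (# 1 ⊞ χ 1) ⊞ χ 2)
    (m≤n+m∸n r 1 ⊕ 1≤m₁)
theorem1p1 m₁ m₂ (m₃ ∷ ms) 1≤m₁ (m₁≤m₂ ∷ _) = Core.threshold m₁ m₂ m₃ ms (length ms) refl 1≤m₁ ,
  λ n n≥ T tree → bound n n≥ T tree (ramseyNumber T (completeMultipartite (m₁ ∷ m₂ ∷ [])))
  where
  1≤m₂ : 1 ≤ m₂
  1≤m₂ = ≤-trans 1≤m₁ m₁≤m₂
  bound : ∀ n → Core.threshold m₁ m₂ m₃ ms (length ms) refl 1≤m₁ ≤ n → (T : Graph n) → IsTree T →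
    (r : ∃ (IsRamseyNumber T (completeMultipartite (m₁ ∷ m₂ ∷ [])))) →
    R T (completeMultipartite (m₁ ∷ m₂ ∷ m₃ ∷ ms)) ≤ (2 + length ms) * (proj₁ r ∸ 1) + m₁
  -- The truncated subtraction is harmless: the Ramsey number is at least the order of the tree,
  -- hence positive.
  bound n n≥ T tree (zero , arr , least) =
    ⊥-elim (1≰0 (≤-trans (IsTree.nonempty tree) (order≤ m₁ m₂ T 1≤m₁ 1≤m₂ arr)))
  bound n n≥ T tree (suc ρ , ramsey) = ≤-trans
    (proj₂ (proj₂ (ramseyNumber T (completeMultipartite (m₁ ∷ m₂ ∷ m₃ ∷ ms)))) _
      (arrows-bound m₁ m₂ m₃ ms 1≤m₁ 1≤m₂ n≥ T tree ρ ramsey))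
    (≤-trans (≤-reflexive (sym (+-comm _ 1))) (+-monoʳ-≤ ((2 + length ms) * ρ) 1≤m₁))
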